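{- Let $\zeta_5$ be a primitive fifth root of unity, $c=\zeta_5+\zeta_5^4$, and let $$PP_3(z,q)=\sum_{n=1}^\infty \frac{q^{n^2+n}(q^{2n+1};q)_\infty}{(zq^n;q)_\infty(z^{ -1}q^n;q)_\infty}.$$ Then $$PP_3(\zeta_5,q)=(q^{25};q^{25})_\infty\Big(-q^5\frac{[q^{10};q^{75}]_\infty}{[q^5,q^{20},q^{25},q^{30};q^{75}]_\infty}-c\,q^6\frac{1}{[q^{15},q^{25},q^{35};q^{75}]_\infty}+(1+c)q^2\frac{1}{[q^{10};q^{25}]_\infty}$$ $$-c\,q^2\frac{1}{[q^5,q^{25},q^{30};q^{75}]_\infty}-q^8\frac{[q^5;q^{75}]_\infty}{[q^{10},q^{15},q^{25},q^{35};q^{75}]_\infty}+c\,q^3\frac{[q^{20};q^{75}]_\infty}{[q^{10},q^{15},q^{25},q^{35};q^{75}]_\infty}\Big).$$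
   Context: $(a;q)_\infty=\prod_{j\ge0}(1-aq^j)$; $[z;q]_\infty=(z;q)_\infty(q/z;q)_\infty$ and $[z_1,\dots,z_k;q]_\infty=[z_1;q]_\infty\cdots[z_k;q]_\infty$. -}

module Defs where

open import Data.Nat as ℕ using (ℕ; zero; suc; _∸_; _≤?_; _≡ᵇ_)
open import Data.Integer as ℤ using (ℤ; +_; -[1+_])
open import Data.Bool using (if_then_else_)
open import Relation.Nullary.Decidable using (⌊_⌋)
open import Relation.Binary.PropositionalEquality using (_≡_)

-- The ring Z[ζ] = Z[x]/(1+x+x²+x³+x⁴), ζ a primitive fifth root of unity.
-- Element  mk a0 a1 a2 a3  represents  a0 + a1 ζ + a2 ζ² + a3 ζ³
-- (canonical form: {1,ζ,ζ²,ζ³} is a Z-basis), so _≡_ is the ring equality.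

record Zζ : Set where
  constructor mk
  field
    c0 c1 c2 c3 : ℤ

open Zζ public

0R 1R ζ : Zζ
0R = mk (+ 0) (+ 0) (+ 0) (+ 0)
1R = mk (+ 1) (+ 0) (+ 0) (+ 0)
ζ  = mk (+ 0) (+ 1) (+ 0) (+ 0)

infixl 6 _+R_ _-R_
infixl 7 _*R_

_+R_ : Zζ → Zζ → Zζ
mk a0 a1 a2 a3 +R mk b0 b1 b2 b3 =
  mk (a0 ℤ.+ b0) (a1 ℤ.+ b1) (a2 ℤ.+ b2) (a3 ℤ.+ b3)

-R_ : Zζ → Zζ
-R mk a0 a1 a2 a3 = mk (ℤ.- a0) (ℤ.- a1) (ℤ.- a2) (ℤ.- a3)

_-R_ : Zζ → Zζ → Zζ
x -R y = x +R (-R y)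

-- multiplication: convolve, then reduce with ζ⁴ = -1-ζ-ζ²-ζ³, ζ⁵ = 1, ζ⁶ = ζ
_*R_ : Zζ → Zζ → Zζ
mk a0 a1 a2 a3 *R mk b0 b1 b2 b3 =
  let e0 = a0 ℤ.* b0
      e1 = a0 ℤ.* b1 ℤ.+ a1 ℤ.* b0
      e2 = a0 ℤ.* b2 ℤ.+ a1 ℤ.* b1 ℤ.+ a2 ℤ.* b0
      e3 = a0 ℤ.* b3 ℤ.+ a1 ℤ.* b2 ℤ.+ a2 ℤ.* b1 ℤ.+ a3 ℤ.* b0
      e4 = a1 ℤ.* b3 ℤ.+ a2 ℤ.* b2 ℤ.+ a3 ℤ.* b1
      e5 = a2 ℤ.* b3 ℤ.+ a3 ℤ.* b2
      e6 = a3 ℤ.* b3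
  in mk (e0 ℤ.+ e5 ℤ.- e4) (e1 ℤ.+ e6 ℤ.- e4) (e2 ℤ.- e4) (e3 ℤ.- e4)

_^R_ : Zζ → ℕ → Zζ
x ^R zero  = 1R
x ^R suc n = x *R (x ^R n)

ζ⁻¹ : Zζ
ζ⁻¹ = ζ ^R 4

cζ : Zζ
cζ = ζ +R (ζ ^R 4)

FPS : Set
FPS = ℕ → Zζ

sumTo : ℕ → (ℕ → Zζ) → Zζ
sumTo zero    f = 0R
sumTo (suc n) f = f n +R sumTo n f

oneS : FPS
oneS zero    = 1R
oneS (suc _) = 0R

infixl 6 _⊕_ _⊖_
infixl 7 _⊛_

_⊕_ : FPS → FPS → FPS
(f ⊕ g) n = f n +R g n

⊝_ : FPS → FPS
(⊝ f) n = -R f n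

_⊖_ : FPS → FPS → FPS
f ⊖ g = f ⊕ (⊝ g)

_⊛_ : FPS → FPS → FPS
(f ⊛ g) n = sumTo (suc n) (λ i → f i *R g (n ∸ i))

_·_ : Zζ → FPS → FPS
(r · f) n = r *R f n

shift : ℕ → FPS → FPS
shift k f n = if ⌊ k ≤? n ⌋ then f (n ∸ k) else 0R

-- the polynomial 1 - a q^m  (used with m ≥ 1)
factor : Zζ → ℕ → FPS
factor a m zero    = 1R
factor a m (suc n) = if (suc n ≡ᵇ m) then -R a else 0R

prodTo : ℕ → (ℕ → FPS) → FPS
prodTo zero    F = oneS
prodTo (suc N) F = prodTo N F ⊛ F N

-- (a q^k ; q^d)_∞ = Π_{j≥0} (1 - a q^{k+dj}), as a formal power series.
-- For k ≥ 1, d ≥ 1 the factors with j ≥ n+1 do not affect the coefficient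
-- of qⁿ, so the coefficient of qⁿ is that of the finite product over j ≤ n.
poch : Zζ → ℕ → ℕ → FPS
poch a k d n = prodTo (suc n) (λ j → factor a (k ℕ.+ d ℕ.* j)) n

-- [q^k ; q^d]_∞ = (q^k;q^d)_∞ (q^{d-k};q^d)_∞   (used with 0 < k < d)
θ : ℕ → ℕ → FPS
θ k d = poch 1R k d ⊛ poch 1R (d ∸ k) d

-- multiplicative inverse of a power series with constant term 1:
-- g 0 = 1,  g m = - Σ_{i=1}^{m} f i · g (m-i).
-- invUpTo f n is correct on indices ≤ n.
invUpTo : FPS → ℕ → FPS
invUpTo f zero    _ = 1R
invUpTo f (suc n) m =
  if ⌊ m ≤? n ⌋ then invUpTo f n m
  else -R sumTo (suc n) (λ i → f (suc i) *R invUpTo f n (n ∸ i))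

inv : FPS → FPS
inv f m = invUpTo f m m

PP3-term : Zζ → Zζ → ℕ → FPS
PP3-term z z⁻¹ n =
  shift (n ℕ.* n ℕ.+ n)
    (poch 1R (2 ℕ.* n ℕ.+ 1) 1 ⊛ inv (poch z n 1 ⊛ poch z⁻¹ n 1))

-- the n-th term is O(q^{n²+n}), so only n ≤ m contribute to q^m
PP3 : Zζ → Zζ → FPS
PP3 z z⁻¹ m = sumTo m (λ i → PP3-term z z⁻¹ (suc i) m)

_≐_ : FPS → FPS → Set
f ≐ g = ∀ n → f n ≡ g n

RHS : FPS
RHS = poch 1R 25 25 ⊛
  ( ⊝ shift 5 (θ 10 75 ⊛ inv (θ 5 75 ⊛ θ 20 75 ⊛ θ 25 75 ⊛ θ 30 75))
  ⊖ (cζ · shift 6 (inv (θ 15 75 ⊛ θ 25 75 ⊛ θ 35 75)))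
  ⊕ ((1R +R cζ) · shift 2 (inv (θ 10 25)))
  ⊖ (cζ · shift 2 (inv (θ 5 75 ⊛ θ 25 75 ⊛ θ 30 75)))
  ⊖ shift 8 (θ 5 75 ⊛ inv (θ 10 75 ⊛ θ 15 75 ⊛ θ 25 75 ⊛ θ 35 75))
  ⊕ (cζ · shift 3 (θ 20 75 ⊛ inv (θ 10 75 ⊛ θ 15 75 ⊛ θ 25 75 ⊛ θ 35 75))) )

{-# OPTIONS --safe #-}

-- Write (a)_n for the base q, and let Ω(x, y) = Σ q^(n²+n) (q^(2n+2))∞ (x)_(n+1) (y)_n where x y = q.
-- The finite triple product and the Durfee-square identity turn Ω(x, y) into a theta series in q³.
-- Since (zq)_(n+1) (1/z)_n + z (q/z)_(n+1) (z)_n = (1 - q^(2n+1)) (1 + z) (z)_n (1/z)_n,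
--   (1 + z) (z)∞ (1/z)∞ PP₃(z, q) = Ω(zq, 1/z) + z Ω(q/z, z) - (1 + z) Ω(q, 1).
-- At a fifth root of unity z the theta series split according to their index modulo 5, and the triple
-- product evaluates the pieces; multiplying by (q)∞ (z²q)∞ (q/z²)∞, which splits into two pieces
-- in the same way, gives six products for (q⁵)∞ PP₃.  They agree with the claim one by one, except for
-- the class of q², which needs an instance of the quintuple product identity.  That instance comes from
-- comparing two dissections of (q)∞: by pentagonal numbers, and as a product of two factors as above.
--
-- Infinite products are finite ones here: the argument takes place in commutative rings in which q is
-- nilpotent, the rings of power series modulo q^N being the intended example.
module Submission where

open import Defs

open import Algebra.Bundles using (CommutativeRing)
import Algebra.Properties.AbelianGroup
import Algebra.Properties.CommutativeSemiring.Exp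
import Algebra.Properties.Ring
import Algebra.Properties.Semiring.Mult.TCOptimised
import Algebra.Solver.Ring
open import Algebra.Solver.Ring.AlmostCommutativeRing using (fromCommutativeRing; _-Raw-AlmostCommutative⟶_)
open import Data.Bool as Bool using (true; false; if_then_else_)
open import Data.Empty using (⊥-elim)
open import Data.Integer as ℤ using (ℤ; +_; -[1+_])
import Data.Integer.Properties as ℤₚ
import Data.Integer.Solver as ℤS
open import Data.Maybe using (Maybe; just; nothing)
open import Data.Nat as ℕ using (ℕ; zero; suc; z≤n; s≤s)
import Data.Nat.Properties as ℕₚ
import Data.Nat.Solver as ℕS
open import Data.Product using (_,_)
import Data.Sign as Sign
open import Data.Sum using (inj₂)
open import Data.Unit using (tt)
open import Level using (0ℓ)
import Relation.Binary.PropositionalEquality as ≡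
open ≡ using (_≡_)
import Relation.Binary.Reasoning.Setoid as SetoidReasoning
open import Relation.Nullary using (yes; no)

-- Two obstacles shape the proof. An arbitrary commutative ring with nilpotent q has no
-- coefficients, so exponents modulo 5 cannot be read off: a relation x = q² y between series x, y
-- in q⁵ is taken both at q and at zq, which have the same fifth power, and the difference (1 - z²)
-- q² y = 0 is cancelled. Nor is there division: 1 - x is cancelled because x is nilpotent, 1 - z
-- because it divides 5, and a Gaussian binomial with a large index stands for 1/(b;b)_k. Ω(q, 1)
-- reduces to its term n = 0, which PP₃ lacks; keeping it as an Ω gives all three series the same
-- dissection, and then two of the five index classes cancel. Three triple products survive, and
-- times the two pieces of the factor they make six. With c = z + z⁴ the relation c² + c = 1 removes
-- the coefficient c (1 + c) at q⁸, and writing 1 = (1 + c) - c at q² lets the term in q⁷ be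
-- absorbed: this is where the quintuple product enters, and why the claim has two products with q².

module NS = ℕS.+-*-Solver

-- Integer coefficients let the solver cancel terms in an arbitrary commutative ring.
module RingSolver {ℓ₁ ℓ₂} (R : CommutativeRing ℓ₁ ℓ₂) where

  open CommutativeRing R
  open Algebra.Properties.Ring ring
  open Algebra.Properties.AbelianGroup +-abelianGroup using (⁻¹-∙-comm)
  open Algebra.Properties.Semiring.Mult.TCOptimised semiring using (_×_; ×-homo-+; ×1-homo-*)
  open SetoidReasoning setoid

  private
    fromℤ : ℤ → Carrier
    fromℤ (+ n)    = n × 1#
    fromℤ -[1+ n ] = - (suc n × 1#)

    ⊖-homo : ∀ m n → fromℤ (m ℤ.⊖ n) ≈ m × 1# + - (n × 1#)
    ⊖-homo m zero = begin
      m × 1#          ≈⟨ +-identityʳ _ ⟨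
      m × 1# + 0#     ≈⟨ +-congˡ -0#≈0# ⟨
      m × 1# + - 0#   ∎
    ⊖-homo zero (suc n) = sym (+-identityˡ _)
    ⊖-homo (suc m) (suc n) = begin
      fromℤ (suc m ℤ.⊖ suc n)                   ≡⟨ ≡.cong fromℤ (ℤₚ.[1+m]⊖[1+n]≡m⊖n m n) ⟩
      fromℤ (m ℤ.⊖ n)                           ≈⟨ ⊖-homo m n ⟩
      m × 1# + - (n × 1#)                     ≈⟨ +-congˡ (+-identityˡ _) ⟨
      m × 1# + (0# + - (n × 1#))              ≈⟨ +-congˡ (+-congʳ (-‿inverseʳ 1#)) ⟨
      m × 1# + (1# + - 1# + - (n × 1#))       ≈⟨ +-congˡ (+-assoc _ _ _) ⟩
      m × 1# + (1# + (- 1# + - (n × 1#)))     ≈⟨ +-assoc _ _ _ ⟨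
      m × 1# + 1# + (- 1# + - (n × 1#))       ≈⟨ +-cong (+-comm _ _) (⁻¹-∙-comm _ _) ⟩
      1# + m × 1# + - (1# + n × 1#)           ≈⟨ +-cong (×-homo-+ 1# 1 m) (-‿cong (×-homo-+ 1# 1 n)) ⟨
      suc m × 1# + - (suc n × 1#)             ∎

    +-homo : ∀ i j → fromℤ (i ℤ.+ j) ≈ fromℤ i + fromℤ j
    +-homo (+ m)    (+ n)    = ×-homo-+ 1# m n
    +-homo (+ m)    -[1+ n ] = ⊖-homo m (suc n)
    +-homo -[1+ m ] (+ n)    = trans (⊖-homo n (suc m)) (+-comm _ _)
    +-homo -[1+ m ] -[1+ n ] = begin
      - (suc (suc (m ℕ.+ n)) × 1#)          ≡⟨ ≡.cong (λ k → - (suc k × 1#)) (ℕₚ.+-suc m n) ⟨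
      - ((suc m ℕ.+ suc n) × 1#)            ≈⟨ -‿cong (×-homo-+ 1# (suc m) (suc n)) ⟩
      - (suc m × 1# + suc n × 1#)           ≈⟨ ⁻¹-∙-comm _ _ ⟨
      - (suc m × 1#) + - (suc n × 1#)       ∎

    +◃-homo : ∀ n → fromℤ (Sign.+ ℤ.◃ n) ≈ n × 1#
    +◃-homo n = reflexive (≡.cong fromℤ (ℤₚ.+◃n≡+n n))

    -◃-homo : ∀ n → fromℤ (Sign.- ℤ.◃ n) ≈ - (n × 1#)
    -◃-homo zero    = sym -0#≈0#
    -◃-homo (suc n) = refl

    *-homo : ∀ i j → fromℤ (i ℤ.* j) ≈ fromℤ i * fromℤ j
    *-homo (+ m)    (+ n)    = trans (+◃-homo (m ℕ.* n)) (×1-homo-* m n)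
    *-homo (+ m)    -[1+ n ] = trans (-◃-homo (m ℕ.* suc n)) (trans (-‿cong (×1-homo-* m (suc n))) (-‿distribʳ-* _ _))
    *-homo -[1+ m ] (+ n)    = trans (-◃-homo (suc m ℕ.* n)) (trans (-‿cong (×1-homo-* (suc m) n)) (-‿distribˡ-* _ _))
    *-homo -[1+ m ] -[1+ n ] = begin
      fromℤ (Sign.+ ℤ.◃ (suc m ℕ.* suc n))   ≈⟨ +◃-homo (suc m ℕ.* suc n) ⟩
      (suc m ℕ.* suc n) × 1#                 ≈⟨ ×1-homo-* (suc m) (suc n) ⟩
      (suc m × 1#) * (suc n × 1#)            ≈⟨ -‿involutive _ ⟨
      - - ((suc m × 1#) * (suc n × 1#))      ≈⟨ -‿cong (-‿distribˡ-* _ _) ⟩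
      - (- (suc m × 1#) * (suc n × 1#))      ≈⟨ -‿distribʳ-* _ _ ⟩
      - (suc m × 1#) * - (suc n × 1#)        ∎

    -‿homo : ∀ i → fromℤ (ℤ.- i) ≈ - fromℤ i
    -‿homo (+ zero)    = sym -0#≈0#
    -‿homo (+ suc n)   = refl
    -‿homo -[1+ n ]    = sym (-‿involutive _)

    homomorphism : ℤ.+-*-rawRing -Raw-AlmostCommutative⟶ fromCommutativeRing R
    homomorphism = record
      { ⟦_⟧ = fromℤ ; +-homo = +-homo ; *-homo = *-homo ; -‿homo = -‿homo ; 0-homo = refl ; 1-homo = refl }

    coeff≟ : ∀ i j → Maybe (fromℤ i ≈ fromℤ j)
    coeff≟ i j with i ℤ.≟ j
    ... | yes i≡j = just (reflexive (≡.cong fromℤ i≡j))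
    ... | no  _   = nothing

  open Algebra.Solver.Ring ℤ.+-*-rawRing (fromCommutativeRing R) homomorphism coeff≟ public
    using (solve; _:=_; _:+_; _:*_; :-_; _:-_; _:^_; con)

-- Gaussian binomials, the finite Durfee identity and the finite triple product.

module FiniteIdentities {ℓ₁ ℓ₂} (R : CommutativeRing ℓ₁ ℓ₂) where

  open CommutativeRing R hiding (zero)
  open Algebra.Properties.CommutativeSemiring.Exp commutativeSemiring public
  open SetoidReasoning setoid
  open RingSolver R

  ∑ : ℕ → (ℕ → Carrier) → Carrier
  ∑ zero    f = 0#
  ∑ (suc n) f = f 0 + ∑ n (λ i → f (suc i))

  -- Carrying both indices k and l avoids the truncated subtraction n ∸ k in Gaussian binomials and
  -- convolutions.
  antidiag : ℕ → (ℕ → ℕ → Carrier) → Carrier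
  antidiag zero    h = h 0 0
  antidiag (suc n) h = h 0 (suc n) + antidiag n (λ k l → h (suc k) l)

  ∑-cong : ∀ n {f g} → (∀ i → f i ≈ g i) → ∑ n f ≈ ∑ n g
  ∑-cong zero    f≈g = refl
  ∑-cong (suc n) f≈g = +-cong (f≈g 0) (∑-cong n (λ i → f≈g (suc i)))

  ∑-zero : ∀ n {f} → (∀ i → f i ≈ 0#) → ∑ n f ≈ 0#
  ∑-zero zero    f≈0 = refl
  ∑-zero (suc n) f≈0 = trans (+-cong (f≈0 0) (∑-zero n (λ i → f≈0 (suc i)))) (+-identityʳ _)

  +-interchange : ∀ a b c d → (a + b) + (c + d) ≈ (a + c) + (b + d)
  +-interchange = solve 4 (λ a b c d → (a :+ b) :+ (c :+ d) := (a :+ c) :+ (b :+ d)) refl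

  ∑-+ : ∀ n f g → ∑ n (λ i → f i + g i) ≈ ∑ n f + ∑ n g
  ∑-+ zero    f g = sym (+-identityʳ _)
  ∑-+ (suc n) f g = trans (+-congˡ (∑-+ n _ _)) (+-interchange _ _ _ _)

  ∑-*ˡ : ∀ n a f → ∑ n (λ i → a * f i) ≈ a * ∑ n f
  ∑-*ˡ zero    a f = sym (zeroʳ a)
  ∑-*ˡ (suc n) a f = trans (+-congˡ (∑-*ˡ n a _)) (sym (distribˡ _ _ _))

  ∑-snoc : ∀ n f → ∑ (suc n) f ≈ ∑ n f + f n
  ∑-snoc zero    f = +-comm _ _
  ∑-snoc (suc n) f = trans (+-congˡ (∑-snoc n _)) (sym (+-assoc _ _ _))

  antidiag-cong : ∀ n {f g} → (∀ k l → k ℕ.+ l ≡ n → f k l ≈ g k l) → antidiag n f ≈ antidiag n g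
  antidiag-cong zero    f≈g = f≈g 0 0 ≡.refl
  antidiag-cong (suc n) f≈g = +-cong (f≈g 0 (suc n) ≡.refl) (antidiag-cong n (λ k l e → f≈g (suc k) l (≡.cong suc e)))

  antidiag-+ : ∀ n f g → antidiag n (λ k l → f k l + g k l) ≈ antidiag n f + antidiag n g
  antidiag-+ zero    f g = refl
  antidiag-+ (suc n) f g = trans (+-congˡ (antidiag-+ n _ _)) (+-interchange _ _ _ _)

  antidiag-*ˡ : ∀ n a f → antidiag n (λ k l → a * f k l) ≈ a * antidiag n f
  antidiag-*ˡ zero    a f = refl
  antidiag-*ˡ (suc n) a f = trans (+-congˡ (antidiag-*ˡ n a _)) (sym (distribˡ _ _ _))

  antidiag-*ʳ : ∀ n a f → antidiag n (λ k l → f k l * a) ≈ antidiag n f * a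
  antidiag-*ʳ n a f = trans (antidiag-cong n (λ _ _ _ → *-comm _ _)) (trans (antidiag-*ˡ n a f) (*-comm _ _))

  antidiag-snoc : ∀ n f → antidiag (suc n) f ≈ antidiag n (λ k l → f k (suc l)) + f (suc n) 0
  antidiag-snoc zero    f = refl
  antidiag-snoc (suc n) f = trans (+-congˡ (antidiag-snoc n (λ k → f (suc k)))) (sym (+-assoc _ _ _))

  antidiag-swap : ∀ n f → antidiag n (λ k l → f l k) ≈ antidiag n f
  antidiag-swap zero    f = refl
  antidiag-swap (suc n) f = begin
    f (suc n) 0 + antidiag n (λ k l → f l (suc k))  ≈⟨ +-congˡ (antidiag-swap n (λ k l → f k (suc l))) ⟩
    f (suc n) 0 + antidiag n (λ k l → f k (suc l))  ≈⟨ +-comm _ _ ⟩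
    antidiag n (λ k l → f k (suc l)) + f (suc n) 0  ≈⟨ antidiag-snoc n f ⟨
    antidiag (suc n) f                              ∎

  antidiag-assoc : ∀ n (f : ℕ → ℕ → ℕ → Carrier) →
    antidiag n (λ i k → antidiag i (λ a b → f a b k)) ≈ antidiag n (λ a j → antidiag j (f a))
  antidiag-assoc zero    f = refl
  antidiag-assoc (suc n) f = begin
    f 0 0 (suc n) + antidiag n (λ i k → f 0 (suc i) k + antidiag i (λ a b → f (suc a) b k))
      ≈⟨ +-congˡ (antidiag-+ n _ _) ⟩
    f 0 0 (suc n) + (antidiag n (λ i k → f 0 (suc i) k) + antidiag n (λ i k → antidiag i (λ a b → f (suc a) b k)))
      ≈⟨ +-assoc _ _ _ ⟨
    antidiag (suc n) (f 0) + antidiag n (λ i k → antidiag i (λ a b → f (suc a) b k))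
      ≈⟨ +-congˡ (antidiag-assoc n (λ a → f (suc a))) ⟩
    antidiag (suc n) (f 0) + antidiag n (λ a j → antidiag j (f (suc a)))  ∎

  -- Common shape of both Pascal rules: `u` collects what comes from lowering l, `v` what comes from
  -- lowering k. The padded `u′` and `v′` are zero on the border, where nothing can be lowered.
  antidiag-split : ∀ n f u v →
    (∀ l → f 0 (suc l) ≈ u 0 l) → (∀ k → f (suc k) 0 ≈ v k 0) →
    (∀ k l → f (suc k) (suc l) ≈ u (suc k) l + v k (suc l)) →
    antidiag (suc n) f ≈ antidiag n u + antidiag n v
  antidiag-split n f u v f₀ f₁ f₂ = begin
    antidiag (suc n) f                                     ≈⟨ antidiag-cong (suc n) step ⟩
    antidiag (suc n) (λ k l → u′ k l + v′ k l)             ≈⟨ antidiag-+ (suc n) u′ v′ ⟩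
    antidiag (suc n) u′ + antidiag (suc n) v′              ≈⟨ +-cong (antidiag-snoc n u′) (+-identityˡ _) ⟩
    (antidiag n u + 0#) + antidiag n v                     ≈⟨ +-congʳ (+-identityʳ _) ⟩
    antidiag n u + antidiag n v                            ∎
    where
    u′ v′ : ℕ → ℕ → Carrier
    u′ k zero    = 0#
    u′ k (suc l) = u k l
    v′ zero    l = 0#
    v′ (suc k) l = v k l
    step : ∀ k l → k ℕ.+ l ≡ suc n → f k l ≈ u′ k l + v′ k l
    step zero    zero    ()
    step zero    (suc l) _ = trans (f₀ l) (sym (+-identityʳ _))
    step (suc k) zero    _ = trans (f₁ k) (sym (+-identityˡ _))
    step (suc k) (suc l) _ = f₂ k l

  qpoch : Carrier → Carrier → ℕ → Carrier
  qpoch x b zero    = 1#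
  qpoch x b (suc n) = qpoch x b n * (1# + - (x * b ^ n))

  qpoch-cong : ∀ n {x y a b} → x ≈ y → a ≈ b → qpoch x a n ≈ qpoch y b n
  qpoch-cong zero    x≈y a≈b = refl
  qpoch-cong (suc n) x≈y a≈b =
    *-cong (qpoch-cong n x≈y a≈b) (+-congˡ (-‿cong (*-cong x≈y (^-congˡ n a≈b))))

  qpoch-+ : ∀ x b m n → qpoch x b (m ℕ.+ n) ≈ qpoch x b m * qpoch (x * b ^ m) b n
  qpoch-+ x b m zero    = begin
    qpoch x b (m ℕ.+ 0)   ≡⟨ ≡.cong (qpoch x b) (ℕₚ.+-identityʳ m) ⟩
    qpoch x b m           ≈⟨ *-identityʳ _ ⟨
    qpoch x b m * 1#      ∎
  qpoch-+ x b m (suc n) = begin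
    qpoch x b (m ℕ.+ suc n)                                  ≡⟨ ≡.cong (qpoch x b) (ℕₚ.+-suc m n) ⟩
    qpoch x b (m ℕ.+ n) * (1# + - (x * b ^ (m ℕ.+ n)))
      ≈⟨ *-cong (qpoch-+ x b m n) (+-congˡ (-‿cong (trans (*-congˡ (^-homo-* b m n)) (sym (*-assoc _ _ _))))) ⟩
    qpoch x b m * qpoch (x * b ^ m) b n * (1# + - (x * b ^ m * b ^ n))   ≈⟨ *-assoc _ _ _ ⟩
    qpoch x b m * qpoch (x * b ^ m) b (suc n)                ∎

  qpoch-suc : ∀ x b n → qpoch x b (suc n) ≈ (1# + - x) * qpoch (x * b) b n
  qpoch-suc x b n = trans (qpoch-+ x b 1 n)
    (*-cong (trans (*-identityˡ _) (+-congˡ (-‿cong (*-identityʳ x)))) (qpoch-cong n (*-congˡ (*-identityʳ b)) refl))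

  -- gauss b k l is the Gaussian binomial [k + l choose k].
  gauss : Carrier → ℕ → ℕ → Carrier
  gauss b zero    l       = 1#
  gauss b (suc k) zero    = 1#
  gauss b (suc k) (suc l) = gauss b (suc k) l + b ^ suc l * gauss b k (suc l)

  gauss-0 : ∀ b k → gauss b k 0 ≈ 1#
  gauss-0 b zero    = refl
  gauss-0 b (suc k) = refl

  -- The mirror image of the defining Pascal rule. In the general case both terms of the definition
  -- are expanded by the induction hypothesis, and the four resulting terms regroup into two
  -- instances of the definition.
  gauss-pascal : ∀ b k l → gauss b (suc k) (suc l) ≈ gauss b k (suc l) + b ^ suc k * gauss b (suc k) l
  gauss-pascal b zero    zero    = refl
  gauss-pascal b zero    (suc l) = begin
    gauss b 1 (suc l) + b ^ suc (suc l) * 1#          ≈⟨ +-congʳ (gauss-pascal b zero l) ⟩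
    (1# + b ^ 1 * gauss b 1 l) + b ^ suc (suc l) * 1#
      ≈⟨ solve 3 (λ b g p → (con (+ 1) :+ (b :* con (+ 1)) :* g) :+ (b :* (b :* p)) :* con (+ 1) := con (+ 1) :+ (b :* con (+ 1)) :* (g :+ (b :* p) :* con (+ 1))) refl b (gauss b 1 l) (b ^ l) ⟩
    1# + b ^ 1 * gauss b 1 (suc l) ∎
  gauss-pascal b (suc k) zero    = begin
    1# + b ^ 1 * gauss b (suc k) 1  ≈⟨ +-congˡ (*-congˡ (gauss-pascal b k zero)) ⟩
    1# + b ^ 1 * (gauss b k 1 + b ^ suc k * 1#)
      ≈⟨ solve 3 (λ b g p → con (+ 1) :+ (b :* con (+ 1)) :* (g :+ (b :* p) :* con (+ 1)) := (con (+ 1) :+ (b :* con (+ 1)) :* g) :+ (b :* (b :* p)) :* con (+ 1)) refl b (gauss b k 1) (b ^ k) ⟩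
    (1# + b ^ 1 * gauss b k 1) + b ^ suc (suc k) * 1# ∎
  gauss-pascal b (suc k) (suc l) = begin
    gauss b (2+ k) (suc l) + b ^ (2+ l) * gauss b (suc k) (2+ l)
      ≈⟨ +-cong (gauss-pascal b (suc k) l) (*-congˡ (gauss-pascal b k (suc l))) ⟩
    (gauss b (suc k) (suc l) + b ^ (2+ k) * gauss b (2+ k) l) + b ^ (2+ l) * (gauss b k (2+ l) + b ^ suc k * gauss b (suc k) (suc l))
      ≈⟨ solve 6 (λ b bk bl g₁ g₂ g₃ → (g₁ :+ (b :* (b :* bk)) :* g₂) :+ (b :* (b :* bl)) :* (g₃ :+ (b :* bk) :* g₁)
            := (g₁ :+ (b :* (b :* bl)) :* g₃) :+ (b :* (b :* bk)) :* (g₂ :+ (b :* bl) :* g₁)) refl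
          b (b ^ k) (b ^ l) (gauss b (suc k) (suc l)) (gauss b (2+ k) l) (gauss b k (2+ l)) ⟩
    gauss b (suc k) (2+ l) + b ^ (2+ k) * gauss b (2+ k) (suc l) ∎
    where
    2+ : ℕ → ℕ
    2+ n = suc (suc n)

  -- The product formula for Gaussian binomials, multiplied out since (b;b)_k need not be
  -- invertible.
  gauss-poch : ∀ b k l → gauss b k l * qpoch b b k ≈ qpoch (b ^ suc l) b k
  gauss-poch b zero    l       = *-identityˡ _
  gauss-poch b (suc k) zero    = trans (*-identityˡ _) (qpoch-cong (suc k) (sym (*-identityʳ b)) refl)
  gauss-poch b (suc k) (suc l) = begin
    (gauss b (suc k) l + b ^ suc l * gauss b k (suc l)) * qpoch b b (suc k)
      ≈⟨ solve 5 (λ g p h y r → (g :+ p :* h) :* (y :* r) := g :* (y :* r) :+ p :* (h :* y) :* r) refl _ _ _ _ _ ⟩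
    gauss b (suc k) l * qpoch b b (suc k) + b ^ suc l * (gauss b k (suc l) * qpoch b b k) * (1# + - (b * b ^ k))
      ≈⟨ +-cong (gauss-poch b (suc k) l) (*-congʳ (*-congˡ (gauss-poch b k (suc l)))) ⟩
    qpoch (b ^ suc l) b (suc k) + b ^ suc l * qpoch (b ^ suc (suc l)) b k * (1# + - (b * b ^ k))
      ≈⟨ +-congʳ (trans (qpoch-suc _ b k) (*-congˡ (qpoch-cong k (*-comm _ _) refl))) ⟩
    (1# + - (b ^ suc l)) * qpoch (b ^ suc (suc l)) b k + b ^ suc l * qpoch (b ^ suc (suc l)) b k * (1# + - (b * b ^ k))
      ≈⟨ solve 4 (λ b p y e → (con (+ 1) :+ :- p) :* y :+ p :* y :* (con (+ 1) :+ :- (b :* e)) := y :* (con (+ 1) :+ :- ((b :* p) :* e))) refl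
          b (b ^ suc l) _ (b ^ k) ⟩
    qpoch (b ^ suc (suc l)) b (suc k) ∎

  -- Summation by parts with Pascal's rule: a weight on row n + 1 becomes another weight on row n,
  -- so inductions on n only have to follow the weight. `gauss-sumʳ` does the same with the mirror
  -- rule.
  gauss-sumˡ : ∀ b n (h : ℕ → ℕ → Carrier) →
    antidiag (suc n) (λ k l → gauss b k l * h k l) ≈
    antidiag n (λ k l → gauss b k l * (h k (suc l) + b ^ l * h (suc k) l))
  gauss-sumˡ b n h = begin
    antidiag (suc n) (λ k l → gauss b k l * h k l)
      ≈⟨ antidiag-split n (λ k l → gauss b k l * h k l) (λ k l → gauss b k l * h k (suc l)) (λ k l → gauss b k l * (b ^ l * h (suc k) l))
           (λ _ → refl)
           (λ k → trans (*-identityˡ _) (sym (trans (*-congʳ (gauss-0 b k)) (trans (*-identityˡ _) (*-identityˡ _)))))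
           (λ k l → solve 4 (λ g p e h → (g :+ p :* e) :* h := g :* h :+ e :* (p :* h)) refl _ _ _ _) ⟩
    _ ≈⟨ antidiag-+ n _ _ ⟨
    antidiag n (λ k l → gauss b k l * h k (suc l) + gauss b k l * (b ^ l * h (suc k) l))
      ≈⟨ antidiag-cong n (λ _ _ _ → sym (distribˡ _ _ _)) ⟩
    antidiag n (λ k l → gauss b k l * (h k (suc l) + b ^ l * h (suc k) l)) ∎

  gauss-sumʳ : ∀ b n (h : ℕ → ℕ → Carrier) →
    antidiag (suc n) (λ k l → gauss b k l * h k l) ≈
    antidiag n (λ k l → gauss b k l * (h (suc k) l + b ^ k * h k (suc l)))
  gauss-sumʳ b n h = begin
    antidiag (suc n) (λ k l → gauss b k l * h k l)
      ≈⟨ antidiag-split n (λ k l → gauss b k l * h k l) (λ k l → gauss b k l * (b ^ k * h k (suc l))) (λ k l → gauss b k l * h (suc k) l)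
           (λ _ → *-congˡ (sym (*-identityˡ _)))
           (λ k → *-congʳ (sym (gauss-0 b k)))
           (λ k l → trans (*-congʳ (gauss-pascal b k l))
              (solve 4 (λ g p e h → (g :+ p :* e) :* h := e :* (p :* h) :+ g :* h) refl _ _ _ _)) ⟩
    _ ≈⟨ antidiag-+ n _ _ ⟨
    antidiag n (λ k l → gauss b k l * (b ^ k * h k (suc l)) + gauss b k l * h (suc k) l)
      ≈⟨ antidiag-cong n (λ _ _ _ → trans (+-comm _ _) (sym (distribˡ _ _ _))) ⟩
    antidiag n (λ k l → gauss b k l * (h (suc k) l + b ^ k * h k (suc l))) ∎

  ^-suc² : ∀ b k → b ^ (suc k ℕ.* suc k) ≈ b ^ (k ℕ.* k) * b ^ k * b ^ k * b
  ^-suc² b k = begin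
    b ^ (suc k ℕ.* suc k)                ≡⟨ ≡.cong (b ^_) (NS.solve 1 (λ k → (NS.con 1 NS.:+ k) NS.:* (NS.con 1 NS.:+ k) NS.:= k NS.:* k NS.:+ k NS.:+ k NS.:+ NS.con 1) ≡.refl k) ⟩
    b ^ (k ℕ.* k ℕ.+ k ℕ.+ k ℕ.+ 1)      ≈⟨ ^-homo-* b (k ℕ.* k ℕ.+ k ℕ.+ k) 1 ⟩
    b ^ (k ℕ.* k ℕ.+ k ℕ.+ k) * b ^ 1    ≈⟨ *-cong (trans (^-homo-* b (k ℕ.* k ℕ.+ k) k) (*-congʳ (^-homo-* b (k ℕ.* k) k))) (*-identityʳ b) ⟩
    b ^ (k ℕ.* k) * b ^ k * b ^ k * b    ∎

  -- Durfee-square identity in division-free form: replacing x by x b lowers n by one.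
  durfee : ∀ b x n →
    antidiag n (λ k l → gauss b k l * (b ^ (k ℕ.* k) * x ^ k * qpoch (x * b ^ suc k) b l)) ≈ 1#
  durfee b x zero    = solve 0 (con (+ 1) :* (con (+ 1) :* con (+ 1) :* con (+ 1)) := con (+ 1)) refl
  durfee b x (suc n) = begin
    antidiag (suc n) (λ k l → gauss b k l * t x k l)
      ≈⟨ gauss-sumʳ b n (t x) ⟩
    antidiag n (λ k l → gauss b k l * (t x (suc k) l + b ^ k * t x k (suc l)))
      ≈⟨ antidiag-cong n (λ k l _ → *-congˡ (step k l)) ⟩
    antidiag n (λ k l → gauss b k l * t (x * b) k l)
      ≈⟨ durfee b (x * b) n ⟩
    1# ∎
    where
    t : Carrier → ℕ → ℕ → Carrier
    t x k l = b ^ (k ℕ.* k) * x ^ k * qpoch (x * b ^ suc k) b l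
    step : ∀ k l → t x (suc k) l + b ^ k * t x k (suc l) ≈ t (x * b) k l
    step k l = begin
      b ^ (suc k ℕ.* suc k) * x ^ suc k * qpoch (x * b ^ suc (suc k)) b l + b ^ k * t x k (suc l)
        ≈⟨ +-cong (*-cong (*-congʳ (^-suc² b k)) p₁) (*-congˡ (*-congˡ (trans (qpoch-suc _ b l) (*-congˡ p₂)))) ⟩
      b ^ (k ℕ.* k) * b ^ k * b ^ k * b * (x * x ^ k) * P + b ^ k * (b ^ (k ℕ.* k) * x ^ k * ((1# + - (x * (b * b ^ k))) * P))
        ≈⟨ solve 6 (λ s b bk x xk P → s :* bk :* bk :* b :* (x :* xk) :* P :+ bk :* (s :* xk :* ((con (+ 1) :+ :- (x :* (b :* bk))) :* P))
              := s :* (xk :* bk) :* P) refl (b ^ (k ℕ.* k)) b (b ^ k) x (x ^ k) P ⟩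
      b ^ (k ℕ.* k) * (x ^ k * b ^ k) * P
        ≈⟨ *-congʳ (*-congˡ (^-distrib-* x b k)) ⟨
      t (x * b) k l ∎
      where
      P = qpoch (x * b * b ^ suc k) b l
      p₁ : qpoch (x * b ^ suc (suc k)) b l ≈ P
      p₁ = qpoch-cong l (sym (*-assoc _ _ _)) refl
      p₂ : qpoch (x * b ^ suc k * b) b l ≈ P
      p₂ = qpoch-cong l (trans (*-assoc _ _ _) (trans (*-congˡ (*-comm _ _)) (sym (*-assoc _ _ _)))) refl

  -- (-x)^j b^(j(j-1)/2)
  thetaTerm : Carrier → Carrier → ℕ → Carrier
  thetaTerm x b zero    = 1#
  thetaTerm x b (suc j) = thetaTerm x b j * - (x * b ^ j)

  -- The term of index k - n of the bilateral theta series in z, where w = b / z.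
  bilateral : Carrier → Carrier → Carrier → ℕ → ℕ → Carrier
  bilateral z w b zero    k       = thetaTerm z b k
  bilateral z w b (suc n) zero    = thetaTerm w b (suc n)
  bilateral z w b (suc n) (suc k) = bilateral z w b n k

  module _ {z w b : Carrier} (zw≈b : z * w ≈ b) where

    private
      θ[_,_] : ℕ → ℕ → Carrier
      θ[ n , k ] = bilateral z w b n k

    bilateral-0 : ∀ n → θ[ n , 0 ] ≈ thetaTerm w b n
    bilateral-0 zero    = refl
    bilateral-0 (suc n) = refl

    bilateral-neg : ∀ n k l → k ℕ.+ l ≡ n → θ[ n , k ] ≈ thetaTerm w b l
    bilateral-neg n       zero    l ≡.refl = bilateral-0 n
    bilateral-neg (suc n) (suc k) l e      = bilateral-neg n k l (ℕₚ.suc-injective e)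

    -- Consecutive terms of the bilateral series have ratio -z b^(k - n). The factor b^l with l = m
    -- + n - k makes it -z b^m for every k, and no negative power is written. For negative indices
    -- the ratio is a quotient of terms in w, whence the use of z w = b.
    bilateral-suc : ∀ m n k l → k ℕ.+ l ≡ m ℕ.+ n → b ^ l * θ[ n , suc k ] ≈ θ[ n , k ] * - (z * b ^ m)
    bilateral-suc m zero k l e = begin
      b ^ l * (thetaTerm z b k * - (z * b ^ k))
        ≈⟨ solve 4 (λ l t z k → l :* (t :* :- (z :* k)) := t :* :- (z :* (k :* l))) refl _ _ _ _ ⟩
      thetaTerm z b k * - (z * (b ^ k * b ^ l))     ≈⟨ *-congˡ (-‿cong (*-congˡ (^-homo-* b k l))) ⟨
      thetaTerm z b k * - (z * b ^ (k ℕ.+ l))       ≡⟨ ≡.cong (λ i → thetaTerm z b k * - (z * b ^ i)) (≡.trans e (ℕₚ.+-identityʳ m)) ⟩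
      thetaTerm z b k * - (z * b ^ m)               ∎
    bilateral-suc m (suc n) zero l e = begin
      b ^ l * θ[ n , 0 ]                             ≈⟨ *-cong (trans (reflexive (≡.cong (b ^_) e)) (^-homo-* b m (suc n))) (bilateral-0 n) ⟩
      b ^ m * (b * b ^ n) * thetaTerm w b n          ≈⟨ *-congʳ (*-congˡ (*-congʳ zw≈b)) ⟨
      b ^ m * (z * w * b ^ n) * thetaTerm w b n      ≈⟨ solve 5 (λ m z w n t → m :* (z :* w :* n) :* t := t :* :- (w :* n) :* :- (z :* m)) refl _ _ _ _ _ ⟩
      thetaTerm w b n * - (w * b ^ n) * - (z * b ^ m) ∎
    bilateral-suc m (suc n) (suc k) l e =
      bilateral-suc m n k l (ℕₚ.suc-injective (≡.trans e (ℕₚ.+-suc m n)))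

    -- The case m = 0 of `finiteTheta`, where no positive index occurs; this is the q-binomial
    -- theorem.
    finiteThetaʳ : ∀ n → antidiag n (λ k l → gauss b k l * thetaTerm w b l) ≈ qpoch w b n
    finiteThetaʳ zero    = *-identityˡ _
    finiteThetaʳ (suc n) = begin
      antidiag (suc n) (λ k l → gauss b k l * thetaTerm w b l)
        ≈⟨ gauss-sumʳ b n (λ _ → thetaTerm w b) ⟩
      antidiag n (λ k l → gauss b k l * (thetaTerm w b l + b ^ k * thetaTerm w b (suc l)))
        ≈⟨ antidiag-cong n step ⟩
      antidiag n (λ k l → gauss b k l * thetaTerm w b l * (1# + - (w * b ^ n)))
        ≈⟨ antidiag-*ʳ n _ _ ⟩
      antidiag n (λ k l → gauss b k l * thetaTerm w b l) * (1# + - (w * b ^ n))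
        ≈⟨ *-congʳ (finiteThetaʳ n) ⟩
      qpoch w b (suc n) ∎
      where
      step : ∀ k l → k ℕ.+ l ≡ n → _ ≈ _
      step k l ≡.refl = begin
        gauss b k l * (thetaTerm w b l + b ^ k * (thetaTerm w b l * - (w * b ^ l)))
          ≈⟨ solve 5 (λ g t k w l → g :* (t :+ k :* (t :* :- (w :* l))) := g :* t :* (con (+ 1) :+ :- (w :* (k :* l)))) refl _ _ _ _ _ ⟩
        gauss b k l * thetaTerm w b l * (1# + - (w * (b ^ k * b ^ l)))
          ≈⟨ *-congˡ (+-congˡ (-‿cong (*-congˡ (^-homo-* b k l)))) ⟨
        gauss b k l * thetaTerm w b l * (1# + - (w * b ^ (k ℕ.+ l))) ∎

    -- Cauchy's finite form of the Jacobi triple product. By `bilateral-suc`, lowering the row by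
    -- one multiplies all its terms by the same factor 1 - z b^m.
    finiteTheta : ∀ m n → antidiag (m ℕ.+ n) (λ k l → gauss b k l * θ[ n , k ]) ≈ qpoch z b m * qpoch w b n
    finiteTheta zero n = trans (antidiag-cong n (λ k l e → *-congˡ (bilateral-neg n k l e)))
                               (trans (finiteThetaʳ n) (sym (*-identityˡ _)))
    finiteTheta (suc m) n = begin
      antidiag (suc m ℕ.+ n) (λ k l → gauss b k l * θ[ n , k ])
        ≈⟨ gauss-sumˡ b (m ℕ.+ n) (λ k _ → θ[ n , k ]) ⟩
      antidiag (m ℕ.+ n) (λ k l → gauss b k l * (θ[ n , k ] + b ^ l * θ[ n , suc k ]))
        ≈⟨ antidiag-cong (m ℕ.+ n) (λ k l e → trans (*-congˡ (+-congˡ (bilateral-suc m n k l e)))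
             (solve 3 (λ g t r → g :* (t :+ t :* r) := g :* t :* (con (+ 1) :+ r)) refl _ _ _)) ⟩
      antidiag (m ℕ.+ n) (λ k l → gauss b k l * θ[ n , k ] * (1# + - (z * b ^ m)))
        ≈⟨ antidiag-*ʳ (m ℕ.+ n) _ _ ⟩
      antidiag (m ℕ.+ n) (λ k l → gauss b k l * θ[ n , k ]) * (1# + - (z * b ^ m))
        ≈⟨ *-congʳ (finiteTheta m n) ⟩
      qpoch z b m * qpoch w b n * (1# + - (z * b ^ m))
        ≈⟨ solve 3 (λ p r s → p :* r :* s := p :* s :* r) refl _ _ _ ⟩
      qpoch z b (suc m) * qpoch w b n ∎

-- Limits of finite products: the Jacobi triple product and a limiting case of Bailey's lemma.

module InfiniteProducts {ℓ₁ ℓ₂} (R : CommutativeRing ℓ₁ ℓ₂) where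

  open CommutativeRing R hiding (zero)
  open Algebra.Properties.Ring ring using (-0#≈0#)
  open Algebra.Properties.AbelianGroup +-abelianGroup using () renaming (x∙y⁻¹≈ε⇒x≈y to x-y≈0⇒x≈y)
  open SetoidReasoning setoid
  open RingSolver R
  open FiniteIdentities R

  antidiag-zero : ∀ n {f} → (∀ k l → f k l ≈ 0#) → antidiag n f ≈ 0#
  antidiag-zero zero    f≈0 = f≈0 0 0
  antidiag-zero (suc n) f≈0 = trans (+-cong (f≈0 0 (suc n)) (antidiag-zero n (λ k → f≈0 (suc k)))) (+-identityʳ _)

  -- Passage to the limit along a long diagonal: for k below M the second index is at least l, where
  -- the term has reached its limit `g k`, and all later terms vanish.
  antidiag-truncate : ∀ M l {f g} → (∀ k l′ → l ℕ.≤ l′ → f k l′ ≈ g k) →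
    (∀ k l′ → M ℕ.≤ k → f k l′ ≈ 0#) → antidiag (M ℕ.+ l) f ≈ ∑ M g
  antidiag-truncate zero    l f≈g f≈0 = antidiag-zero l (λ k l′ → f≈0 k l′ z≤n)
  antidiag-truncate (suc M) l f≈g f≈0 = +-cong
    (f≈g 0 (suc (M ℕ.+ l)) (ℕₚ.≤-trans (ℕₚ.m≤n+m l M) (ℕₚ.n≤1+n _)))
    (antidiag-truncate M l (λ k → f≈g (suc k)) (λ k l′ M≤k → f≈0 (suc k) l′ (s≤s M≤k)))

  -- The diagonal 2n + 1 has an even number of entries and is paired about its middle: i measures
  -- the distance from the middle and m = n - i is the smaller index.
  antidiag-fold : ∀ n (f : ℕ → ℕ → Carrier) → antidiag (suc n ℕ.+ n) f ≈
    antidiag n (λ i m → f (suc (i ℕ.+ i ℕ.+ m)) m + f m (suc (i ℕ.+ i ℕ.+ m)))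
  antidiag-fold zero    f = +-comm _ _
  antidiag-fold (suc n) f = begin
    antidiag (suc (suc n ℕ.+ suc n)) f
      ≡⟨ ≡.cong (λ k → antidiag (suc k) f) (ℕₚ.+-suc (suc n) n) ⟩
    f 0 (suc (suc (suc n ℕ.+ n))) + antidiag (suc (suc n ℕ.+ n)) (λ k → f (suc k))
      ≈⟨ +-congˡ (antidiag-snoc (suc n ℕ.+ n) (λ k → f (suc k))) ⟩
    f 0 (suc (suc (suc n ℕ.+ n))) + (antidiag (suc n ℕ.+ n) (λ k l → f (suc k) (suc l)) + f (suc (suc (suc n ℕ.+ n))) 0)
      ≈⟨ +-congˡ (+-congʳ (antidiag-fold n (λ k l → f (suc k) (suc l)))) ⟩
    f 0 (suc (suc (suc n ℕ.+ n))) + (antidiag n (λ i m → f (suc (suc (i ℕ.+ i ℕ.+ m))) (suc m) + f (suc m) (suc (suc (i ℕ.+ i ℕ.+ m)))) + f (suc (suc (suc n ℕ.+ n))) 0)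
      ≈⟨ solve 3 (λ a b c → a :+ (b :+ c) := b :+ (c :+ a)) refl _ _ _ ⟩
    antidiag n (λ i m → f (suc (suc (i ℕ.+ i ℕ.+ m))) (suc m) + f (suc m) (suc (suc (i ℕ.+ i ℕ.+ m)))) + (f (suc (suc (suc n ℕ.+ n))) 0 + f 0 (suc (suc (suc n ℕ.+ n))))
      ≈⟨ +-cong (antidiag-cong n (λ i m _ → reflexive (≡.cong (λ s → f (suc s) (suc m) + f (suc m) (suc s)) (≡.sym (ℕₚ.+-suc (i ℕ.+ i) m)))))
                (reflexive (≡.cong (λ s → f (suc s) 0 + f 0 (suc s)) (≡.sym (≡.trans (ℕₚ.+-identityʳ _) (ℕₚ.+-suc (suc n) n))))) ⟩
    antidiag n (λ i m → F i (suc m)) + F (suc n) 0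
      ≈⟨ antidiag-snoc n F ⟨
    antidiag (suc n) F ∎
    where
    F : ℕ → ℕ → Carrier
    F i m = f (suc (i ℕ.+ i ℕ.+ m)) m + f m (suc (i ℕ.+ i ℕ.+ m))

  -- The vanishing terms complete the triangle i + m < N to a square, which makes i the outer
  -- variable.
  ∑-antidiag : ∀ N (g : ℕ → ℕ → Carrier) → (∀ i m → N ℕ.≤ i ℕ.+ m → g i m ≈ 0#) →
    ∑ N (λ n → antidiag n g) ≈ ∑ N (λ i → ∑ N (g i))
  ∑-antidiag zero    g g≈0 = refl
  ∑-antidiag (suc N) g g≈0 = begin
    g 0 0 + ∑ N (λ n → g 0 (suc n) + antidiag n (λ i → g (suc i)))
      ≈⟨ +-congˡ (∑-+ N _ _) ⟩
    g 0 0 + (∑ N (λ n → g 0 (suc n)) + ∑ N (λ n → antidiag n (λ i → g (suc i))))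
      ≈⟨ +-assoc _ _ _ ⟨
    ∑ (suc N) (g 0) + ∑ N (λ n → antidiag n (λ i → g (suc i)))
      ≈⟨ +-congˡ (∑-antidiag N (λ i → g (suc i)) (λ i m le → g≈0 (suc i) m (s≤s le))) ⟩
    ∑ (suc N) (g 0) + ∑ N (λ i → ∑ N (g (suc i)))
      ≈⟨ +-congˡ (∑-cong N (λ i → trans (sym (+-identityʳ _)) (trans (+-congˡ (sym (g≈0 (suc i) N (s≤s (ℕₚ.m≤n+m N i)))))
           (sym (∑-snoc N (g (suc i))))))) ⟩
    ∑ (suc N) (g 0) + ∑ N (λ i → ∑ (suc N) (g (suc i))) ∎

  gauss-sym : ∀ b k l → gauss b k l ≈ gauss b l k
  gauss-sym b zero    l       = sym (gauss-0 b l)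
  gauss-sym b (suc k) zero    = refl
  gauss-sym b (suc k) (suc l) = trans (+-cong (gauss-sym b (suc k) l) (*-congˡ (gauss-sym b k (suc l))))
                                      (sym (gauss-pascal b l k))

  bilateral-pos : ∀ z w b n j → bilateral z w b n (n ℕ.+ j) ≡ thetaTerm z b j
  bilateral-pos z w b zero    j = ≡.refl
  bilateral-pos z w b (suc n) j = bilateral-pos z w b n j

  -- The bilateral indices i + 1 and -i carry the same Gaussian binomial. Divided by (b;b)_(2n+1)
  -- this is, up to normalisation, a Bailey pair relative to b whose α-part is
  -- `thetaTerm z b (suc i) + thetaTerm w b i`.
  foldedTheta : ∀ {z w b} → z * w ≈ b → ∀ n → qpoch z b (suc n) * qpoch w b n ≈
    antidiag n (λ i m → gauss b m (suc (i ℕ.+ i ℕ.+ m)) * (thetaTerm z b (suc i) + thetaTerm w b i))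
  foldedTheta {z} {w} {b} zw≈b n = begin
    qpoch z b (suc n) * qpoch w b n
      ≈⟨ finiteTheta zw≈b (suc n) n ⟨
    antidiag (suc n ℕ.+ n) (λ k l → gauss b k l * bilateral z w b n k)
      ≈⟨ antidiag-fold n (λ k l → gauss b k l * bilateral z w b n k) ⟩
    _ ≈⟨ antidiag-cong n step ⟩
    antidiag n (λ i m → gauss b m (suc (i ℕ.+ i ℕ.+ m)) * (thetaTerm z b (suc i) + thetaTerm w b i)) ∎
    where
    step : ∀ i m → i ℕ.+ m ≡ n →
      gauss b (suc (i ℕ.+ i ℕ.+ m)) m * bilateral z w b n (suc (i ℕ.+ i ℕ.+ m)) +
      gauss b m (suc (i ℕ.+ i ℕ.+ m)) * bilateral z w b n m ≈
      gauss b m (suc (i ℕ.+ i ℕ.+ m)) * (thetaTerm z b (suc i) + thetaTerm w b i)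
    step i m ≡.refl = trans
      (+-cong (*-cong (gauss-sym b _ m) (reflexive (≡.trans (≡.cong (bilateral z w b (i ℕ.+ m)) index) (bilateral-pos z w b (i ℕ.+ m) (suc i)))))
              (*-congˡ (bilateral-neg zw≈b (i ℕ.+ m) m i (ℕₚ.+-comm m i))))
      (sym (distribˡ _ _ _))
      where
      index : suc (i ℕ.+ i ℕ.+ m) ≡ i ℕ.+ m ℕ.+ suc i
      index = NS.solve 2 (λ i m → NS.con 1 NS.:+ (i NS.:+ i NS.:+ m) NS.:= i NS.:+ m NS.:+ (NS.con 1 NS.:+ i)) ≡.refl i m

  qpoch-0 : ∀ {x} b n → x ≈ 0# → qpoch x b n ≈ 1#
  qpoch-0 b zero    x≈0 = refl
  qpoch-0 b (suc n) x≈0 = trans (*-cong (qpoch-0 b n x≈0) (trans (+-congˡ (trans (-‿cong (trans (*-congʳ x≈0) (zeroˡ _))) -0#≈0#)) (+-identityʳ 1#)))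
                                (*-identityʳ 1#)

  ^-vanish : ∀ {x L n} → x ^ L ≈ 0# → L ℕ.≤ n → x ^ n ≈ 0#
  ^-vanish {x} {L} {n} nil L≤n = begin
    x ^ n                     ≡⟨ ≡.cong (x ^_) (ℕₚ.m+[n∸m]≡n L≤n) ⟨
    x ^ (L ℕ.+ (n ℕ.∸ L))     ≈⟨ ^-homo-* x L (n ℕ.∸ L) ⟩
    x ^ L * x ^ (n ℕ.∸ L)     ≈⟨ *-congʳ nil ⟩
    0# * x ^ (n ℕ.∸ L)        ≈⟨ zeroˡ _ ⟩
    0#                        ∎

  nilpotent-*ʳ : ∀ {x L} y → x ^ L ≈ 0# → (x * y) ^ L ≈ 0#
  nilpotent-*ʳ {x} {L} y nil = trans (^-distrib-* x y L) (trans (*-congʳ nil) (zeroˡ _))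

  -- Substitute for the geometric series: the difference d = f - g satisfies d = x d, hence d = x^L
  -- d = 0.
  1-nilpotent-cancel : ∀ {x L} → x ^ L ≈ 0# → ∀ {f g} → (1# + - x) * f ≈ (1# + - x) * g → f ≈ g
  1-nilpotent-cancel {x} {L} nil {f} {g} eq = x-y≈0⇒x≈y f g (trans (iterate L) (trans (*-congʳ nil) (zeroˡ _)))
    where
    iterate : ∀ n → f + - g ≈ x ^ n * (f + - g)
    iterate zero    = sym (*-identityˡ _)
    iterate (suc n) = begin
      f + - g ≈⟨ solve 3 (λ x f g → f :+ :- g := (con (+ 1) :+ :- x) :* f :+ :- ((con (+ 1) :+ :- x) :* g) :+ x :* (f :+ :- g)) refl x f g ⟩
      (1# + - x) * f + - ((1# + - x) * g) + x * (f + - g) ≈⟨ +-congʳ (trans (+-congʳ eq) (-‿inverseʳ _)) ⟩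
      0# + x * (f + - g)      ≈⟨ +-identityˡ _ ⟩
      x * (f + - g)           ≈⟨ *-congˡ (iterate n) ⟩
      x * (x ^ n * (f + - g)) ≈⟨ *-assoc _ _ _ ⟨
      x ^ suc n * (f + - g)   ∎

  qpoch-cancel : ∀ {x L} b n → x ^ L ≈ 0# → ∀ {f g} → qpoch x b n * f ≈ qpoch x b n * g → f ≈ g
  qpoch-cancel b zero    nil eq = trans (sym (*-identityˡ _)) (trans eq (*-identityˡ _))
  qpoch-cancel {x} {L} b (suc n) nil eq = 1-nilpotent-cancel {L = L} (nilpotent-*ʳ {L = L} (b ^ n) nil)
    (qpoch-cancel {L = L} b n nil (trans (sym (*-assoc _ _ _)) (trans eq (*-assoc _ _ _))))

  -- As b is nilpotent, qpoch x b K is the infinite product (x;b)∞ for every K ≥ L.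
  module Nilpotent {b L} (nil : b ^ L ≈ 0#) where

    qpoch-extend : ∀ x {m} n → L ℕ.≤ m → qpoch x b (m ℕ.+ n) ≈ qpoch x b m
    qpoch-extend x {m} n L≤m = begin
      qpoch x b (m ℕ.+ n)                     ≈⟨ qpoch-+ x b m n ⟩
      qpoch x b m * qpoch (x * b ^ m) b n     ≈⟨ *-congˡ (qpoch-0 b n (trans (*-congˡ (^-vanish nil L≤m)) (zeroʳ x))) ⟩
      qpoch x b m * 1#                        ≈⟨ *-identityʳ _ ⟩
      qpoch x b m                             ∎

    qpoch-stable : ∀ x {m n} → L ℕ.≤ m → L ℕ.≤ n → qpoch x b m ≈ qpoch x b n
    qpoch-stable x {m} {n} L≤m L≤n = begin
      qpoch x b m           ≈⟨ qpoch-extend x n L≤m ⟨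
      qpoch x b (m ℕ.+ n)   ≡⟨ ≡.cong (qpoch x b) (ℕₚ.+-comm m n) ⟩
      qpoch x b (n ℕ.+ m)   ≈⟨ qpoch-extend x m L≤n ⟩
      qpoch x b n           ∎

    qpoch-step : ∀ x {K} → L ℕ.≤ K → qpoch x b K ≈ (1# + - x) * qpoch (x * b) b K
    qpoch-step x {K} L≤K = trans (qpoch-stable x L≤K (ℕₚ.m≤n⇒m≤1+n L≤K)) (qpoch-suc x b K)

    -- A Gaussian binomial with large l is the reciprocal of (b;b)_k, so this inverse exists without
    -- any assumption on the ring.
    gauss-inverse : ∀ k {l} → L ℕ.≤ l → gauss b k l * qpoch b b k ≈ 1#
    gauss-inverse k L≤l = trans (gauss-poch b k _) (qpoch-0 b k (^-vanish nil (ℕₚ.m≤n⇒m≤1+n L≤l)))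

    -- Both sides are (b^(l+1);b)∞ / (b;b)_k; on the right `gauss b k l′` with large l′ plays the
    -- reciprocal.
    gauss-tail : ∀ k l {K l′} → L ℕ.≤ K → L ℕ.≤ l′ →
      gauss b k l * qpoch (b ^ suc (k ℕ.+ l)) b K ≈ gauss b k l′ * qpoch (b ^ suc l) b K
    gauss-tail k l {K} {l′} L≤K L≤l′ = qpoch-cancel {L = L} b k nil (begin
      qpoch b b k * (gauss b k l * qpoch (b ^ suc (k ℕ.+ l)) b K)
        ≈⟨ solve 3 (λ p g r → p :* (g :* r) := (g :* p) :* r) refl _ _ _ ⟩
      gauss b k l * qpoch b b k * qpoch (b ^ suc (k ℕ.+ l)) b K
        ≈⟨ *-cong (gauss-poch b k l) (qpoch-cong K exponent refl) ⟩
      qpoch (b ^ suc l) b k * qpoch (b ^ suc l * b ^ k) b K   ≈⟨ qpoch-+ (b ^ suc l) b k K ⟨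
      qpoch (b ^ suc l) b (k ℕ.+ K)                           ≈⟨ qpoch-stable _ (ℕₚ.≤-trans L≤K (ℕₚ.m≤n+m K k)) L≤K ⟩
      qpoch (b ^ suc l) b K                                   ≈⟨ *-identityˡ _ ⟨
      1# * qpoch (b ^ suc l) b K                              ≈⟨ *-congʳ (gauss-inverse k L≤l′) ⟨
      gauss b k l′ * qpoch b b k * qpoch (b ^ suc l) b K
        ≈⟨ solve 3 (λ g p r → (g :* p) :* r := p :* (g :* r)) refl _ _ _ ⟩
      qpoch b b k * (gauss b k l′ * qpoch (b ^ suc l) b K) ∎)
      where
      exponent : b ^ suc (k ℕ.+ l) ≈ b ^ suc l * b ^ k
      exponent = trans (reflexive (≡.cong (b ^_) (≡.cong suc (ℕₚ.+-comm k l)))) (^-homo-* b (suc l) k)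

    thetaTerm-vanish : ∀ x j → suc L ℕ.≤ j → thetaTerm x b j ≈ 0#
    thetaTerm-vanish x (suc j) (s≤s L≤j) =
      trans (*-congˡ (trans (-‿cong (trans (*-congˡ (^-vanish nil L≤j)) (zeroʳ x))) -0#≈0#)) (zeroʳ _)

    -- The limit of `foldedTheta`: for fixed i its Gaussian binomials become 1/(b;b)∞, which
    -- `qpoch b b K` cancels. The sum is the bilateral theta series folded into the index pairs i +
    -- 1 and -i.
    jacobi : ∀ {z w K M} → z * w ≈ b → L ℕ.≤ K → suc L ℕ.≤ M →
      qpoch z b K * qpoch w b K * qpoch b b K ≈ ∑ M (λ i → thetaTerm z b (suc i) + thetaTerm w b i)
    jacobi {z} {w} {K} {M} zw≈b L≤K L<M = begin
      qpoch z b K * qpoch w b K * qpoch b b K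
        ≈⟨ *-congʳ (*-cong (qpoch-stable z L≤K (ℕₚ.m≤n⇒m≤1+n L≤n)) (qpoch-stable w L≤K L≤n)) ⟩
      qpoch z b (suc n) * qpoch w b n * qpoch b b K
        ≈⟨ *-congʳ (foldedTheta zw≈b n) ⟩
      antidiag n (λ i m → gauss b m (suc (i ℕ.+ i ℕ.+ m)) * c i) * qpoch b b K
        ≈⟨ antidiag-*ʳ n _ _ ⟨
      antidiag n (λ i m → gauss b m (suc (i ℕ.+ i ℕ.+ m)) * c i * qpoch b b K)
        ≈⟨ antidiag-truncate M K limit vanish ⟩
      ∑ M c ∎
      where
      -- Long enough that each i below M leaves m at least K, where the Gaussian binomial is already
      -- a reciprocal.
      n = M ℕ.+ K
      L≤n : L ℕ.≤ n
      L≤n = ℕₚ.≤-trans L≤K (ℕₚ.m≤n+m K M)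
      c : ℕ → Carrier
      c i = thetaTerm z b (suc i) + thetaTerm w b i
      limit : ∀ i m → K ℕ.≤ m → gauss b m (suc (i ℕ.+ i ℕ.+ m)) * c i * qpoch b b K ≈ c i
      limit i m K≤m = begin
        gauss b m (suc (i ℕ.+ i ℕ.+ m)) * c i * qpoch b b K
          ≈⟨ *-congˡ (qpoch-stable b L≤K (ℕₚ.≤-trans L≤K K≤m)) ⟩
        gauss b m (suc (i ℕ.+ i ℕ.+ m)) * c i * qpoch b b m
          ≈⟨ solve 3 (λ g c p → g :* c :* p := g :* p :* c) refl _ _ _ ⟩
        gauss b m (suc (i ℕ.+ i ℕ.+ m)) * qpoch b b m * c i
          ≈⟨ *-congʳ (gauss-inverse m (ℕₚ.≤-trans L≤K (ℕₚ.≤-trans K≤m (ℕₚ.m≤n⇒m≤1+n (ℕₚ.m≤n+m m (i ℕ.+ i)))))) ⟩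
        1# * c i ≈⟨ *-identityˡ _ ⟩
        c i ∎
      vanish : ∀ i m → M ℕ.≤ i → gauss b m (suc (i ℕ.+ i ℕ.+ m)) * c i * qpoch b b K ≈ 0#
      vanish i m M≤i = trans (*-congʳ (trans (*-congˡ (trans (+-cong (thetaTerm-vanish z (suc i) (ℕₚ.m≤n⇒m≤1+n L<i)) (thetaTerm-vanish w i L<i)) (+-identityʳ _))) (zeroʳ _))) (zeroˡ _)
        where
        L<i : suc L ℕ.≤ i
        L<i = ℕₚ.≤-trans L<M M≤i

    module _ {K N} (L≤K : L ℕ.≤ K) (L≤N : L ℕ.≤ N) where

      private
        q = b

      -- The Durfee identity at x = q^(2i+1). With n = i + m, `gauss-tail` trades the limiting
      -- Gaussian binomial for the one in `foldedTheta` together with the tail (q^(2n+2);q)∞ of the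
      -- Bailey sum.
      durfee-limit : ∀ i → ∑ N (λ m → q ^ (m ℕ.* m) * (q ^ suc (i ℕ.+ i)) ^ m *
        (gauss q m (suc (i ℕ.+ i ℕ.+ m)) * qpoch (q ^ suc (m ℕ.+ suc (i ℕ.+ i ℕ.+ m))) q K)) ≈ 1#
      durfee-limit i = begin
        ∑ N (λ m → q ^ (m ℕ.* m) * x ^ m * (gauss q m (suc (i ℕ.+ i ℕ.+ m)) * qpoch (q ^ suc (m ℕ.+ suc (i ℕ.+ i ℕ.+ m))) q K))
          ≈⟨ antidiag-truncate N K limit vanish ⟨
        antidiag (N ℕ.+ K) (λ k l → gauss q k l * (q ^ (k ℕ.* k) * x ^ k * qpoch (x * q ^ suc k) q l))
          ≈⟨ durfee q x (N ℕ.+ K) ⟩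
        1# ∎
        where
        x = q ^ suc (i ℕ.+ i)
        limit : ∀ m l → K ℕ.≤ l → gauss q m l * (q ^ (m ℕ.* m) * x ^ m * qpoch (x * q ^ suc m) q l) ≈
          q ^ (m ℕ.* m) * x ^ m * (gauss q m (suc (i ℕ.+ i ℕ.+ m)) * qpoch (q ^ suc (m ℕ.+ suc (i ℕ.+ i ℕ.+ m))) q K)
        limit m l K≤l = begin
          gauss q m l * (q ^ (m ℕ.* m) * x ^ m * qpoch (x * q ^ suc m) q l)
            ≈⟨ solve 3 (λ g y p → g :* (y :* p) := y :* (g :* p)) refl _ _ _ ⟩
          q ^ (m ℕ.* m) * x ^ m * (gauss q m l * qpoch (x * q ^ suc m) q l)
            ≈⟨ *-congˡ (*-congˡ (trans (qpoch-stable _ L≤l L≤K) (qpoch-cong K exponent refl))) ⟩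
          q ^ (m ℕ.* m) * x ^ m * (gauss q m l * qpoch (q ^ suc (suc (i ℕ.+ i ℕ.+ m))) q K)
            ≈⟨ *-congˡ (gauss-tail m (suc (i ℕ.+ i ℕ.+ m)) L≤K L≤l) ⟨
          q ^ (m ℕ.* m) * x ^ m * (gauss q m (suc (i ℕ.+ i ℕ.+ m)) * qpoch (q ^ suc (m ℕ.+ suc (i ℕ.+ i ℕ.+ m))) q K) ∎
          where
          L≤l : L ℕ.≤ l
          L≤l = ℕₚ.≤-trans L≤K K≤l
          exponent : x * q ^ suc m ≈ q ^ suc (suc (i ℕ.+ i ℕ.+ m))
          exponent = trans (sym (^-homo-* q (suc (i ℕ.+ i)) (suc m))) (reflexive (≡.cong (λ e → q ^ suc e) (ℕₚ.+-suc (i ℕ.+ i) m)))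
        vanish : ∀ m l → N ℕ.≤ m → gauss q m l * (q ^ (m ℕ.* m) * x ^ m * qpoch (x * q ^ suc m) q l) ≈ 0#
        vanish m l N≤m = trans (*-congˡ (trans (*-congʳ (trans (*-congʳ (^-vanish nil (m≤m² m (ℕₚ.≤-trans L≤N N≤m)))) (zeroˡ _))) (zeroˡ _))) (zeroʳ _)
          where
          m≤m² : ∀ m → L ℕ.≤ m → L ℕ.≤ m ℕ.* m
          m≤m² zero    le = le
          m≤m² (suc m) le = ℕₚ.≤-trans le (ℕₚ.m≤m+n (suc m) (m ℕ.* suc m))

      -- The series Ω(x, y), cut off after N terms.
      baileySum : Carrier → Carrier → Carrier
      baileySum x y = ∑ N (λ n → q ^ (n ℕ.* n ℕ.+ n) * qpoch (q ^ suc (suc (n ℕ.+ n))) q K * (qpoch x q (suc n) * qpoch y q n))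

      -- Bailey's lemma in the limit: insert `foldedTheta` and exchange the sums. As n² + n = i² + i
      -- + m² + (2i + 1) m for n = i + m, the sum over m is the one in `durfee-limit` and equals
      -- one.
      baileySum≈theta : ∀ {x y} → x * y ≈ q →
        baileySum x y ≈ ∑ N (λ i → (thetaTerm x q (suc i) + thetaTerm y q i) * q ^ (i ℕ.* i ℕ.+ i))
      baileySum≈theta {x} {y} xy≈q = begin
        baileySum x y
          ≈⟨ ∑-cong N (λ n → trans (*-congˡ (foldedTheta xy≈q n)) (sym (antidiag-*ˡ n _ _))) ⟩
        ∑ N (λ n → antidiag n (λ i m → q ^ (n ℕ.* n ℕ.+ n) * qpoch (q ^ suc (suc (n ℕ.+ n))) q K * (gauss q m (suc (i ℕ.+ i ℕ.+ m)) * c i)))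
          ≈⟨ ∑-cong N (λ n → antidiag-cong n (term n)) ⟩
        ∑ N (λ n → antidiag n g)
          ≈⟨ ∑-antidiag N g vanish ⟩
        ∑ N (λ i → ∑ N (g i))
          ≈⟨ ∑-cong N (λ i → trans (∑-*ˡ N (c i * q ^ (i ℕ.* i ℕ.+ i)) (λ m → h i m * r i m)) (trans (*-congˡ (durfee-limit i)) (*-identityʳ _))) ⟩
        ∑ N (λ i → c i * q ^ (i ℕ.* i ℕ.+ i)) ∎
        where
        c : ℕ → Carrier
        c i = thetaTerm x q (suc i) + thetaTerm y q i
        h r g : ℕ → ℕ → Carrier
        h i m = q ^ (m ℕ.* m) * (q ^ suc (i ℕ.+ i)) ^ m
        r i m = gauss q m (suc (i ℕ.+ i ℕ.+ m)) * qpoch (q ^ suc (m ℕ.+ suc (i ℕ.+ i ℕ.+ m))) q K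
        g i m = c i * q ^ (i ℕ.* i ℕ.+ i) * (h i m * r i m)
        power : ∀ i m → q ^ ((i ℕ.+ m) ℕ.* (i ℕ.+ m) ℕ.+ (i ℕ.+ m)) ≈ q ^ (i ℕ.* i ℕ.+ i) * h i m
        power i m = begin
          q ^ ((i ℕ.+ m) ℕ.* (i ℕ.+ m) ℕ.+ (i ℕ.+ m))
            ≡⟨ ≡.cong (q ^_) (NS.solve 2 (λ i m → (i NS.:+ m) NS.:* (i NS.:+ m) NS.:+ (i NS.:+ m) NS.:=
                 i NS.:* i NS.:+ i NS.:+ (m NS.:* m NS.:+ (NS.con 1 NS.:+ (i NS.:+ i)) NS.:* m)) ≡.refl i m) ⟩
          q ^ (i ℕ.* i ℕ.+ i ℕ.+ (m ℕ.* m ℕ.+ suc (i ℕ.+ i) ℕ.* m))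
            ≈⟨ ^-homo-* q (i ℕ.* i ℕ.+ i) _ ⟩
          q ^ (i ℕ.* i ℕ.+ i) * q ^ (m ℕ.* m ℕ.+ suc (i ℕ.+ i) ℕ.* m)
            ≈⟨ *-congˡ (trans (^-homo-* q (m ℕ.* m) _) (*-congˡ (sym (^-assocʳ q (suc (i ℕ.+ i)) m)))) ⟩
          q ^ (i ℕ.* i ℕ.+ i) * h i m ∎
        term : ∀ n i m → i ℕ.+ m ≡ n →
          q ^ (n ℕ.* n ℕ.+ n) * qpoch (q ^ suc (suc (n ℕ.+ n))) q K * (gauss q m (suc (i ℕ.+ i ℕ.+ m)) * c i) ≈ g i m
        term n i m ≡.refl = trans
          (*-congʳ (*-cong (power i m) (qpoch-cong K (reflexive (≡.cong (λ e → q ^ suc e) exponent)) refl)))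
          (solve 5 (λ a h p g c → a :* h :* p :* (g :* c) := c :* a :* (h :* (g :* p))) refl _ _ _ _ _)
          where
          exponent : suc (i ℕ.+ m ℕ.+ (i ℕ.+ m)) ≡ m ℕ.+ suc (i ℕ.+ i ℕ.+ m)
          exponent = NS.solve 2 (λ i m → NS.con 1 NS.:+ (i NS.:+ m NS.:+ (i NS.:+ m)) NS.:= m NS.:+ (NS.con 1 NS.:+ (i NS.:+ i NS.:+ m))) ≡.refl i m
        vanish : ∀ i m → N ℕ.≤ i ℕ.+ m → g i m ≈ 0#
        vanish i m N≤ = trans (solve 4 (λ c a h r → c :* a :* (h :* r) := (a :* h) :* (c :* r)) refl _ _ _ _)
          (trans (*-congʳ (trans (sym (power i m)) (^-vanish nil (ℕₚ.≤-trans L≤N (ℕₚ.≤-trans N≤ (ℕₚ.m≤n+m (i ℕ.+ m) ((i ℕ.+ m) ℕ.* (i ℕ.+ m)))))))) (zeroˡ _))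

-- Dissection of theta series by index modulo 5, and of products by residues.

module Dissections {ℓ₁ ℓ₂} (R : CommutativeRing ℓ₁ ℓ₂) where

  open CommutativeRing R hiding (zero)
  open SetoidReasoning setoid
  open RingSolver R
  open FiniteIdentities R
  open InfiniteProducts R

  ∑-++ : ∀ m n f → ∑ (m ℕ.+ n) f ≈ ∑ m f + ∑ n (λ i → f (m ℕ.+ i))
  ∑-++ zero    n f = sym (+-identityˡ _)
  ∑-++ (suc m) n f = trans (+-congˡ (∑-++ m n (λ i → f (suc i)))) (sym (+-assoc _ _ _))

  ∑-blocks : ∀ d n f → ∑ (n ℕ.* d) f ≈ ∑ n (λ s → ∑ d (λ r → f (s ℕ.* d ℕ.+ r)))
  ∑-blocks d zero    f = refl
  ∑-blocks d (suc n) f = begin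
    ∑ (d ℕ.+ n ℕ.* d) f
      ≈⟨ ∑-++ d (n ℕ.* d) f ⟩
    ∑ d f + ∑ (n ℕ.* d) (λ i → f (d ℕ.+ i))
      ≈⟨ +-congˡ (∑-blocks d n (λ i → f (d ℕ.+ i))) ⟩
    ∑ d f + ∑ n (λ s → ∑ d (λ r → f (d ℕ.+ (s ℕ.* d ℕ.+ r))))
      ≈⟨ +-congˡ (∑-cong n (λ s → ∑-cong d (λ r → reflexive (≡.cong f (≡.sym (ℕₚ.+-assoc d (s ℕ.* d) r)))))) ⟩
    ∑ (suc n) (λ s → ∑ d (λ r → f (s ℕ.* d ℕ.+ r))) ∎

  ∑-swap : ∀ m n (g : ℕ → ℕ → Carrier) → ∑ m (λ s → ∑ n (λ r → g r s)) ≈ ∑ n (λ r → ∑ m (g r))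
  ∑-swap m zero    g = ∑-zero m (λ _ → refl)
  ∑-swap m (suc n) g = trans (∑-+ m (g 0) (λ s → ∑ n (λ r → g (suc r) s))) (+-congˡ (∑-swap m n (λ r → g (suc r))))

  thetaTerm-cong : ∀ n {x y a b} → x ≈ y → a ≈ b → thetaTerm x a n ≈ thetaTerm y b n
  thetaTerm-cong zero    x≈y a≈b = refl
  thetaTerm-cong (suc n) x≈y a≈b =
    *-cong (thetaTerm-cong n x≈y a≈b) (-‿cong (*-cong x≈y (^-congˡ n a≈b)))

  thetaTerm-+ : ∀ x b m n → thetaTerm x b (m ℕ.+ n) ≈ thetaTerm x b m * thetaTerm (x * b ^ m) b n
  thetaTerm-+ x b m zero    = trans (reflexive (≡.cong (thetaTerm x b) (ℕₚ.+-identityʳ m))) (sym (*-identityʳ _))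
  thetaTerm-+ x b m (suc n) = begin
    thetaTerm x b (m ℕ.+ suc n)                                ≡⟨ ≡.cong (thetaTerm x b) (ℕₚ.+-suc m n) ⟩
    thetaTerm x b (m ℕ.+ n) * - (x * b ^ (m ℕ.+ n))
      ≈⟨ *-cong (thetaTerm-+ x b m n) (-‿cong (trans (*-congˡ (^-homo-* b m n)) (sym (*-assoc _ _ _)))) ⟩
    thetaTerm x b m * thetaTerm (x * b ^ m) b n * - (x * b ^ m * b ^ n)  ≈⟨ *-assoc _ _ _ ⟩
    thetaTerm x b m * thetaTerm (x * b ^ m) b (suc n)          ∎

  thetaTerm-suc : ∀ x b n → thetaTerm x b (suc n) ≈ - x * thetaTerm (x * b) b n
  thetaTerm-suc x b n = trans (thetaTerm-+ x b 1 n)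
    (*-cong (trans (*-identityˡ _) (-‿cong (*-identityʳ x))) (thetaTerm-cong n (*-congˡ (*-identityʳ b)) refl))

  thetaTerm-scale : ∀ x y b n → thetaTerm (x * y) b n ≈ thetaTerm x b n * y ^ n
  thetaTerm-scale x y b zero    = sym (*-identityʳ 1#)
  thetaTerm-scale x y b (suc n) = trans (*-congʳ (thetaTerm-scale x y b n))
    (solve 5 (λ t p x y e → t :* p :* :- (x :* y :* e) := t :* :- (x :* e) :* (y :* p)) refl _ _ _ _ _)

  -- From 5s(5s - 1)/2 = 25 s(s - 1)/2 + 10 s; in the step from s to s + 1 the 10 is 0 + 1 + 2 + 3 +
  -- 4.
  thetaTerm-*5 : ∀ x b s → thetaTerm x b (s ℕ.* 5) ≈ thetaTerm (x ^ 5 * b ^ 10) (b ^ 25) s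
  thetaTerm-*5 x b zero    = refl
  thetaTerm-*5 x b (suc s) = begin
    thetaTerm x b (5 ℕ.+ s ℕ.* 5)
      ≈⟨ solve 4 (λ t x b e → t :* :- (x :* e) :* :- (x :* (b :* e)) :* :- (x :* (b :* (b :* e))) :* :- (x :* (b :* (b :* (b :* e))))
            :* :- (x :* (b :* (b :* (b :* (b :* e))))) := t :* :- (x :^ 5 :* b :^ 10 :* e :^ 5)) refl _ _ _ _ ⟩
    thetaTerm x b (s ℕ.* 5) * - (x ^ 5 * b ^ 10 * (b ^ (s ℕ.* 5)) ^ 5)
      ≈⟨ *-cong (thetaTerm-*5 x b s) (-‿cong (*-congˡ power)) ⟩
    thetaTerm (x ^ 5 * b ^ 10) (b ^ 25) (suc s) ∎
    where
    power : (b ^ (s ℕ.* 5)) ^ 5 ≈ (b ^ 25) ^ s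
    power = trans (^-assocʳ b (s ℕ.* 5) 5) (trans
      (reflexive (≡.cong (b ^_) (NS.solve 1 (λ s → s NS.:* NS.con 5 NS.:* NS.con 5 NS.:= NS.con 25 NS.:* s) ≡.refl s)))
      (sym (^-assocʳ b 25 s)))

  thetaTerm-dissect : ∀ x b r s → thetaTerm x b (s ℕ.* 5 ℕ.+ r) ≈
    thetaTerm x b r * thetaTerm (x ^ 5 * b ^ (10 ℕ.+ 5 ℕ.* r)) (b ^ 25) s
  thetaTerm-dissect x b r s = begin
    thetaTerm x b (s ℕ.* 5 ℕ.+ r)
      ≈⟨ thetaTerm-+ x b (s ℕ.* 5) r ⟩
    thetaTerm x b (s ℕ.* 5) * thetaTerm (x * b ^ (s ℕ.* 5)) b r
      ≈⟨ *-cong (thetaTerm-*5 x b s) (trans (thetaTerm-scale x _ b r) (*-congˡ power)) ⟩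
    thetaTerm (x ^ 5 * b ^ 10) (b ^ 25) s * (thetaTerm x b r * (b ^ (5 ℕ.* r)) ^ s)
      ≈⟨ solve 3 (λ t u e → t :* (u :* e) := u :* (t :* e)) refl _ _ _ ⟩
    thetaTerm x b r * (thetaTerm (x ^ 5 * b ^ 10) (b ^ 25) s * (b ^ (5 ℕ.* r)) ^ s)
      ≈⟨ *-congˡ (thetaTerm-scale _ _ (b ^ 25) s) ⟨
    thetaTerm x b r * thetaTerm (x ^ 5 * b ^ 10 * b ^ (5 ℕ.* r)) (b ^ 25) s
      ≈⟨ *-congˡ (thetaTerm-cong s (trans (*-assoc _ _ _) (*-congˡ (sym (^-homo-* b 10 (5 ℕ.* r))))) refl) ⟩
    thetaTerm x b r * thetaTerm (x ^ 5 * b ^ (10 ℕ.+ 5 ℕ.* r)) (b ^ 25) s ∎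
    where
    power : (b ^ (s ℕ.* 5)) ^ r ≈ (b ^ (5 ℕ.* r)) ^ s
    power = trans (^-assocʳ b (s ℕ.* 5) r) (trans
      (reflexive (≡.cong (b ^_) (NS.solve 2 (λ s r → s NS.:* NS.con 5 NS.:* r NS.:= NS.con 5 NS.:* r NS.:* s) ≡.refl s r)))
      (sym (^-assocʳ b (5 ℕ.* r) s)))

  thetaSum-dissect : ∀ x b M → ∑ (M ℕ.* 5) (thetaTerm x b) ≈
    ∑ 5 (λ r → thetaTerm x b r * ∑ M (thetaTerm (x ^ 5 * b ^ (10 ℕ.+ 5 ℕ.* r)) (b ^ 25)))
  thetaSum-dissect x b M = begin
    ∑ (M ℕ.* 5) (thetaTerm x b)
      ≈⟨ ∑-blocks 5 M (thetaTerm x b) ⟩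
    ∑ M (λ s → ∑ 5 (λ r → thetaTerm x b (s ℕ.* 5 ℕ.+ r)))
      ≈⟨ ∑-swap M 5 (λ r s → thetaTerm x b (s ℕ.* 5 ℕ.+ r)) ⟩
    ∑ 5 (λ r → ∑ M (λ s → thetaTerm x b (s ℕ.* 5 ℕ.+ r)))
      ≈⟨ ∑-cong 5 (λ r → trans (∑-cong M (thetaTerm-dissect x b r)) (∑-*ˡ M _ _)) ⟩
    ∑ 5 (λ r → thetaTerm x b r * ∑ M (thetaTerm (x ^ 5 * b ^ (10 ℕ.+ 5 ℕ.* r)) (b ^ 25))) ∎

  -- From i(i - 1)/2 + i² + i = 3 i(i - 1)/2 + 2i: the extra factor of the Bailey sum changes the
  -- base from q to q³.
  thetaTerm-cubic : ∀ y q i → thetaTerm y q i * q ^ (i ℕ.* i ℕ.+ i) ≈ thetaTerm (y * q ^ 2) (q ^ 3) i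
  thetaTerm-cubic y q zero    = *-identityʳ _
  thetaTerm-cubic y q (suc i) = begin
    thetaTerm y q i * - (y * q ^ i) * q ^ (suc i ℕ.* suc i ℕ.+ suc i)
      ≈⟨ *-congˡ (trans (reflexive (≡.cong (q ^_) exponent)) (trans (^-homo-* q (i ℕ.* i ℕ.+ i) _) (*-congˡ (^-homo-* q 2 (i ℕ.+ i))))) ⟩
    thetaTerm y q i * - (y * q ^ i) * (q ^ (i ℕ.* i ℕ.+ i) * (q ^ 2 * q ^ (i ℕ.+ i)))
      ≈⟨ solve 6 (λ t y e s q r → t :* :- (y :* e) :* (s :* (q :* r)) := (t :* s) :* :- (y :* q :* (e :* r))) refl _ _ _ _ _ _ ⟩
    thetaTerm y q i * q ^ (i ℕ.* i ℕ.+ i) * - (y * q ^ 2 * (q ^ i * q ^ (i ℕ.+ i)))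
      ≈⟨ *-cong (thetaTerm-cubic y q i) (-‿cong (*-congˡ power)) ⟩
    thetaTerm (y * q ^ 2) (q ^ 3) (suc i) ∎
    where
    exponent : suc i ℕ.* suc i ℕ.+ suc i ≡ i ℕ.* i ℕ.+ i ℕ.+ (2 ℕ.+ (i ℕ.+ i))
    exponent = NS.solve 1 (λ i → (NS.con 1 NS.:+ i) NS.:* (NS.con 1 NS.:+ i) NS.:+ (NS.con 1 NS.:+ i) NS.:=
      i NS.:* i NS.:+ i NS.:+ (NS.con 2 NS.:+ (i NS.:+ i))) ≡.refl i
    power : q ^ i * q ^ (i ℕ.+ i) ≈ (q ^ 3) ^ i
    power = trans (sym (^-homo-* q i (i ℕ.+ i))) (trans
      (reflexive (≡.cong (q ^_) (NS.solve 1 (λ i → i NS.:+ (i NS.:+ i) NS.:= NS.con 3 NS.:* i) ≡.refl i)))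
      (sym (^-assocʳ q 3 i)))

  ∏ : ℕ → (ℕ → Carrier) → Carrier
  ∏ zero    f = 1#
  ∏ (suc n) f = f 0 * ∏ n (λ i → f (suc i))

  ∏-cong : ∀ n {f g} → (∀ i → f i ≈ g i) → ∏ n f ≈ ∏ n g
  ∏-cong zero    f≈g = refl
  ∏-cong (suc n) f≈g = *-cong (f≈g 0) (∏-cong n (λ i → f≈g (suc i)))

  ∏-* : ∀ n f g → ∏ n f * ∏ n g ≈ ∏ n (λ i → f i * g i)
  ∏-* zero    f g = *-identityʳ _
  ∏-* (suc n) f g = trans (solve 4 (λ a b c d → (a :* b) :* (c :* d) := (a :* c) :* (b :* d)) refl _ _ _ _)
                          (*-congˡ (∏-* n (λ i → f (suc i)) (λ i → g (suc i))))

  ∏-1 : ∀ n → ∏ n (λ _ → 1#) ≈ 1#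
  ∏-1 zero    = refl
  ∏-1 (suc n) = trans (*-identityˡ _) (∏-1 n)

  qpoch-∏ : ∀ x b n → qpoch x b n ≈ ∏ n (λ r → 1# + - (x * b ^ r))
  qpoch-∏ x b zero    = refl
  qpoch-∏ x b (suc n) = trans (qpoch-suc x b n) (*-cong (+-congˡ (-‿cong (sym (*-identityʳ x))))
    (trans (qpoch-∏ (x * b) b n) (∏-cong n (λ r → +-congˡ (-‿cong (*-assoc _ _ _))))))

  qpoch-split : ∀ x b d K → qpoch x b (K ℕ.* d) ≈ ∏ d (λ r → qpoch (x * b ^ r) (b ^ d) K)
  qpoch-split x b d zero    = sym (∏-1 d)
  qpoch-split x b d (suc K) = begin
    qpoch x b (d ℕ.+ K ℕ.* d)                                   ≡⟨ ≡.cong (qpoch x b) (ℕₚ.+-comm d (K ℕ.* d)) ⟩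
    qpoch x b (K ℕ.* d ℕ.+ d)                                   ≈⟨ qpoch-+ x b (K ℕ.* d) d ⟩
    qpoch x b (K ℕ.* d) * qpoch (x * b ^ (K ℕ.* d)) b d
      ≈⟨ *-cong (qpoch-split x b d K) (trans (qpoch-∏ _ b d) (∏-cong d lastFactor)) ⟩
    ∏ d (λ r → qpoch (x * b ^ r) (b ^ d) K) * ∏ d (λ r → 1# + - (x * b ^ r * (b ^ d) ^ K))
      ≈⟨ ∏-* d _ _ ⟩
    ∏ d (λ r → qpoch (x * b ^ r) (b ^ d) (suc K)) ∎
    where
    lastFactor : ∀ r → 1# + - (x * b ^ (K ℕ.* d) * b ^ r) ≈ 1# + - (x * b ^ r * (b ^ d) ^ K)
    lastFactor r = +-congˡ (-‿cong (begin
      x * b ^ (K ℕ.* d) * b ^ r     ≈⟨ solve 3 (λ x k r → x :* k :* r := x :* r :* k) refl _ _ _ ⟩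
      x * b ^ r * b ^ (K ℕ.* d)     ≡⟨ ≡.cong (λ e → x * b ^ r * b ^ e) (ℕₚ.*-comm K d) ⟩
      x * b ^ r * b ^ (d ℕ.* K)     ≈⟨ *-congˡ (^-assocʳ b d K) ⟨
      x * b ^ r * (b ^ d) ^ K       ∎))

  -- c is the cofactor of the relation r in x - y.
  ≈-modulo : ∀ {r c x y} → r ≈ 0# → x ≈ y + r * c → x ≈ y
  ≈-modulo r≈0 eq = trans eq (trans (+-congˡ (trans (*-congʳ r≈0) (zeroˡ _))) (+-identityʳ _))

  -- The reduction of PP₃ to three Bailey sums.

  module BaileyPair {q L} (nil : q ^ L ≈ 0#) {z z⁻¹} (inverse : z * z⁻¹ ≈ 1#)
                    {K} (L≤K : L ℕ.≤ K) where

    open Nilpotent {q} {L} nil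

    private
      relation : z * z⁻¹ + - 1# ≈ 0#
      relation = trans (+-congʳ inverse) (-‿inverseʳ 1#)

    -- All four products contain (zq)_(n-1) or (q/z)_(n-1). Without these a polynomial identity
    -- modulo z z⁻¹ = 1 remains. The case n = 0 is separate because an empty product has no factor 1
    -- - z to peel off.
    pair-term : ∀ n →
      qpoch (z * q) q (suc n) * qpoch z⁻¹ q n + z * (qpoch (z⁻¹ * q) q (suc n) * qpoch z q n) ≈
      (1# + - (q ^ suc (n ℕ.+ n))) * ((1# + z) * (qpoch z q n * qpoch z⁻¹ q n))
    pair-term zero = ≈-modulo relation (solve 3 (λ q z y →
        con (+ 1) :* (con (+ 1) :+ :- (z :* q :* con (+ 1))) :* con (+ 1)
          :+ z :* (con (+ 1) :* (con (+ 1) :+ :- (y :* q :* con (+ 1))) :* con (+ 1))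
        := (con (+ 1) :+ :- (q :* con (+ 1))) :* ((con (+ 1) :+ z) :* (con (+ 1) :* con (+ 1)))
          :+ (z :* y :+ :- con (+ 1)) :* (:- q)) refl q z z⁻¹)
    pair-term (suc m) = begin
      A * (1# + - (z * q * p)) * (1# + - (z * q * (q * p))) * qpoch z⁻¹ q (suc m) +
        z * (B * (1# + - (z⁻¹ * q * p)) * (1# + - (z⁻¹ * q * (q * p))) * qpoch z q (suc m))
        ≈⟨ +-cong (*-congˡ (qpoch-suc z⁻¹ q m)) (*-congˡ (*-congˡ (qpoch-suc z q m))) ⟩
      A * (1# + - (z * q * p)) * (1# + - (z * q * (q * p))) * ((1# + - z⁻¹) * B) +
        z * (B * (1# + - (z⁻¹ * q * p)) * (1# + - (z⁻¹ * q * (q * p))) * ((1# + - z) * A))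
        ≈⟨ ≈-modulo relation (solve 6 (λ q z y p A B →
             let P = q :* p
                 one = con (+ 1) in
             A :* (one :+ :- (z :* q :* p)) :* (one :+ :- (z :* q :* (q :* p))) :* ((one :+ :- y) :* B)
               :+ z :* (B :* (one :+ :- (y :* q :* p)) :* (one :+ :- (y :* q :* (q :* p))) :* ((one :+ :- z) :* A))
             := (one :+ :- (q :* (P :* P))) :* ((one :+ z) :* ((one :+ :- z) :* A :* ((one :+ :- y) :* B)))
               :+ (z :* y :+ :- one) :* (A :* B :* (:- z :+ P :* (one :+ q) :* z :+ q :* P :* P :* (y :+ :- (z :* y) :+ :- one))))
             refl q z z⁻¹ p A B) ⟩
      (1# + - (q * (q * p * (q * p)))) * ((1# + z) * ((1# + - z) * A * ((1# + - z⁻¹) * B)))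
        ≈⟨ *-cong (+-congˡ (-‿cong (*-congˡ (^-homo-* q (suc m) (suc m))))) (*-congˡ (*-cong (qpoch-suc z q m) (qpoch-suc z⁻¹ q m))) ⟨
      (1# + - (q ^ suc (suc m ℕ.+ suc m))) * ((1# + z) * (qpoch z q (suc m) * qpoch z⁻¹ q (suc m))) ∎
      where
      A = qpoch (z * q) q m
      B = qpoch (z⁻¹ * q) q m
      p = q ^ m

    pairSum : ℕ → Carrier
    pairSum N = ∑ N (λ n → q ^ (n ℕ.* n ℕ.+ n) * qpoch (q ^ suc (n ℕ.+ n)) q K * ((1# + z) * (qpoch z q n * qpoch z⁻¹ q n)))

    pairSum≈baileySums : ∀ {N} (L≤N : L ℕ.≤ N) →
      pairSum N ≈ baileySum L≤K L≤N (z * q) z⁻¹ + z * baileySum L≤K L≤N (z⁻¹ * q) z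
    pairSum≈baileySums {N} L≤N = begin
      pairSum N
        ≈⟨ ∑-cong N term ⟩
      ∑ N (λ n → a n * (b n * x n) + z * (a n * (b n * y n)))
        ≈⟨ ∑-cong N (λ n → +-cong (sym (*-assoc (a n) (b n) (x n))) (*-congˡ (sym (*-assoc (a n) (b n) (y n))))) ⟩
      ∑ N (λ n → a n * b n * x n + z * (a n * b n * y n))
        ≈⟨ ∑-+ N _ _ ⟩
      ∑ N (λ n → a n * b n * x n) + ∑ N (λ n → z * (a n * b n * y n))
        ≈⟨ +-congˡ (∑-*ˡ N z _) ⟩
      baileySum L≤K L≤N (z * q) z⁻¹ + z * baileySum L≤K L≤N (z⁻¹ * q) z ∎
      where
      a b x y : ℕ → Carrier
      a n = q ^ (n ℕ.* n ℕ.+ n)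
      b n = qpoch (q ^ suc (suc (n ℕ.+ n))) q K
      x n = qpoch (z * q) q (suc n) * qpoch z⁻¹ q n
      y n = qpoch (z⁻¹ * q) q (suc n) * qpoch z q n
      term : ∀ n → a n * qpoch (q ^ suc (n ℕ.+ n)) q K * ((1# + z) * (qpoch z q n * qpoch z⁻¹ q n)) ≈
        a n * (b n * x n) + z * (a n * (b n * y n))
      term n = begin
        a n * qpoch (q ^ suc (n ℕ.+ n)) q K * V
          ≈⟨ *-congʳ (*-congˡ (trans (qpoch-step _ L≤K) (*-congˡ (qpoch-cong K (*-comm _ _) refl)))) ⟩
        a n * ((1# + - (q ^ suc (n ℕ.+ n))) * b n) * V
          ≈⟨ solve 4 (λ a e b v → a :* (e :* b) :* v := a :* (b :* (e :* v))) refl _ _ _ _ ⟩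
        a n * (b n * ((1# + - (q ^ suc (n ℕ.+ n))) * V))
          ≈⟨ *-congˡ (*-congˡ (pair-term n)) ⟨
        a n * (b n * (x n + z * y n))
          ≈⟨ solve 5 (λ a b x z y → a :* (b :* (x :+ z :* y)) := a :* (b :* x) :+ z :* (a :* (b :* y))) refl _ _ _ _ _ ⟩
        a n * (b n * x n) + z * (a n * (b n * y n)) ∎
        where V = (1# + z) * (qpoch z q n * qpoch z⁻¹ q n)

    -- Since (1)_n = 0 for n ≥ 1, only the term n = 0 of Ω(q, 1) remains. Its multiple by 1 + z is
    -- therefore the term n = 0 of `pairSum`.
    qpoch≈baileySum : ∀ {N N′} (L≤N : L ℕ.≤ N) → suc N′ ≡ N → baileySum L≤K L≤N q 1# ≈ qpoch q q K
    qpoch≈baileySum {N′ = N} L≤N ≡.refl = begin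
      1# * qpoch (q ^ 2) q K * (1# * (1# + - (q * 1#)) * 1#) + ∑ N _
        ≈⟨ +-congˡ (∑-zero N (λ n → trans (*-congˡ (trans (*-congˡ (vanish n)) (zeroʳ _))) (zeroʳ _))) ⟩
      1# * qpoch (q ^ 2) q K * (1# * (1# + - (q * 1#)) * 1#) + 0#
        ≈⟨ solve 2 (λ p q → con (+ 1) :* p :* (con (+ 1) :* (con (+ 1) :+ :- (q :* con (+ 1))) :* con (+ 1)) :+ con (+ 0)
              := (con (+ 1) :+ :- q) :* p) refl _ _ ⟩
      (1# + - q) * qpoch (q ^ 2) q K
        ≈⟨ *-congˡ (qpoch-cong K (*-congˡ (*-identityʳ q)) refl) ⟩
      (1# + - q) * qpoch (q * q) q K
        ≈⟨ qpoch-step q L≤K ⟨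
      qpoch q q K ∎
      where
      vanish : ∀ n → qpoch 1# q (suc n) ≈ 0#
      vanish n = trans (qpoch-suc 1# q n) (trans (*-congʳ (-‿inverseʳ 1#)) (zeroˡ _))

    module _ (I : ℕ → Carrier) (I-inverse : ∀ n → I (suc n) * (qpoch (z * q ^ suc n) q K * qpoch (z⁻¹ * q ^ suc n) q K) ≈ 1#) where

      private
        D = (1# + z) * ((1# + - z) * qpoch (z * q) q K * ((1# + - z⁻¹) * qpoch (z⁻¹ * q) q K))

        shiftBase : ∀ x n → (1# + - x) * qpoch (x * q) q K ≈ qpoch x q n * qpoch (x * q ^ n) q K
        shiftBase x n = begin
          (1# + - x) * qpoch (x * q) q K          ≈⟨ qpoch-step x L≤K ⟨
          qpoch x q K                             ≈⟨ qpoch-stable x L≤K (ℕₚ.≤-trans L≤K (ℕₚ.m≤n+m K n)) ⟩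
          qpoch x q (n ℕ.+ K)                     ≈⟨ qpoch-+ x q n K ⟩
          qpoch x q n * qpoch (x * q ^ n) q K     ∎

        D*I : ∀ n → D * I (suc n) ≈ (1# + z) * (qpoch z q (suc n) * qpoch z⁻¹ q (suc n))
        D*I n = begin
          D * I (suc n)
            ≈⟨ *-congʳ (*-congˡ (*-cong (shiftBase z (suc n)) (shiftBase z⁻¹ (suc n)))) ⟩
          (1# + z) * (a * c * (b * d)) * I (suc n)
            ≈⟨ solve 6 (λ y a c b d i → y :* (a :* c :* (b :* d)) :* i := y :* (a :* b) :* (i :* (c :* d))) refl _ _ _ _ _ _ ⟩
          (1# + z) * (a * b) * (I (suc n) * (c * d))
            ≈⟨ *-congˡ (I-inverse n) ⟩
          (1# + z) * (a * b) * 1#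
            ≈⟨ *-identityʳ _ ⟩
          (1# + z) * (a * b) ∎
          where
          a = qpoch z q (suc n)
          b = qpoch z⁻¹ q (suc n)
          c = qpoch (z * q ^ suc n) q K
          d = qpoch (z⁻¹ * q ^ suc n) q K

      -- PP₃(z, q), with `I n` as the reciprocal of (z qⁿ;q)∞ (z⁻¹ qⁿ;q)∞.
      spt : ℕ → Carrier
      spt N = ∑ N (λ i → let n = suc i in q ^ (n ℕ.* n ℕ.+ n) * (qpoch (q ^ suc (n ℕ.+ n)) q K * I n))

      spt≈baileySums : ∀ {N N′} (L≤N : L ℕ.≤ N) → suc N′ ≡ N → D * spt N′ ≈
        baileySum L≤K L≤N (z * q) z⁻¹ + z * baileySum L≤K L≤N (z⁻¹ * q) z + - ((1# + z) * baileySum L≤K L≤N q 1#)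
      spt≈baileySums {N′ = N} L≤N ≡.refl = begin
        D * spt N
          ≈⟨ ∑-*ˡ N D _ ⟨
        ∑ N (λ i → D * (a (suc i) * (b (suc i) * I (suc i))))
          ≈⟨ ∑-cong N (λ i → trans (solve 4 (λ d a b i → d :* (a :* (b :* i)) := a :* b :* (d :* i)) refl _ _ _ _) (*-congˡ (D*I i))) ⟩
        tail
          -- The term n = 0 is added and subtracted, completing the sum to `pairSum`.
          ≈⟨ solve 2 (λ t u → t := u :+ t :+ :- u) refl tail head ⟩
        pairSum (suc N) + - head
          ≈⟨ +-cong (pairSum≈baileySums L≤N) (-‿cong head≈) ⟩
        baileySum L≤K L≤N (z * q) z⁻¹ + z * baileySum L≤K L≤N (z⁻¹ * q) z + - ((1# + z) * baileySum L≤K L≤N q 1#) ∎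
        where
        a b : ℕ → Carrier
        a n = q ^ (n ℕ.* n ℕ.+ n)
        b n = qpoch (q ^ suc (n ℕ.+ n)) q K
        head tail : Carrier
        head = 1# * qpoch (q ^ 1) q K * ((1# + z) * (1# * 1#))
        tail = ∑ N (λ i → a (suc i) * b (suc i) * ((1# + z) * (qpoch z q (suc i) * qpoch z⁻¹ q (suc i))))
        head≈ : head ≈ (1# + z) * baileySum L≤K L≤N q 1#
        head≈ = begin
          head ≈⟨ solve 2 (λ p z → con (+ 1) :* p :* ((con (+ 1) :+ z) :* (con (+ 1) :* con (+ 1))) := (con (+ 1) :+ z) :* p) refl _ _ ⟩
          (1# + z) * qpoch (q ^ 1) q K ≈⟨ *-congˡ (qpoch-cong K (*-identityʳ q) refl) ⟩
          (1# + z) * qpoch q q K       ≈⟨ *-congˡ (qpoch≈baileySum L≤N ≡.refl) ⟨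
          (1# + z) * baileySum L≤K L≤N q 1# ∎

-- Dissections at a primitive fifth root of unity.

module FifthRoots {ℓ₁ ℓ₂} (R : CommutativeRing ℓ₁ ℓ₂) where

  open CommutativeRing R hiding (zero)
  open Algebra.Properties.AbelianGroup +-abelianGroup using () renaming (x∙y⁻¹≈ε⇒x≈y to x-y≈0⇒x≈y)
  open SetoidReasoning setoid
  open RingSolver R
  open FiniteIdentities R
  open InfiniteProducts R
  open Dissections R

  module JacobiSums {b L} (nil : b ^ L ≈ 0#) where

    open Nilpotent {b} {L} nil

    -- Cutting the bilateral series into two one-sided ones lets each be dissected on its own; -z is
    -- its term of index one.
    jacobiSums : ∀ {z w K M} → z * w ≈ b → L ℕ.≤ K → suc L ℕ.≤ M →
      qpoch z b K * qpoch w b K * qpoch b b K ≈ ∑ M (thetaTerm w b) + - (z * ∑ M (thetaTerm (z * b) b))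
    jacobiSums {z} {w} {K} {M} zw≈b L≤K L<M = begin
      qpoch z b K * qpoch w b K * qpoch b b K
        ≈⟨ jacobi zw≈b L≤K L<M ⟩
      ∑ M (λ i → thetaTerm z b (suc i) + thetaTerm w b i)
        ≈⟨ ∑-+ M _ _ ⟩
      ∑ M (λ i → thetaTerm z b (suc i)) + ∑ M (thetaTerm w b)
        ≈⟨ +-congʳ (trans (∑-cong M (thetaTerm-suc z b)) (∑-*ˡ M (- z) _)) ⟩
      - z * ∑ M (thetaTerm (z * b) b) + ∑ M (thetaTerm w b)
        ≈⟨ solve 3 (λ z s t → :- z :* s :+ t := t :+ :- (z :* s)) refl _ _ _ ⟩
      ∑ M (thetaTerm w b) + - (z * ∑ M (thetaTerm (z * b) b)) ∎

    baileySum≈thetaSums : ∀ {x y K N} (L≤K : L ℕ.≤ K) (L≤N : L ℕ.≤ N) → x * y ≈ b →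
      baileySum L≤K L≤N x y ≈ ∑ N (thetaTerm (y * b ^ 2) (b ^ 3)) + - (x * ∑ N (thetaTerm (x * b ^ 3) (b ^ 3)))
    baileySum≈thetaSums {x} {y} {K} {N} L≤K L≤N xy≈b = begin
      baileySum L≤K L≤N x y
        ≈⟨ baileySum≈theta L≤K L≤N xy≈b ⟩
      ∑ N (λ i → (thetaTerm x b (suc i) + thetaTerm y b i) * b ^ (i ℕ.* i ℕ.+ i))
        ≈⟨ ∑-cong N term ⟩
      ∑ N (λ i → thetaTerm (y * b ^ 2) (b ^ 3) i + - x * thetaTerm (x * b ^ 3) (b ^ 3) i)
        ≈⟨ ∑-+ N _ _ ⟩
      ∑ N (thetaTerm (y * b ^ 2) (b ^ 3)) + ∑ N (λ i → - x * thetaTerm (x * b ^ 3) (b ^ 3) i)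
        ≈⟨ +-congˡ (trans (∑-*ˡ N (- x) _) (solve 2 (λ x s → :- x :* s := :- (x :* s)) refl _ _)) ⟩
      ∑ N (thetaTerm (y * b ^ 2) (b ^ 3)) + - (x * ∑ N (thetaTerm (x * b ^ 3) (b ^ 3))) ∎
      where
      term : ∀ i → (thetaTerm x b (suc i) + thetaTerm y b i) * b ^ (i ℕ.* i ℕ.+ i) ≈
        thetaTerm (y * b ^ 2) (b ^ 3) i + - x * thetaTerm (x * b ^ 3) (b ^ 3) i
      term i = begin
        (thetaTerm x b (suc i) + thetaTerm y b i) * s
          ≈⟨ *-congʳ (+-congʳ (thetaTerm-suc x b i)) ⟩
        (- x * thetaTerm (x * b) b i + thetaTerm y b i) * s
          ≈⟨ solve 4 (λ x t u s → (:- x :* t :+ u) :* s := u :* s :+ :- x :* (t :* s)) refl _ _ _ _ ⟩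
        thetaTerm y b i * s + - x * (thetaTerm (x * b) b i * s)
          ≈⟨ +-cong (thetaTerm-cubic y b i) (*-congˡ (trans (thetaTerm-cubic (x * b) b i) (thetaTerm-cong i (*-assoc _ _ _) refl))) ⟩
        thetaTerm (y * b ^ 2) (b ^ 3) i + - x * thetaTerm (x * b ^ 3) (b ^ 3) i ∎
        where s = b ^ (i ℕ.* i ℕ.+ i)

  -- Primitivity is expressed by the cyclotomic polynomial: u⁵ = 1 would admit u = 1, and in a ring
  -- with zero divisors even u ≠ 1 would not imply this relation.
  IsFifthRoot : Carrier → Set ℓ₂
  IsFifthRoot u = 1# + u + u ^ 2 + u ^ 3 + u ^ 4 ≈ 0#

  module FifthRoot {u} (Φ : IsFifthRoot u) where

    u^5≈1 : u ^ 5 ≈ 1#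
    u^5≈1 = ≈-modulo Φ (solve 1 (λ z → z :^ 5 := con (+ 1) :+ (con (+ 1) :+ z :+ z :^ 2 :+ z :^ 3 :+ z :^ 4) :* (z :- con (+ 1))) refl u)

    fifthRoot-² : IsFifthRoot (u ^ 2)
    fifthRoot-² = ≈-modulo Φ (solve 1 (λ z → con (+ 1) :+ z :^ 2 :+ (z :^ 2) :^ 2 :+ (z :^ 2) :^ 3 :+ (z :^ 2) :^ 4 :=
      con (+ 0) :+ (con (+ 1) :+ z :+ z :^ 2 :+ z :^ 3 :+ z :^ 4) :* (con (+ 1) :- z :+ z :^ 2 :- z :^ 3 :+ z :^ 4)) refl u)

    u^8≈u^3 : (u ^ 4) ^ 2 ≈ u ^ 3
    u^8≈u^3 = ≈-modulo Φ (solve 1 (λ z → (z :^ 4) :^ 2 := z :^ 3 :+ (con (+ 1) :+ z :+ z :^ 2 :+ z :^ 3 :+ z :^ 4) :* (:- z :^ 3 :+ z :^ 4)) refl u)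

    u^12≈u^2 : (u ^ 4) ^ 3 ≈ u ^ 2
    u^12≈u^2 = trans (solve 1 (λ z → (z :^ 4) :^ 3 := z :^ 2 :* (z :^ 5 :* z :^ 5)) refl u) (trans (*-congˡ (*-cong u^5≈1 u^5≈1)) (solve 1 (λ z → z :^ 2 :* (con (+ 1) :* con (+ 1)) := z :^ 2) refl u))

    u^16≈u : (u ^ 4) ^ 4 ≈ u
    u^16≈u = trans (solve 1 (λ z → (z :^ 4) :^ 4 := z :* (z :^ 5 :* z :^ 5 :* z :^ 5)) refl u) (trans (*-congˡ (*-cong (*-cong u^5≈1 u^5≈1) u^5≈1)) (solve 1 (λ z → z :* (con (+ 1) :* con (+ 1) :* con (+ 1)) := z) refl u))

    u^20≈1 : (u ^ 4) ^ 5 ≈ 1#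
    u^20≈1 = trans (solve 1 (λ z → (z :^ 4) :^ 5 := (z :^ 5) :^ 4) refl u) (trans (^-congˡ 4 u^5≈1) (solve 0 (con (+ 1) :^ 4 := con (+ 1)) refl))

  -- In ℤ[ζ] the element 1 - ζ is a prime above 5 and not a unit, so it can be cancelled but not
  -- inverted; absence of 5-torsion is enough for that.
  module Cancellation (five-cancel : ∀ {x} → x + (x + (x + (x + x))) ≈ 0# → x ≈ 0#) where

    -- (1 - u) (4 + 3u + 2u² + u³) = 5
    1-fifthRoot-cancel₀ : ∀ {u} → IsFifthRoot u → ∀ {x} → (1# + - u) * x ≈ 0# → x ≈ 0#
    1-fifthRoot-cancel₀ {u} Φ {x} eq = five-cancel (≈-modulo Φ (≈-modulo eq (solve 2 (λ z x →
      x :+ (x :+ (x :+ (x :+ x))) := con (+ 0) :+ (con (+ 1) :+ z :+ z :^ 2 :+ z :^ 3 :+ z :^ 4) :* x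
        :+ ((con (+ 1) :+ :- z) :* x) :* (con (+ 4) :+ con (+ 3) :* z :+ con (+ 2) :* z :^ 2 :+ z :^ 3)) refl u x)))

    1-fifthRoot-cancel : ∀ {u} → IsFifthRoot u → ∀ {x y} → (1# + - u) * x ≈ (1# + - u) * y → x ≈ y
    1-fifthRoot-cancel {u} Φ {x} {y} eq = x-y≈0⇒x≈y x y (1-fifthRoot-cancel₀ Φ (trans
      (solve 3 (λ u x y → (con (+ 1) :+ :- u) :* (x :+ :- y) := (con (+ 1) :+ :- u) :* x :+ :- ((con (+ 1) :+ :- u) :* y)) refl u x y)
      (trans (+-congʳ eq) (-‿inverseʳ _))))

  module Quintisection (five-cancel : ∀ {x} → x + (x + (x + (x + x))) ≈ 0# → x ≈ 0#)
    {Q L} (nilQ : Q ^ L ≈ 0#) {K} (L≤K : L ℕ.≤ K) {M} (L<M : suc L ℕ.≤ M) where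

    open Cancellation five-cancel

    -- φ i j stands for (Qⁱ;Qʲ)∞.
    φ σ : ℕ → ℕ → Carrier
    φ i j = qpoch (Q ^ i) (Q ^ j) K
    σ i j = ∑ M (thetaTerm (Q ^ i) (Q ^ j))

    nil^ : ∀ j → (Q ^ suc j) ^ L ≈ 0#
    nil^ j = nilpotent-*ʳ {L = L} (Q ^ j) nilQ

    φ-cancel : ∀ i j {f g} → φ (suc i) j * f ≈ φ (suc i) j * g → f ≈ g
    φ-cancel i j = qpoch-cancel {L = L} (Q ^ j) K (nil^ i)

    φ-split : ∀ i j d → φ i (suc j) ≈ ∏ (suc d) (λ r → φ (i ℕ.+ suc j ℕ.* r) (suc j ℕ.* suc d))
    φ-split i j d = begin
      φ i (suc j)
        ≈⟨ Nilpotent.qpoch-stable {Q ^ suc j} {L} (nil^ j) (Q ^ i) L≤K (ℕₚ.≤-trans L≤K (ℕₚ.m≤m*n K (suc d))) ⟩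
      qpoch (Q ^ i) (Q ^ suc j) (K ℕ.* suc d)
        ≈⟨ qpoch-split (Q ^ i) (Q ^ suc j) (suc d) K ⟩
      ∏ (suc d) (λ r → qpoch (Q ^ i * (Q ^ suc j) ^ r) ((Q ^ suc j) ^ suc d) K)
        ≈⟨ ∏-cong (suc d) (λ r → qpoch-cong K
             (trans (*-congˡ (^-assocʳ Q (suc j) r)) (sym (^-homo-* Q i (suc j ℕ.* r)))) (^-assocʳ Q (suc j) (suc d))) ⟩
      ∏ (suc d) (λ r → φ (i ℕ.+ suc j ℕ.* r) (suc j ℕ.* suc d)) ∎

    φ-jacobi : ∀ i i′ j → i ℕ.+ i′ ≡ suc j →
      φ i (suc j) * φ i′ (suc j) * φ (suc j) (suc j) ≈ σ i′ (suc j) + - (Q ^ i * σ (i ℕ.+ suc j) (suc j))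
    φ-jacobi i i′ j e = trans
      (JacobiSums.jacobiSums {Q ^ suc j} {L} (nil^ j) (trans (sym (^-homo-* Q i i′)) (reflexive (≡.cong (Q ^_) e))) L≤K L<M)
      (+-congˡ (-‿cong (*-congˡ (∑-cong M (λ s → thetaTerm-cong s (sym (^-homo-* Q i (suc j))) refl)))))

    -- The reciprocals of the two Rogers-Ramanujan products in Q.
    α β : Carrier
    α = φ 2 5 * φ 3 5
    β = φ 1 5 * φ 4 5

    Q-factor : qpoch Q Q K ≈ φ 5 5 * (α * β)
    Q-factor = trans (qpoch-cong K (sym (*-identityʳ Q)) (sym (*-identityʳ Q))) (trans (φ-split 1 0 4)
      (solve 5 (λ a b c d e → a :* (b :* (c :* (d :* (e :* con (+ 1))))) := e :* ((b :* c) :* (a :* d))) refl _ _ _ _ _))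

    -- Q is fixed while q varies over its fifth roots: the module is used at q and at z q, and both
    -- uses share the same series in Q.
    module At {q} (q^5≈Q : q ^ 5 ≈ Q) (nil : q ^ L ≈ 0#) where

      open Nilpotent {q} {L} nil
      open JacobiSums {q} {L} nil

      q^5* : ∀ k → q ^ (5 ℕ.* k) ≈ Q ^ k
      q^5* k = trans (sym (^-assocʳ q 5 k)) (^-congˡ k q^5≈Q)

      -- Five classes of M terms each, so that the dissection leaves no incomplete block.
      N : ℕ
      N = M ℕ.* 5

      L<N : suc L ℕ.≤ N
      L<N = ℕₚ.≤-trans L<M (ℕₚ.m≤m*n M 5)

      L≤N : L ℕ.≤ N
      L≤N = ℕₚ.≤-trans (ℕₚ.n≤1+n L) L<N

      -- The twist enters class r only through w^r, because the subseries involves w⁵ = 1; thus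
      -- every `σ` is a series in Q alone.
      thetaSum-twisted : ∀ {w} → w ^ 5 ≈ 1# → ∀ i d → ∑ N (thetaTerm (w * q ^ i) (q ^ d)) ≈
        ∑ 5 (λ r → thetaTerm (q ^ i) (q ^ d) r * w ^ r * σ (i ℕ.+ d ℕ.* (2 ℕ.+ r)) (5 ℕ.* d))
      thetaSum-twisted {w} w^5≈1 i d = trans (thetaSum-dissect (w * q ^ i) (q ^ d) M) (∑-cong 5 (λ r →
        *-cong (trans (thetaTerm-cong r (*-comm _ _) refl) (thetaTerm-scale (q ^ i) w (q ^ d) r))
               (∑-cong M (λ s → thetaTerm-cong s (initial r) base))))
        where
        base : (q ^ d) ^ 25 ≈ Q ^ (5 ℕ.* d)
        base = trans (^-assocʳ q d 25) (trans
          (reflexive (≡.cong (q ^_) (NS.solve 1 (λ d → d NS.:* NS.con 25 NS.:= NS.con 5 NS.:* (NS.con 5 NS.:* d)) ≡.refl d)))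
          (q^5* (5 ℕ.* d)))
        initial : ∀ r → (w * q ^ i) ^ 5 * (q ^ d) ^ (10 ℕ.+ 5 ℕ.* r) ≈ Q ^ (i ℕ.+ d ℕ.* (2 ℕ.+ r))
        initial r = begin
          (w * q ^ i) ^ 5 * (q ^ d) ^ (10 ℕ.+ 5 ℕ.* r)
            ≈⟨ *-cong (trans (^-distrib-* w (q ^ i) 5) (trans (*-congʳ w^5≈1) (*-identityˡ _))) (^-assocʳ q d _) ⟩
          (q ^ i) ^ 5 * q ^ (d ℕ.* (10 ℕ.+ 5 ℕ.* r))
            ≈⟨ *-congʳ (^-assocʳ q i 5) ⟩
          q ^ (i ℕ.* 5) * q ^ (d ℕ.* (10 ℕ.+ 5 ℕ.* r))
            ≈⟨ ^-homo-* q (i ℕ.* 5) _ ⟨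
          q ^ (i ℕ.* 5 ℕ.+ d ℕ.* (10 ℕ.+ 5 ℕ.* r))
            ≡⟨ ≡.cong (q ^_) (NS.solve 3 (λ i d r → i NS.:* NS.con 5 NS.:+ d NS.:* (NS.con 10 NS.:+ NS.con 5 NS.:* r) NS.:=
                 NS.con 5 NS.:* (i NS.:+ d NS.:* (NS.con 2 NS.:+ r))) ≡.refl i d r) ⟩
          q ^ (5 ℕ.* (i ℕ.+ d ℕ.* (2 ℕ.+ r)))
            ≈⟨ q^5* (i ℕ.+ d ℕ.* (2 ℕ.+ r)) ⟩
          Q ^ (i ℕ.+ d ℕ.* (2 ℕ.+ r)) ∎

      baileySum-dissect : ∀ {w v} → w * v ≈ 1# → w ^ 5 ≈ 1# → v ^ 5 ≈ 1# →
        baileySum L≤K L≤N (w * q) v ≈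
        ∑ 5 (λ r → thetaTerm (q ^ 2) (q ^ 3) r * v ^ r * σ (8 ℕ.+ 3 ℕ.* r) 15) +
        - (w * q * ∑ 5 (λ r → thetaTerm (q ^ 4) (q ^ 3) r * w ^ r * σ (10 ℕ.+ 3 ℕ.* r) 15))
      baileySum-dissect {w} {v} wv≈1 w^5≈1 v^5≈1 = trans
        (baileySum≈thetaSums L≤K L≤N (trans (solve 3 (λ w q v → w :* q :* v := w :* v :* q) refl w q v) (trans (*-congʳ wv≈1) (*-identityˡ q))))
        (+-cong (thetaSum-twisted v^5≈1 2 3)
          (-‿cong (*-congˡ (trans (∑-cong N (λ s → thetaTerm-cong s (*-assoc w q (q ^ 3)) refl)) (thetaSum-twisted w^5≈1 4 3)))))

      -- Multiplication by 1 - u completes (uq)∞ to (u)∞, and the triple product applies to u and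
      -- vq. Class r receives the coefficient v^r - u^(r+1), which vanishes for r = 2; the classes 0
      -- and 4, and likewise 1 and 3, pair into triple products in Q. The factor u² + u³ comes from
      -- u² - u⁴ = (1 - u)(u² + u³).
      rankFactor : ∀ {u v} → IsFifthRoot u → v ≈ u ^ 4 →
        qpoch (u * q) q K * qpoch (v * q) q K * qpoch q q K ≈
        φ 5 5 * (α + (u ^ 2 + u ^ 3) * (q * β))
      rankFactor {u} {v} Φ v≈u^4 = 1-fifthRoot-cancel Φ (begin
        (1# + - u) * (qpoch (u * q) q K * qpoch (v * q) q K * qpoch q q K)
          ≈⟨ solve 4 (λ e a b c → e :* (a :* b :* c) := e :* a :* b :* c) refl _ _ _ _ ⟩
        (1# + - u) * qpoch (u * q) q K * qpoch (v * q) q K * qpoch q q K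
          ≈⟨ *-congʳ (*-congʳ (qpoch-step u L≤K)) ⟨
        qpoch u q K * qpoch (v * q) q K * qpoch q q K
          ≈⟨ jacobiSums {u} {v * q} (trans (sym (*-assoc u v q)) (trans (*-congʳ (trans (*-congˡ v≈u^4) u^5≈1)) (*-identityˡ q))) L≤K L<N ⟩
        ∑ N (thetaTerm (v * q) q) + - (u * ∑ N (thetaTerm (u * q) q))
          ≈⟨ +-cong (twisted v^5≈1) (-‿cong (*-congˡ (twisted u^5≈1))) ⟩
        ∑ 5 (λ r → G r * v ^ r * σ (3 ℕ.+ r) 5) + - (u * ∑ 5 (λ r → G r * u ^ r * σ (3 ℕ.+ r) 5))
          ≈⟨ solve 12 (λ g₀ g₁ g₂ g₃ g₄ u v s₀ s₁ s₂ s₃ s₄ →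
               g₀ :* v :^ 0 :* s₀ :+ (g₁ :* v :^ 1 :* s₁ :+ (g₂ :* v :^ 2 :* s₂ :+ (g₃ :* v :^ 3 :* s₃ :+ (g₄ :* v :^ 4 :* s₄ :+ con (+ 0)))))
               :+ :- (u :* (g₀ :* u :^ 0 :* s₀ :+ (g₁ :* u :^ 1 :* s₁ :+ (g₂ :* u :^ 2 :* s₂ :+ (g₃ :* u :^ 3 :* s₃ :+ (g₄ :* u :^ 4 :* s₄ :+ con (+ 0)))))))
               := (con (+ 1) :+ :- u) :* g₀ :* s₀ :+ (v :+ :- u :^ 2) :* g₁ :* s₁ :+ (v :^ 2 :+ :- u :^ 3) :* g₂ :* s₂
                 :+ (v :^ 3 :+ :- u :^ 4) :* g₃ :* s₃ :+ (v :^ 4 :+ :- u :^ 5) :* g₄ :* s₄) refl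
               (G 0) (G 1) (G 2) (G 3) (G 4) u v (σ 3 5) (σ 4 5) (σ 5 5) (σ 6 5) (σ 7 5) ⟩
        (1# + - u) * G 0 * σ 3 5 + (v + - (u ^ 2)) * G 1 * σ 4 5 + (v ^ 2 + - (u ^ 3)) * G 2 * σ 5 5
          + (v ^ 3 + - (u ^ 4)) * G 3 * σ 6 5 + (v ^ 4 + - (u ^ 5)) * G 4 * σ 7 5
          ≈⟨ +-cong (+-cong (+-cong (+-cong refl (*-congʳ (*-congʳ (+-congʳ v≈u^4))))
               (*-congʳ (*-congʳ (+-congʳ (trans (^-congˡ 2 v≈u^4) u^8≈u^3)))))
               (*-congʳ (*-congʳ (+-congʳ (trans (^-congˡ 3 v≈u^4) u^12≈u^2)))))
               (*-congʳ (*-congʳ (+-cong (trans (^-congˡ 4 v≈u^4) u^16≈u) (-‿cong u^5≈1)))) ⟩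
        (1# + - u) * G 0 * σ 3 5 + (u ^ 4 + - (u ^ 2)) * G 1 * σ 4 5 + (u ^ 3 + - (u ^ 3)) * G 2 * σ 5 5
          + (u ^ 2 + - (u ^ 4)) * G 3 * σ 6 5 + (u + - 1#) * G 4 * σ 7 5
          ≈⟨ solve 7 (λ q u s₀ s₁ s₂ s₃ s₄ →
               let one = con (+ 1)
                   q₁ = q :* con (+ 1)
                   g₁ = one :* :- (q₁ :* one)
                   g₂ = g₁ :* :- (q₁ :* (q₁ :* one))
                   g₃ = g₂ :* :- (q₁ :* (q₁ :* (q₁ :* one)))
                   g₄ = g₃ :* :- (q₁ :* (q₁ :* (q₁ :* (q₁ :* one)))) in
               (one :+ :- u) :* one :* s₀ :+ (u :^ 4 :+ :- u :^ 2) :* g₁ :* s₁ :+ (u :^ 3 :+ :- u :^ 3) :* g₂ :* s₂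
                 :+ (u :^ 2 :+ :- u :^ 4) :* g₃ :* s₃ :+ (u :+ :- one) :* g₄ :* s₄
               := (one :+ :- u) :* ((s₀ :+ :- (q :^ 10 :* s₄)) :+ (u :^ 2 :+ u :^ 3) :* (q :* (s₁ :+ :- (q :^ 5 :* s₃))))) refl
               q u (σ 3 5) (σ 4 5) (σ 5 5) (σ 6 5) (σ 7 5) ⟩
        (1# + - u) * ((σ 3 5 + - (q ^ 10 * σ 7 5)) + (u ^ 2 + u ^ 3) * (q * (σ 4 5 + - (q ^ 5 * σ 6 5))))
          ≈⟨ *-congˡ (+-cong (trans (+-congˡ (-‿cong (*-congʳ (q^5* 2)))) (sym (φ-jacobi 2 3 4 ≡.refl)))
               (*-congˡ (*-congˡ (trans (+-congˡ (-‿cong (*-congʳ (q^5* 1)))) (sym (φ-jacobi 1 4 4 ≡.refl)))))) ⟩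
        (1# + - u) * (φ 2 5 * φ 3 5 * φ 5 5 + (u ^ 2 + u ^ 3) * (q * (φ 1 5 * φ 4 5 * φ 5 5)))
          ≈⟨ *-congˡ (solve 5 (λ a p w q b → a :* p :+ w :* (q :* (b :* p)) := p :* (a :+ w :* (q :* b))) refl _ _ _ _ _) ⟩
        (1# + - u) * (φ 5 5 * (α + (u ^ 2 + u ^ 3) * (q * β))) ∎)
        where
        open FifthRoot Φ
        G : ℕ → Carrier
        G r = thetaTerm (q ^ 1) (q ^ 1) r
        v^5≈1 : v ^ 5 ≈ 1#
        v^5≈1 = trans (^-congˡ 5 v≈u^4) u^20≈1
        twisted : ∀ {w} → w ^ 5 ≈ 1# → ∑ N (thetaTerm (w * q) q) ≈ ∑ 5 (λ r → G r * w ^ r * σ (3 ℕ.+ r) 5)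
        twisted {w} w^5≈1 = trans (∑-cong N (λ s → thetaTerm-cong s (*-congˡ (sym (*-identityʳ q))) (sym (*-identityʳ q))))
          (trans (thetaSum-twisted w^5≈1 1 1) (∑-cong 5 (λ r → *-congˡ {G r * w ^ r} (reflexive (≡.cong (λ i → σ i 5) (index r))))))
          where
          index : ∀ r → 1 ℕ.+ 1 ℕ.* (2 ℕ.+ r) ≡ 3 ℕ.+ r
          index r = ≡.cong suc (ℕₚ.*-identityˡ (2 ℕ.+ r))

      -- E r and F r are the signed pentagonal powers of q, of exponents r(3r+1)/2 and (r+1)(3r+2)/2 - 1.
      E F : ℕ → Carrier
      E r = thetaTerm (q ^ 2) (q ^ 3) r
      F r = thetaTerm (q ^ 4) (q ^ 3) r

      E₁ : E 1 ≈ - (q ^ 2)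
      E₁ = solve 1 (λ q → con (+ 1) :* :- (q :^ 2 :* con (+ 1)) := :- (q :^ 2)) refl q
      E₂ : E 2 ≈ q ^ 7
      E₂ = solve 1 (λ q → con (+ 1) :* :- (q :^ 2 :* con (+ 1)) :* :- (q :^ 2 :* ((q :^ 3) :^ 1)) := q :^ 7) refl q
      E₃ : E 3 ≈ - (q ^ 15)
      E₃ = trans (*-congʳ E₂) (solve 1 (λ q → q :^ 7 :* :- (q :^ 2 :* ((q :^ 3) :^ 2)) := :- (q :^ 15)) refl q)
      E₄ : E 4 ≈ q ^ 26
      E₄ = trans (*-congʳ E₃) (solve 1 (λ q → :- (q :^ 15) :* :- (q :^ 2 :* ((q :^ 3) :^ 3)) := q :^ 26) refl q)
      F₁ : F 1 ≈ - (q ^ 4)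
      F₁ = solve 1 (λ q → con (+ 1) :* :- (q :^ 4 :* con (+ 1)) := :- (q :^ 4)) refl q
      F₂ : F 2 ≈ q ^ 11
      F₂ = solve 1 (λ q → con (+ 1) :* :- (q :^ 4 :* con (+ 1)) :* :- (q :^ 4 :* ((q :^ 3) :^ 1)) := q :^ 11) refl q
      F₃ : F 3 ≈ - (q ^ 21)
      F₃ = trans (*-congʳ F₂) (solve 1 (λ q → q :^ 11 :* :- (q :^ 4 :* ((q :^ 3) :^ 2)) := :- (q :^ 21)) refl q)
      F₄ : F 4 ≈ q ^ 34
      F₄ = trans (*-congʳ F₃) (solve 1 (λ q → :- (q :^ 21) :* :- (q :^ 4 :* ((q :^ 3) :^ 3)) := q :^ 34) refl q)
      N≡suc : suc (ℕ.pred N) ≡ N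
      N≡suc = positive L<N
        where
        positive : ∀ {m n} → suc m ℕ.≤ n → suc (ℕ.pred n) ≡ n
        positive (s≤s _) = ≡.refl

      -- Regarding (q)∞ as Ω at the trivial twist w = v = 1 makes the pentagonal number series a
      -- case of `baileySum-dissect`.
      eulerBailey : qpoch q q K ≈ baileySum L≤K L≤N (1# * q) 1#
      eulerBailey = trans (sym (BaileyPair.qpoch≈baileySum {q} {L} nil (*-identityʳ 1#) L≤K L≤N N≡suc))
        (∑-cong N (λ n → *-congˡ (*-congʳ (qpoch-cong (suc n) (sym (*-identityˡ q)) refl))))

      E-sum F-sum : Carrier → Carrier
      E-sum w = ∑ 5 (λ r → E r * w ^ r * σ (8 ℕ.+ 3 ℕ.* r) 15)
      F-sum w = ∑ 5 (λ r → F r * w ^ r * σ (10 ℕ.+ 3 ℕ.* r) 15)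

      -- Series in Q that collect the pentagonal numbers of the classes 0 and 2 modulo 5.
      H J : Carrier
      H = σ 8 15 + Q ^ 1 * σ 13 15 + - (Q ^ 3 * σ 17 15) + - (Q ^ 7 * σ 22 15)
      J = (σ 11 15 + - (Q ^ 4 * σ 19 15)) + - (Q ^ 1 * (σ 14 15 + - (Q ^ 1 * σ 16 15)))

      -- Generalised pentagonal numbers are 0, 1 or 2 modulo 5. Class 1 is a triple product of
      -- modulus 15, and its three factors are (Q⁵;Q⁵)∞ split by residues modulo 3.
      euler-dissect : qpoch q q K ≈ H + - (q * φ 5 5) + - (q ^ 2 * J)
      euler-dissect = begin
        qpoch q q K
          ≈⟨ eulerBailey ⟩
        baileySum L≤K L≤N (1# * q) 1#
          ≈⟨ baileySum-dissect (*-identityʳ 1#) 1^5 1^5 ⟩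
        E-sum 1# + - (1# * q * F-sum 1#)
          ≈⟨ +-cong (+-cong refl (+-cong (e E₁) (+-cong (e E₂) (+-cong (e E₃) (+-cong (e E₄) refl)))))
               (-‿cong (*-congˡ (+-cong refl (+-cong (e F₁) (+-cong (e F₂) (+-cong (e F₃) (+-cong (e F₄) refl))))))) ⟩
        _ ≈⟨ solve 11 (λ q s₈ s₁₁ s₁₄ s₁₇ s₂₀ s₁₀ s₁₃ s₁₆ s₁₉ s₂₂ →
               let one = con (+ 1) in
               one :* one :* s₈ :+ (:- (q :^ 2) :* one :^ 1 :* s₁₁ :+ (q :^ 7 :* one :^ 2 :* s₁₄ :+ (:- (q :^ 15) :* one :^ 3 :* s₁₇ :+ (q :^ 26 :* one :^ 4 :* s₂₀ :+ con (+ 0)))))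
               :+ :- (one :* q :* (one :* one :* s₁₀ :+ (:- (q :^ 4) :* one :^ 1 :* s₁₃ :+ (q :^ 11 :* one :^ 2 :* s₁₆ :+ (:- (q :^ 21) :* one :^ 3 :* s₁₉ :+ (q :^ 34 :* one :^ 4 :* s₂₂ :+ con (+ 0)))))))
               := s₈ :+ q :^ 5 :* s₁₃ :+ :- (q :^ 15 :* s₁₇) :+ :- (q :^ 35 :* s₂₂) :+ :- (q :* (s₁₀ :+ :- (q :^ 25 :* s₂₀)))
                 :+ :- (q :^ 2 :* ((s₁₁ :+ :- (q :^ 20 :* s₁₉)) :+ :- (q :^ 5 :* (s₁₄ :+ :- (q :^ 5 :* s₁₆)))))) refl
               q (σ 8 15) (σ 11 15) (σ 14 15) (σ 17 15) (σ 20 15) (σ 10 15) (σ 13 15) (σ 16 15) (σ 19 15) (σ 22 15) ⟩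
        σ 8 15 + q ^ 5 * σ 13 15 + - (q ^ 15 * σ 17 15) + - (q ^ 35 * σ 22 15) + - (q * (σ 10 15 + - (q ^ 25 * σ 20 15)))
          + - (q ^ 2 * ((σ 11 15 + - (q ^ 20 * σ 19 15)) + - (q ^ 5 * (σ 14 15 + - (q ^ 5 * σ 16 15)))))
          ≈⟨ +-cong (+-cong (+-cong (+-cong (+-cong refl (*-congʳ (q^5* 1))) (-‿cong (*-congʳ (q^5* 3)))) (-‿cong (*-congʳ (q^5* 7))))
               (-‿cong (*-congˡ (trans (+-congˡ (-‿cong (*-congʳ (q^5* 5)))) (trans (sym (φ-jacobi 5 10 14 ≡.refl)) triple)))))
               (-‿cong (*-congˡ (+-cong (+-congˡ (-‿cong (*-congʳ (q^5* 4)))) (-‿cong (*-cong (q^5* 1) (+-congˡ (-‿cong (*-congʳ (q^5* 1))))))))) ⟩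
        H + - (q * φ 5 5) + - (q ^ 2 * J) ∎
        where
        1^5 : 1# ^ 5 ≈ 1#
        1^5 = solve 0 (con (+ 1) :^ 5 := con (+ 1)) refl
        e : ∀ {x y w s} → x ≈ y → x * w * s ≈ y * w * s
        e x≈y = *-congʳ (*-congʳ x≈y)
        triple : φ 5 15 * φ 10 15 * φ 15 15 ≈ φ 5 5
        triple = trans (solve 3 (λ x y z → x :* y :* z := x :* (y :* (z :* con (+ 1)))) refl _ _ _) (sym (φ-split 5 4 2))

      module _ {z} (Φ : IsFifthRoot z) where

        open FifthRoot Φ

        -- Factor by factor: the product of 1 - zᵏ t over k modulo 5 is 1 - t⁵.
        qpoch-fifth : ∀ n → qpoch (z * q) q n * qpoch (z ^ 4 * q) q n * (qpoch (z ^ 2 * q) q n * qpoch (z ^ 3 * q) q n * qpoch q q n) ≈ qpoch Q Q n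
        qpoch-fifth zero    = solve 0 (con (+ 1) :* con (+ 1) :* (con (+ 1) :* con (+ 1) :* con (+ 1)) := con (+ 1)) refl
        qpoch-fifth (suc n) = begin
          qpoch (z * q) q (suc n) * qpoch (z ^ 4 * q) q (suc n) * (qpoch (z ^ 2 * q) q (suc n) * qpoch (z ^ 3 * q) q (suc n) * qpoch q q (suc n))
            ≈⟨ solve 10 (λ a b c d e a′ b′ c′ d′ e′ → a :* a′ :* (b :* b′) :* (c :* c′ :* (d :* d′) :* (e :* e′)) :=
                 a :* b :* (c :* d :* e) :* (a′ :* b′ :* (c′ :* d′ :* e′))) refl _ _ _ _ _ _ _ _ _ _ ⟩
          qpoch (z * q) q n * qpoch (z ^ 4 * q) q n * (qpoch (z ^ 2 * q) q n * qpoch (z ^ 3 * q) q n * qpoch q q n) *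
            ((1# + - (z * q * q ^ n)) * (1# + - (z ^ 4 * q * q ^ n)) * ((1# + - (z ^ 2 * q * q ^ n)) * (1# + - (z ^ 3 * q * q ^ n)) * (1# + - (q * q ^ n))))
            ≈⟨ *-cong (qpoch-fifth n) (≈-modulo Φ (solve 3 (λ z q p → let t = q :* p in
                 (con (+ 1) :+ :- (z :* q :* p)) :* (con (+ 1) :+ :- (z :^ 4 :* q :* p)) :* ((con (+ 1) :+ :- (z :^ 2 :* q :* p)) :* (con (+ 1) :+ :- (z :^ 3 :* q :* p)) :* (con (+ 1) :+ :- (q :* p)))
                 := (con (+ 1) :+ :- (q :^ 5 :* p :^ 5)) :+ (con (+ 1) :+ z :+ z :^ 2 :+ z :^ 3 :+ z :^ 4) :*
                   (:- t :+ t :^ 5 :+ z :* t :^ 2 :- z :* t :^ 5 :+ z :^ 3 :* t :^ 2 :- z :^ 3 :* t :^ 3 :- z :^ 5 :* t :^ 3 :+ z :^ 5 :* t :^ 5 :+ z :^ 6 :* t :^ 4 :- z :^ 6 :* t :^ 5))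
                 refl z q (q ^ n))) ⟩
          qpoch Q Q n * (1# + - (q ^ 5 * (q ^ n) ^ 5))
            ≈⟨ *-congˡ (+-congˡ (-‿cong (*-cong q^5≈Q (trans (^-assocʳ q n 5) (trans (reflexive (≡.cong (q ^_) (ℕₚ.*-comm n 5))) (q^5* n)))))) ⟩
          qpoch Q Q (suc n) ∎

        -- The case u = z². These three products are what (zq)∞ (z⁴q)∞ lacks in `qpoch-fifth`.
        rankFactor₂ : qpoch (z ^ 2 * q) q K * qpoch (z ^ 3 * q) q K * qpoch q q K ≈ φ 5 5 * (α + (z + z ^ 4) * (q * β))
        rankFactor₂ = trans (rankFactor fifthRoot-² z^3≈) (*-congˡ (+-congˡ (*-congʳ
          (≈-modulo Φ (solve 1 (λ z → (z :^ 2) :^ 2 :+ (z :^ 2) :^ 3 := z :+ z :^ 4 :+ (con (+ 1) :+ z :+ z :^ 2 :+ z :^ 3 :+ z :^ 4) :* (:- z :+ z :^ 2)) refl z)))))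
          where
          z^3≈ : z ^ 3 ≈ (z ^ 2) ^ 4
          z^3≈ = ≈-modulo Φ (solve 1 (λ z → z :^ 3 := (z :^ 2) :^ 4 :+ (con (+ 1) :+ z :+ z :^ 2 :+ z :^ 3 :+ z :^ 4) :* (z :^ 3 :- z :^ 4)) refl z)

        -- z + z⁴ and z² + z³ have sum -1 and product -1, so z disappears from the product of the
        -- two factors given by z and z².
        euler-αβ : qpoch q q K * (α * β) ≈ φ 5 5 * (α * α + - (q * (α * β)) + - (q ^ 2 * (β * β)))
        euler-αβ = φ-cancel 4 5 (begin
          φ 5 5 * (qpoch q q K * (α * β))
            ≈⟨ solve 4 (λ p e a b → p :* (e :* (a :* b)) := p :* (a :* b) :* e) refl _ _ _ _ ⟩
          φ 5 5 * (α * β) * qpoch q q K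
            ≈⟨ *-congʳ (trans (sym Q-factor) (sym (qpoch-fifth K))) ⟩
          qpoch (z * q) q K * qpoch (z ^ 4 * q) q K * (qpoch (z ^ 2 * q) q K * qpoch (z ^ 3 * q) q K * qpoch q q K) * qpoch q q K
            ≈⟨ solve 4 (λ a b c d → a :* b :* c :* d := (a :* b :* d) :* c) refl _ _ _ _ ⟩
          (qpoch (z * q) q K * qpoch (z ^ 4 * q) q K * qpoch q q K) * (qpoch (z ^ 2 * q) q K * qpoch (z ^ 3 * q) q K * qpoch q q K)
            ≈⟨ *-cong (rankFactor Φ refl) rankFactor₂ ⟩
          φ 5 5 * (α + (z ^ 2 + z ^ 3) * (q * β)) * (φ 5 5 * (α + (z + z ^ 4) * (q * β)))
            ≈⟨ ≈-modulo Φ (solve 5 (λ z q p a b →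
                 p :* (a :+ (z :^ 2 :+ z :^ 3) :* (q :* b)) :* (p :* (a :+ (z :+ z :^ 4) :* (q :* b)))
                 := p :* (p :* (a :* a :+ :- (q :* (a :* b)) :+ :- (q :^ 2 :* (b :* b))))
                   :+ (con (+ 1) :+ z :+ z :^ 2 :+ z :^ 3 :+ z :^ 4) :* (p :* p :* (q :* (a :* b) :+ (con (+ 1) :- z :+ z :^ 3) :* (q :^ 2 :* (b :* b)))))
                 refl z q (φ 5 5) α β) ⟩
          φ 5 5 * (φ 5 5 * (α * α + - (q * (α * β)) + - (q ^ 2 * (β * β)))) ∎)

        -- The left side and the bracket on the right are series in Q and do not change when q
        -- becomes z q, whereas q² does. The terms of class 1 agree in both dissections and drop
        -- out.
        class2 : H * (α * β) + - (φ 5 5 * (α * α)) ≈ q ^ 2 * (J * (α * β) + - (φ 5 5 * (β * β)))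
        class2 = begin
          H * (α * β) + - (p * (α * α))
            ≈⟨ solve 6 (λ h q p j a b → h :* (a :* b) :+ :- (p :* (a :* a)) :=
                 (h :+ :- (q :* p) :+ :- (q :^ 2 :* j)) :* (a :* b) :+ q :* p :* (a :* b) :+ q :^ 2 :* j :* (a :* b) :+ :- (p :* (a :* a))) refl H q p J α β ⟩
          (H + - (q * p) + - (q ^ 2 * J)) * (α * β) + q * p * (α * β) + q ^ 2 * J * (α * β) + - (p * (α * α))
            ≈⟨ +-congʳ (+-congʳ (+-congʳ (trans (*-congʳ (sym euler-dissect)) euler-αβ))) ⟩
          p * (α * α + - (q * (α * β)) + - (q ^ 2 * (β * β))) + q * p * (α * β) + q ^ 2 * J * (α * β) + - (p * (α * α))
            ≈⟨ solve 5 (λ q p j a b → p :* (a :* a :+ :- (q :* (a :* b)) :+ :- (q :^ 2 :* (b :* b))) :+ q :* p :* (a :* b) :+ q :^ 2 :* j :* (a :* b) :+ :- (p :* (a :* a))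
                 := q :^ 2 :* (j :* (a :* b) :+ :- (p :* (b :* b)))) refl q p J α β ⟩
          q ^ 2 * (J * (α * β) + - (p * (β * β))) ∎
          where p = φ 5 5

-- The theorem in a ring with nilpotent q.

module ProductIdentity {ℓ₁ ℓ₂} (R : CommutativeRing ℓ₁ ℓ₂) where

  open CommutativeRing R hiding (zero)
  open Algebra.Properties.AbelianGroup +-abelianGroup using () renaming (x∙y⁻¹≈ε⇒x≈y to x-y≈0⇒x≈y)
  open SetoidReasoning setoid
  open RingSolver R
  open FiniteIdentities R
  open InfiniteProducts R
  open Dissections R
  open FifthRoots R

  module Main (five-cancel : ∀ {x} → x + (x + (x + (x + x))) ≈ 0# → x ≈ 0#)
    {z} (Φ : IsFifthRoot z) {q L} (nil : q ^ L ≈ 0#)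
    {K} (L≤K : L ℕ.≤ K) {M} (L<M : suc L ℕ.≤ M) where

    Q : Carrier
    Q = q ^ 5

    nilQ : Q ^ L ≈ 0#
    nilQ = nilpotent-*ʳ {L = L} (q ^ 4) nil

    open Cancellation five-cancel
    open FifthRoot Φ
    open Quintisection five-cancel {Q} {L} nilQ {K} L≤K {M} L<M
    open At {q} refl nil
    open Nilpotent {q} {L} nil
    private module Twisted = At {z * q} (trans (^-distrib-* z q 5) (trans (*-congʳ u^5≈1) (*-identityˡ _)))
                                (trans (^-congˡ L (*-comm z q)) (nilpotent-*ʳ {L = L} z nil))

    c : Carrier
    c = z + z ^ 4

    -- t k stands for [Qᵏ;Q¹⁵]∞.
    t : ℕ → Carrier
    t k = φ k 15 * φ (15 ℕ.∸ k) 15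

    e : Carrier
    e = φ 15 15

    -- Comparing the dissections at q and at z q, whose fifth powers agree, isolates the class of q².
    quintuple : q ^ 2 * (J * α) ≈ q ^ 2 * (φ 5 5 * β)
    quintuple = φ-cancel 3 5 (φ-cancel 0 5 (x-y≈0⇒x≈y _ _ (trans
      (solve 6 (λ q j a b₁ b₄ p → b₁ :* (b₄ :* (q :^ 2 :* (j :* a))) :+ :- (b₁ :* (b₄ :* (q :^ 2 :* (p :* (b₁ :* b₄)))))
        := q :^ 2 :* (j :* (a :* (b₁ :* b₄)) :+ :- (p :* ((b₁ :* b₄) :* (b₁ :* b₄))))) refl q J α (φ 1 5) (φ 4 5) (φ 5 5))
      (1-fifthRoot-cancel₀ fifthRoot-² (trans
        (solve 3 (λ z q x → (con (+ 1) :+ :- (z :^ 2)) :* (q :^ 2 :* x) := q :^ 2 :* x :+ :- ((z :* q) :^ 2 :* x)) refl z q X)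
        (trans (+-cong (sym (class2 Φ)) (-‿cong (sym (Twisted.class2 Φ)))) (-‿inverseʳ _)))))))
      where
      X = J * (α * β) + - (φ 5 5 * (β * β))

    -- Modulo the relation for z, -W is (1 - z²)(1 - z⁴), a product of two cancellable factors.
    W : Carrier
    W = z ^ 4 + z ^ 2 + - (1# + z)

    -- In Σ a(r) sᵣ (z⁻ʳ + zʳ⁺¹ - 1 - z) the terms r = 0 and r = 4 vanish, and the others are multiples of W.
    combine : ∀ (a s : ℕ → Carrier) → let S = λ w → ∑ 5 (λ r → a r * w ^ r * s r) in
      S (z ^ 4) + z * S z + - ((1# + z) * S 1#) ≈ W * (a 1 * s 1 + (1# + c) * (a 2 * s 2) + a 3 * s 3)
    combine a s = begin
      _ ≈⟨ solve 12 (λ z y a₀ a₁ a₂ a₃ a₄ s₀ s₁ s₂ s₃ s₄ →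
           let one = con (+ 1)
               S = λ w → a₀ :* w :^ 0 :* s₀ :+ (a₁ :* w :^ 1 :* s₁ :+ (a₂ :* w :^ 2 :* s₂ :+ (a₃ :* w :^ 3 :* s₃ :+ (a₄ :* w :^ 4 :* s₄ :+ con (+ 0))))) in
           S y :+ z :* S z :+ :- ((one :+ z) :* S one)
           := (y :+ z :^ 2 :+ :- (one :+ z)) :* (a₁ :* s₁) :+ (y :^ 2 :+ z :^ 3 :+ :- (one :+ z)) :* (a₂ :* s₂)
             :+ (y :^ 3 :+ z :^ 4 :+ :- (one :+ z)) :* (a₃ :* s₃) :+ (y :^ 4 :+ z :^ 5 :+ :- (one :+ z)) :* (a₄ :* s₄))
           refl z (z ^ 4) (a 0) (a 1) (a 2) (a 3) (a 4) (s 0) (s 1) (s 2) (s 3) (s 4) ⟩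
      W * (a 1 * s 1) + ((z ^ 4) ^ 2 + z ^ 3 + - (1# + z)) * (a 2 * s 2) + ((z ^ 4) ^ 3 + z ^ 4 + - (1# + z)) * (a 3 * s 3)
        + ((z ^ 4) ^ 4 + z ^ 5 + - (1# + z)) * (a 4 * s 4)
        ≈⟨ +-cong (+-cong (+-congˡ (*-congʳ (trans (+-congʳ (+-congʳ u^8≈u^3)) W₂))) (*-congʳ (+-congʳ (+-congʳ u^12≈u^2))))
             (*-congʳ (+-congʳ (+-cong u^16≈u u^5≈1))) ⟩
      W * (a 1 * s 1) + (1# + c) * W * (a 2 * s 2) + (z ^ 2 + z ^ 4 + - (1# + z)) * (a 3 * s 3) + (z + 1# + - (1# + z)) * (a 4 * s 4)
        ≈⟨ solve 5 (λ z x₁ x₂ x₃ x₄ →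
             let one = con (+ 1)
                 W = z :^ 4 :+ z :^ 2 :+ :- (one :+ z) in
             W :* x₁ :+ (one :+ (z :+ z :^ 4)) :* W :* x₂ :+ (z :^ 2 :+ z :^ 4 :+ :- (one :+ z)) :* x₃ :+ (z :+ one :+ :- (one :+ z)) :* x₄
             := W :* (x₁ :+ (one :+ (z :+ z :^ 4)) :* x₂ :+ x₃)) refl z _ _ _ _ ⟩
      W * (a 1 * s 1 + (1# + c) * (a 2 * s 2) + a 3 * s 3) ∎
      where
      W₂ : z ^ 3 + z ^ 3 + - (1# + z) ≈ (1# + c) * W
      W₂ = ≈-modulo Φ (solve 1 (λ z → z :^ 3 :+ z :^ 3 :+ :- (con (+ 1) :+ z) :=
        (con (+ 1) :+ (z :+ z :^ 4)) :* (z :^ 4 :+ z :^ 2 :+ :- (con (+ 1) :+ z))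
          :+ (con (+ 1) :+ z :+ z :^ 2 :+ z :^ 3 :+ z :^ 4) :* (z :- z :^ 2 :+ z :^ 3 :- z :^ 4)) refl z)

    -- The value of (zq)∞ (z⁴q)∞ PP₃; each `t k * e` is a triple product of modulus 15 in Q.
    T : Carrier
    T = q ^ 2 * (t 4 * e) + - (q ^ 5 * (t 2 * e)) + - ((1# + c) * (q ^ 7 * (t 1 * e)))

    -- As z z⁴ = 1, the E-parts and the F-parts both have the shape of `combine`. The surviving
    -- classes then pair across the two parts: E 1 with F 3, E 2 with F 2, E 3 with F 1.
    baileySums≈T : baileySum L≤K L≤N (z * q) (z ^ 4) + z * baileySum L≤K L≤N (z ^ 4 * q) z + - ((1# + z) * baileySum L≤K L≤N q 1#) ≈ W * - T
    baileySums≈T = begin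
      _ ≈⟨ +-cong (+-cong (baileySum-dissect u^5≈1 u^5≈1 u^20≈1) (*-congˡ (baileySum-dissect (trans (*-comm _ _) u^5≈1) u^20≈1 u^5≈1)))
             (-‿cong (*-congˡ (trans (trans (BaileyPair.qpoch≈baileySum {q} {L} nil u^5≈1 L≤K L≤N N≡suc) eulerBailey) (baileySum-dissect (*-identityʳ 1#) 1^5 1^5)))) ⟩
      E-sum (z ^ 4) + - (z * q * F-sum z) + z * (E-sum z + - (z ^ 4 * q * F-sum (z ^ 4))) + - ((1# + z) * (E-sum 1# + - (1# * q * F-sum 1#)))
        ≈⟨ solve 9 (λ z y q e₄ e₁ e₀ f₄ f₁ f₀ → let one = con (+ 1) in
             e₄ :+ :- (z :* q :* f₁) :+ z :* (e₁ :+ :- (y :* q :* f₄)) :+ :- ((one :+ z) :* (e₀ :+ :- (one :* q :* f₀)))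
             := (e₄ :+ z :* e₁ :+ :- ((one :+ z) :* e₀)) :+ :- (q :* ((z :* y) :* f₄ :+ z :* f₁ :+ :- ((one :+ z) :* f₀)))) refl
             z (z ^ 4) q (E-sum (z ^ 4)) (E-sum z) (E-sum 1#) (F-sum (z ^ 4)) (F-sum z) (F-sum 1#) ⟩
      (E-sum (z ^ 4) + z * E-sum z + - ((1# + z) * E-sum 1#)) + - (q * (z * z ^ 4 * F-sum (z ^ 4) + z * F-sum z + - ((1# + z) * F-sum 1#)))
        ≈⟨ +-cong (combine E (λ r → σ (8 ℕ.+ 3 ℕ.* r) 15))
             (-‿cong (*-congˡ (trans (+-congʳ (+-congʳ (trans (*-congʳ u^5≈1) (*-identityˡ _)))) (combine F (λ r → σ (10 ℕ.+ 3 ℕ.* r) 15))))) ⟩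
      W * (E 1 * σ 11 15 + (1# + c) * (E 2 * σ 14 15) + E 3 * σ 17 15) + - (q * (W * (F 1 * σ 13 15 + (1# + c) * (F 2 * σ 16 15) + F 3 * σ 19 15)))
        ≈⟨ +-cong (*-congˡ (+-cong (+-cong (*-congʳ E₁) (*-congˡ (*-congʳ E₂))) (*-congʳ E₃)))
             (-‿cong (*-congˡ (*-congˡ (+-cong (+-cong (*-congʳ F₁) (*-congˡ (*-congʳ F₂))) (*-congʳ F₃))))) ⟩
      _ ≈⟨ solve 9 (λ q w c s₁₁ s₁₄ s₁₇ s₁₃ s₁₆ s₁₉ →
             w :* (:- (q :^ 2) :* s₁₁ :+ c :* (q :^ 7 :* s₁₄) :+ :- (q :^ 15) :* s₁₇) :+ :- (q :* (w :* (:- (q :^ 4) :* s₁₃ :+ c :* (q :^ 11 :* s₁₆) :+ :- (q :^ 21) :* s₁₉)))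
             := w :* :- (q :^ 2 :* (s₁₁ :+ :- (q :^ 20 :* s₁₉)) :+ :- (q :^ 5 :* (s₁₃ :+ :- (q :^ 10 :* s₁₇))) :+ :- (c :* (q :^ 7 :* (s₁₄ :+ :- (q :^ 5 :* s₁₆)))))) refl
             q W (1# + c) (σ 11 15) (σ 14 15) (σ 17 15) (σ 13 15) (σ 16 15) (σ 19 15) ⟩
      W * - (q ^ 2 * (σ 11 15 + - (q ^ 20 * σ 19 15)) + - (q ^ 5 * (σ 13 15 + - (q ^ 10 * σ 17 15))) + - ((1# + c) * (q ^ 7 * (σ 14 15 + - (q ^ 5 * σ 16 15)))))
        ≈⟨ *-congˡ (-‿cong (+-cong (+-cong (*-congˡ (product 4 11 ≡.refl)) (-‿cong (*-congˡ (product 2 13 ≡.refl)))) (-‿cong (*-congˡ (*-congˡ (product 1 14 ≡.refl)))))) ⟩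
      W * - T ∎
      where
      1^5 : 1# ^ 5 ≈ 1#
      1^5 = solve 0 (con (+ 1) :^ 5 := con (+ 1)) refl
      product : ∀ i i′ → i ℕ.+ i′ ≡ 15 → σ i′ 15 + - (q ^ (5 ℕ.* i) * σ (i ℕ.+ 15) 15) ≈ φ i 15 * φ i′ 15 * φ 15 15
      product i i′ eq = trans (+-congˡ (-‿cong (*-congʳ (q^5* i)))) (sym (φ-jacobi i i′ 14 eq))

    module _ (I : ℕ → Carrier)
      (I-inverse : ∀ n → I (suc n) * (qpoch (z * q ^ suc n) q K * qpoch (z ^ 4 * q ^ suc n) q K) ≈ 1#)
      where

      private
        PP : Carrier
        PP = BaileyPair.spt {q} {L} nil u^5≈1 L≤K I I-inverse (ℕ.pred N)

      -- The factor (1 + z)(1 - z)(1 - z⁴) in front of the products equals (1 - z²)(1 - z⁴), which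
      -- is also -W. Both z² and z⁴ are primitive fifth roots, so it cancels.
      spt≈T : qpoch (z * q) q K * qpoch (z ^ 4 * q) q K * PP ≈ T
      spt≈T = 1-fifthRoot-cancel fifthRoot-² (1-fifthRoot-cancel root₄ (begin
        (1# + - (z ^ 2) ^ 2) * ((1# + - (z ^ 2)) * (A * B * PP))
          ≈⟨ solve 4 (λ z a b p → let one = con (+ 1) in
               (one :+ :- ((z :^ 2) :^ 2)) :* ((one :+ :- (z :^ 2)) :* (a :* b :* p)) :=
               (one :+ z) :* ((one :+ :- z) :* a :* ((one :+ :- (z :^ 4)) :* b)) :* p) refl z A B PP ⟩
        (1# + z) * ((1# + - z) * A * ((1# + - (z ^ 4)) * B)) * PP
          ≈⟨ BaileyPair.spt≈baileySums {q} {L} nil u^5≈1 L≤K I I-inverse L≤N N≡suc ⟩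
        _ ≈⟨ baileySums≈T ⟩
        W * - T
          ≈⟨ ≈-modulo Φ (solve 2 (λ z t → let one = con (+ 1) in
               (z :^ 4 :+ z :^ 2 :+ :- (one :+ z)) :* :- t := (one :+ :- ((z :^ 2) :^ 2)) :* ((one :+ :- (z :^ 2)) :* t)
                 :+ (one :+ z :+ z :^ 2 :+ z :^ 3 :+ z :^ 4) :* ((z :- z :^ 2) :* t)) refl z T) ⟩
        (1# + - (z ^ 2) ^ 2) * ((1# + - (z ^ 2)) * T) ∎))
        where
        A = qpoch (z * q) q K
        B = qpoch (z ^ 4 * q) q K
        root₄ : IsFifthRoot ((z ^ 2) ^ 2)
        root₄ = FifthRoot.fifthRoot-² fifthRoot-²

      module _ {I₁ I₂ I₃ I₄ I₅ : Carrier}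
        (inv₁ : t 1 * t 4 * t 5 * t 6 * I₁ ≈ 1#)
        (inv₂ : t 3 * t 5 * t 7 * I₂ ≈ 1#)
        (inv₃ : α * I₃ ≈ 1#)
        (inv₄ : t 1 * t 5 * t 6 * I₄ ≈ 1#)
        (inv₅ : t 2 * t 3 * t 5 * t 7 * I₅ ≈ 1#)
        where

        products : Carrier
        products = - (q ^ 5 * (t 2 * I₁)) + - (c * (q ^ 6 * I₂)) + (1# + c) * (q ^ 2 * I₃) + - (c * (q ^ 2 * I₄))
          + - (q ^ 8 * (t 1 * I₅)) + c * (q ^ 3 * (t 4 * I₅))

        private
          E∞ : Carrier
          E∞ = qpoch Q Q K

          E∞-factor : E∞ ≈ e * (t 1 * t 2 * t 3 * t 4 * t 5 * t 6 * t 7)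
          E∞-factor = trans (qpoch-cong K (sym (*-identityʳ Q)) (sym (*-identityʳ Q))) (trans (φ-split 1 0 14)
            (solve 15 (λ u₁ u₂ u₃ u₄ u₅ u₆ u₇ u₈ u₉ u₁₀ u₁₁ u₁₂ u₁₃ u₁₄ u₁₅ →
              u₁ :* (u₂ :* (u₃ :* (u₄ :* (u₅ :* (u₆ :* (u₇ :* (u₈ :* (u₉ :* (u₁₀ :* (u₁₁ :* (u₁₂ :* (u₁₃ :* (u₁₄ :* (u₁₅ :* con (+ 1)))))))))))))))
              := u₁₅ :* (u₁ :* u₁₄ :* (u₂ :* u₁₃) :* (u₃ :* u₁₂) :* (u₄ :* u₁₁) :* (u₅ :* u₁₀) :* (u₆ :* u₉) :* (u₇ :* u₈)))
              refl _ _ _ _ _ _ _ _ _ _ _ _ _ _ _))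

          α-factor : α ≈ t 2 * t 3 * t 7
          α-factor = trans (*-cong (φ-split 2 4 2) (φ-split 3 4 2))
            (solve 6 (λ u₂ u₇ u₁₂ u₃ u₈ u₁₃ → u₂ :* (u₇ :* (u₁₂ :* con (+ 1))) :* (u₃ :* (u₈ :* (u₁₃ :* con (+ 1))))
              := u₂ :* u₁₃ :* (u₃ :* u₁₂) :* (u₇ :* u₈)) refl _ _ _ _ _ _)

          β-factor : β ≈ t 1 * t 4 * t 6
          β-factor = trans (*-cong (φ-split 1 4 2) (φ-split 4 4 2))
            (solve 6 (λ u₁ u₆ u₁₁ u₄ u₉ u₁₄ → u₁ :* (u₆ :* (u₁₁ :* con (+ 1))) :* (u₄ :* (u₉ :* (u₁₄ :* con (+ 1))))
              := u₁ :* u₁₄ :* (u₄ :* u₁₁) :* (u₆ :* u₉)) refl _ _ _ _ _ _)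

          clear : ∀ {x y d i} → d * i ≈ 1# → x ≈ y * d → x * i ≈ y
          clear di≈1 x≈yd = trans (*-congʳ x≈yd) (trans (*-assoc _ _ _) (trans (*-congˡ di≈1) (*-identityʳ _)))

          -- Multiplying by E∞ = e t₁ ⋯ t₇ clears the denominator, and the remaining factors regroup
          -- into `α` or `β`: the form in which they occur when `T` is multiplied by the second
          -- factor. The other quotients are alike.
          quotient₁ : E∞ * (t 2 * I₁) ≈ t 2 * e * α
          quotient₁ = trans (sym (*-assoc _ _ _)) (clear inv₁ (trans (*-congʳ E∞-factor) (trans
            (solve 8 (λ e t₁ t₂ t₃ t₄ t₅ t₆ t₇ → e :* (t₁ :* t₂ :* t₃ :* t₄ :* t₅ :* t₆ :* t₇) :* t₂ :=
              t₂ :* e :* (t₂ :* t₃ :* t₇) :* (t₁ :* t₄ :* t₅ :* t₆)) refl e (t 1) (t 2) (t 3) (t 4) (t 5) (t 6) (t 7))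
            (*-congʳ (*-congˡ (sym α-factor))))))

          quotient₂ : E∞ * I₂ ≈ t 2 * e * β
          quotient₂ = clear inv₂ (trans E∞-factor (trans
            (solve 8 (λ e t₁ t₂ t₃ t₄ t₅ t₆ t₇ → e :* (t₁ :* t₂ :* t₃ :* t₄ :* t₅ :* t₆ :* t₇) :=
              t₂ :* e :* (t₁ :* t₄ :* t₆) :* (t₃ :* t₅ :* t₇)) refl e (t 1) (t 2) (t 3) (t 4) (t 5) (t 6) (t 7))
            (*-congʳ (*-congˡ (sym β-factor)))))

          quotient₃ : E∞ * I₃ ≈ φ 5 5 * β
          quotient₃ = clear inv₃ (trans Q-factor (solve 3 (λ p a b → p :* (a :* b) := p :* b :* a) refl _ _ _))

          quotient₄ : E∞ * I₄ ≈ t 4 * e * α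
          quotient₄ = clear inv₄ (trans E∞-factor (trans
            (solve 8 (λ e t₁ t₂ t₃ t₄ t₅ t₆ t₇ → e :* (t₁ :* t₂ :* t₃ :* t₄ :* t₅ :* t₆ :* t₇) :=
              t₄ :* e :* (t₂ :* t₃ :* t₇) :* (t₁ :* t₅ :* t₆)) refl e (t 1) (t 2) (t 3) (t 4) (t 5) (t 6) (t 7))
            (*-congʳ (*-congˡ (sym α-factor)))))

          quotient₅ : ∀ x → E∞ * (x * I₅) ≈ x * e * β
          quotient₅ x = trans (sym (*-assoc _ _ _)) (clear inv₅ (trans (*-congʳ E∞-factor) (trans
            (solve 9 (λ x e t₁ t₂ t₃ t₄ t₅ t₆ t₇ → e :* (t₁ :* t₂ :* t₃ :* t₄ :* t₅ :* t₆ :* t₇) :* x :=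
              x :* e :* (t₁ :* t₄ :* t₆) :* (t₂ :* t₃ :* t₅ :* t₇)) refl x e (t 1) (t 2) (t 3) (t 4) (t 5) (t 6) (t 7))
            (*-congʳ (*-congˡ (sym β-factor))))))

          -- In this form `quintuple` evaluates a difference of two triple products of modulus 15,
          -- times `α`, as a single product.
          J≈ : J ≈ t 4 * e + - (q ^ 5 * (t 1 * e))
          J≈ = +-cong (sym (φ-jacobi 4 11 14 ≡.refl))
            (-‿cong (*-cong (*-identityʳ Q) (sym (φ-jacobi 1 14 14 ≡.refl))))

        -- `E∞` contains both the denominator cleared in `spt≈T` and the complementary factor
        -- `rankFactor₂`, so the product of two known dissections is to be compared with the claim.
        spt≈products : PP ≈ φ 5 5 * products
        spt≈products = qpoch-cancel {Q} {L} Q K nilQ (begin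
          E∞ * PP
            ≈⟨ *-congʳ (qpoch-fifth Φ K) ⟨
          A * B * (qpoch (z ^ 2 * q) q K * qpoch (z ^ 3 * q) q K * qpoch q q K) * PP
            ≈⟨ solve 3 (λ x y p → x :* y :* p := x :* p :* y) refl _ _ _ ⟩
          A * B * PP * (qpoch (z ^ 2 * q) q K * qpoch (z ^ 3 * q) q K * qpoch q q K)
            ≈⟨ *-cong spt≈T (rankFactor₂ Φ) ⟩
          T * (p * (α + c * (q * β)))
            -- As c² + c = 1, the coefficient c (1 + c) of the product of t₁ and β becomes one. The
            -- term q² t₄ α is written with (1 + c) - c, and its first part is joined with -(1 + c)
            -- q⁷ t₁ α to meet `J≈`.
            ≈⟨ ≈-modulo Φ (solve 8 (λ z q p j₁ j₂ j₄ a b →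
                 let one = con (+ 1)
                     c = z :+ z :^ 4 in
                 (q :^ 2 :* j₄ :+ :- (q :^ 5 :* j₂) :+ :- ((one :+ c) :* (q :^ 7 :* j₁))) :* (p :* (a :+ c :* (q :* b)))
                 := p :* (:- (q :^ 5 :* (j₂ :* a)) :+ :- (c :* (q :^ 6 :* (j₂ :* b))) :+ (one :+ c) :* (q :^ 2 :* ((j₄ :+ :- (q :^ 5 :* j₁)) :* a))
                     :+ :- (c :* (q :^ 2 :* (j₄ :* a))) :+ :- (q :^ 8 :* (j₁ :* b)) :+ c :* (q :^ 3 :* (j₄ :* b)))
                   :+ (one :+ z :+ z :^ 2 :+ z :^ 3 :+ z :^ 4) :* (:- (:- one :+ con (+ 2) :* z :- z :^ 3 :+ z :^ 4) :* (q :^ 8 :* (p :* (j₁ :* b)))))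
                 refl z q p (t 1 * e) (t 2 * e) (t 4 * e) α β) ⟩
          p * (- (q ^ 5 * (t 2 * e * α)) + - (c * (q ^ 6 * (t 2 * e * β))) + (1# + c) * (q ^ 2 * ((t 4 * e + - (q ^ 5 * (t 1 * e))) * α))
            + - (c * (q ^ 2 * (t 4 * e * α))) + - (q ^ 8 * (t 1 * e * β)) + c * (q ^ 3 * (t 4 * e * β)))
            ≈⟨ *-congˡ (+-cong (+-cong (+-cong (+-cong (+-cong
                 (-‿cong (*-congˡ (sym quotient₁)))
                 (-‿cong (*-congˡ (*-congˡ (sym quotient₂)))))
                 (*-congˡ (trans (*-congˡ (*-congʳ (sym J≈))) (trans quintuple (*-congˡ (sym quotient₃))))))
                 (-‿cong (*-congˡ (*-congˡ (sym quotient₄)))))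
                 (-‿cong (*-congˡ (sym (quotient₅ (t 1))))))
                 (*-congˡ (*-congˡ (sym (quotient₅ (t 4)))))) ⟩
          p * (- (q ^ 5 * (E∞ * (t 2 * I₁))) + - (c * (q ^ 6 * (E∞ * I₂))) + (1# + c) * (q ^ 2 * (E∞ * I₃))
            + - (c * (q ^ 2 * (E∞ * I₄))) + - (q ^ 8 * (E∞ * (t 1 * I₅))) + c * (q ^ 3 * (E∞ * (t 4 * I₅))))
            ≈⟨ solve 14 (λ p q₂ q₃ q₅ q₆ q₈ c E x₁ x₂ x₃ x₄ x₅ x₆ → let one = con (+ 1) in
                 p :* (:- (q₅ :* (E :* x₁)) :+ :- (c :* (q₆ :* (E :* x₂))) :+ (one :+ c) :* (q₂ :* (E :* x₃))
                   :+ :- (c :* (q₂ :* (E :* x₄))) :+ :- (q₈ :* (E :* x₅)) :+ c :* (q₃ :* (E :* x₆)))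
                 := E :* (p :* (:- (q₅ :* x₁) :+ :- (c :* (q₆ :* x₂)) :+ (one :+ c) :* (q₂ :* x₃)
                   :+ :- (c :* (q₂ :* x₄)) :+ :- (q₈ :* x₅) :+ c :* (q₃ :* x₆)))) refl
                 p (q ^ 2) (q ^ 3) (q ^ 5) (q ^ 6) (q ^ 8) c E∞ (t 2 * I₁) I₂ I₃ I₄ (t 1 * I₅) (t 4 * I₅) ⟩
          E∞ * (p * products) ∎)
          where
          A = qpoch (z * q) q K
          B = qpoch (z ^ 4 * q) q K
          p = φ 5 5

-- The ring ℤ[ζ].

module Cyclotomic where

  open ℤS.+-*-Solver
  open ≡ using (refl; sym; trans; cong; cong₂; isEquivalence)

  private
    mk-cong : ∀ {a a′ b b′ c c′ d d′} → a ≡ a′ → b ≡ b′ → c ≡ c′ → d ≡ d′ → mk a b c d ≡ mk a′ b′ c′ d′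
    mk-cong refl refl refl refl = refl

  +R-assoc : ∀ x y z → (x +R y) +R z ≡ x +R (y +R z)
  +R-assoc x y z = mk-cong (ℤₚ.+-assoc (c0 x) _ _) (ℤₚ.+-assoc (c1 x) _ _) (ℤₚ.+-assoc (c2 x) _ _) (ℤₚ.+-assoc (c3 x) _ _)

  +R-comm : ∀ x y → x +R y ≡ y +R x
  +R-comm x y = mk-cong (ℤₚ.+-comm (c0 x) _) (ℤₚ.+-comm (c1 x) _) (ℤₚ.+-comm (c2 x) _) (ℤₚ.+-comm (c3 x) _)

  +R-identityˡ : ∀ x → 0R +R x ≡ x
  +R-identityˡ x = mk-cong (ℤₚ.+-identityˡ _) (ℤₚ.+-identityˡ _) (ℤₚ.+-identityˡ _) (ℤₚ.+-identityˡ _)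

  -R-inverseˡ : ∀ x → (-R x) +R x ≡ 0R
  -R-inverseˡ x = mk-cong (ℤₚ.+-inverseˡ (c0 x)) (ℤₚ.+-inverseˡ (c1 x)) (ℤₚ.+-inverseˡ (c2 x)) (ℤₚ.+-inverseˡ (c3 x))

  private
    record Quad (n : ℕ) : Set where
      constructor quad
      field p0 p1 p2 p3 : Polynomial n
    open Quad

    -- Symbolic copies of the ring operations, so that one formula serves all four coordinates. The
    -- bracketing is that of `_*R_`, which makes the polynomials evaluate to its coordinates by
    -- definition.
    _⊗_ _⊞_ : ∀ {n} → Quad n → Quad n → Quad n
    quad a0 a1 a2 a3 ⊗ quad b0 b1 b2 b3 =
      let e4 = a1 :* b3 :+ a2 :* b2 :+ a3 :* b1 in quad
        (a0 :* b0 :+ (a2 :* b3 :+ a3 :* b2) :- e4)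
        (a0 :* b1 :+ a1 :* b0 :+ a3 :* b3 :- e4)
        (a0 :* b2 :+ a1 :* b1 :+ a2 :* b0 :- e4)
        (a0 :* b3 :+ a1 :* b2 :+ a2 :* b1 :+ a3 :* b0 :- e4)
    quad a0 a1 a2 a3 ⊞ quad b0 b1 b2 b3 = quad (a0 :+ b0) (a1 :+ b1) (a2 :+ b2) (a3 :+ b3)

    comm₈ : (i : ∀ {n} → Quad n → Polynomial n) → ∀ {n} (a b c d e f g h : Polynomial n) → _
    comm₈ i a b c d e f g h = i (quad a b c d ⊗ quad e f g h) := i (quad e f g h ⊗ quad a b c d)

    assoc₁₂ distrib₁₂ : (i : ∀ {n} → Quad n → Polynomial n) → ∀ {n} (a b c d e f g h k l m o : Polynomial n) → _
    assoc₁₂ i a b c d e f g h k l m o =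
      i ((quad a b c d ⊗ quad e f g h) ⊗ quad k l m o) := i (quad a b c d ⊗ (quad e f g h ⊗ quad k l m o))
    distrib₁₂ i a b c d e f g h k l m o =
      i (quad a b c d ⊗ (quad e f g h ⊞ quad k l m o)) := i ((quad a b c d ⊗ quad e f g h) ⊞ (quad a b c d ⊗ quad k l m o))

  *R-comm : ∀ x y → x *R y ≡ y *R x
  *R-comm (mk a b c d) (mk e f g h) = mk-cong
    (solve 8 (comm₈ p0) refl a b c d e f g h) (solve 8 (comm₈ p1) refl a b c d e f g h)
    (solve 8 (comm₈ p2) refl a b c d e f g h) (solve 8 (comm₈ p3) refl a b c d e f g h)

  *R-assoc : ∀ x y z → (x *R y) *R z ≡ x *R (y *R z)
  *R-assoc (mk a b c d) (mk e f g h) (mk k l m o) = mk-cong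
    (solve 12 (assoc₁₂ p0) refl a b c d e f g h k l m o) (solve 12 (assoc₁₂ p1) refl a b c d e f g h k l m o)
    (solve 12 (assoc₁₂ p2) refl a b c d e f g h k l m o) (solve 12 (assoc₁₂ p3) refl a b c d e f g h k l m o)

  *R-distribˡ-+R : ∀ x y z → x *R (y +R z) ≡ x *R y +R x *R z
  *R-distribˡ-+R (mk a b c d) (mk e f g h) (mk k l m o) = mk-cong
    (solve 12 (distrib₁₂ p0) refl a b c d e f g h k l m o) (solve 12 (distrib₁₂ p1) refl a b c d e f g h k l m o)
    (solve 12 (distrib₁₂ p2) refl a b c d e f g h k l m o) (solve 12 (distrib₁₂ p3) refl a b c d e f g h k l m o)

  *R-identityˡ : ∀ x → 1R *R x ≡ x
  *R-identityˡ (mk a b c d) = mk-cong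
    (solve 4 (λ a b c d → p0 (one ⊗ quad a b c d) := a) refl a b c d) (solve 4 (λ a b c d → p1 (one ⊗ quad a b c d) := b) refl a b c d)
    (solve 4 (λ a b c d → p2 (one ⊗ quad a b c d) := c) refl a b c d) (solve 4 (λ a b c d → p3 (one ⊗ quad a b c d) := d) refl a b c d)
    where
    one : ∀ {n} → Quad n
    one = quad (con (+ 1)) (con (+ 0)) (con (+ 0)) (con (+ 0))

  Zζ-ring : CommutativeRing 0ℓ 0ℓ
  Zζ-ring = record
    { Carrier = Zζ ; _≈_ = _≡_ ; _+_ = _+R_ ; _*_ = _*R_ ; -_ = -R_ ; 0# = 0R ; 1# = 1R
    ; isCommutativeRing = record
      { isRing = record
        { +-isAbelianGroup = record
          { isGroup = record
            { isMonoid = record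
              { isSemigroup = record
                { isMagma = record { isEquivalence = isEquivalence ; ∙-cong = cong₂ _+R_ }
                ; assoc = +R-assoc }
              ; identity = +R-identityˡ , λ x → trans (+R-comm x 0R) (+R-identityˡ x) }
            ; inverse = -R-inverseˡ , λ x → trans (+R-comm x (-R x)) (-R-inverseˡ x)
            ; ⁻¹-cong = cong (λ x → -R x) }
          ; comm = +R-comm }
        ; *-cong = cong₂ _*R_
        ; *-assoc = *R-assoc
        ; *-identity = *R-identityˡ , λ x → trans (*R-comm x 1R) (*R-identityˡ x)
        ; distrib = *R-distribˡ-+R , λ x y z → trans (*R-comm (y +R z) x)
            (trans (*R-distribˡ-+R x y z) (cong₂ _+R_ (*R-comm x y) (*R-comm x z))) }
      ; *-comm = *R-comm } }

-- Power series over ℤ[ζ] modulo a power of q.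

module PowerSeries where

  open Cyclotomic
  open import Data.Nat using (_≤_; _<_; _∸_; _≤?_)
  open ≡ using (refl; sym; trans; cong; cong₂; module ≡-Reasoning)
  open FiniteIdentities Zζ-ring using (antidiag; antidiag-cong; antidiag-+; antidiag-*ˡ; antidiag-*ʳ; antidiag-swap; antidiag-assoc)
  open InfiniteProducts Zζ-ring using (antidiag-zero)
  private module R = CommutativeRing Zζ-ring

  -- `sumTo` peels off its last term and `antidiag` its first; this reconciles them.
  sumTo-head : ∀ n f → sumTo (suc n) f ≡ f 0 +R sumTo n (λ i → f (suc i))
  sumTo-head zero    f = refl
  sumTo-head (suc n) f = begin
    f (suc n) +R sumTo (suc n) f                          ≡⟨ cong (f (suc n) +R_) (sumTo-head n f) ⟩
    f (suc n) +R (f 0 +R sumTo n (λ i → f (suc i)))       ≡⟨ +R-assoc (f (suc n)) (f 0) (sumTo n (λ i → f (suc i))) ⟨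
    f (suc n) +R f 0 +R sumTo n (λ i → f (suc i))         ≡⟨ cong (_+R sumTo n (λ i → f (suc i))) (R.+-comm (f (suc n)) (f 0)) ⟩
    f 0 +R f (suc n) +R sumTo n (λ i → f (suc i))         ≡⟨ +R-assoc (f 0) (f (suc n)) (sumTo n (λ i → f (suc i))) ⟩
    f 0 +R sumTo (suc n) (λ i → f (suc i))                ∎
    where open ≡-Reasoning

  sumTo-antidiag : ∀ n (h : ℕ → ℕ → Zζ) → sumTo (suc n) (λ i → h i (n ∸ i)) ≡ antidiag n h
  sumTo-antidiag zero    h = R.+-identityʳ _
  sumTo-antidiag (suc n) h = trans (sumTo-head (suc n) (λ i → h i (suc n ∸ i)))
    (cong (h 0 (suc n) +R_) (sumTo-antidiag n (λ i → h (suc i))))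

  ⊛-antidiag : ∀ f g n → (f ⊛ g) n ≡ antidiag n (λ i j → f i *R g j)
  ⊛-antidiag f g n = sumTo-antidiag n (λ i j → f i *R g j)

  infix 4 _≈[_]_

  -- Wrapped in a record so that N and both series can be inferred from a proof.
  record _≈[_]_ (f : FPS) (N : ℕ) (g : FPS) : Set where
    constructor mod
    field at : ∀ n → n < N → f n ≡ g n

  open _≈[_]_ public

  ≐⇒≈ : ∀ {N f g} → f ≐ g → f ≈[ N ] g
  ≐⇒≈ f≐g = mod (λ n _ → f≐g n)

  ⊛-cong : ∀ {N f f′ g g′} → f ≈[ N ] f′ → g ≈[ N ] g′ → f ⊛ g ≈[ N ] f′ ⊛ g′
  ⊛-cong {f = f} {f′} {g} {g′} f≈ g≈ = mod λ n n<N → let open ≡-Reasoning in begin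
    (f ⊛ g) n                            ≡⟨ ⊛-antidiag f g n ⟩
    antidiag n (λ i j → f i *R g j)      ≡⟨ antidiag-cong n (λ i j e → cong₂ _*R_
      (f≈ .at i (ℕₚ.≤-<-trans (ℕₚ.m+n≤o⇒m≤o i (ℕₚ.≤-reflexive e)) n<N))
      (g≈ .at j (ℕₚ.≤-<-trans (ℕₚ.m+n≤o⇒n≤o i (ℕₚ.≤-reflexive e)) n<N))) ⟩
    antidiag n (λ i j → f′ i *R g′ j)    ≡⟨ ⊛-antidiag f′ g′ n ⟨
    (f′ ⊛ g′) n                          ∎

  ⊛-comm : ∀ f g → (f ⊛ g) ≐ (g ⊛ f)
  ⊛-comm f g n = begin
    (f ⊛ g) n                            ≡⟨ ⊛-antidiag f g n ⟩
    antidiag n (λ i j → f i *R g j)      ≡⟨ antidiag-cong n (λ i j _ → *R-comm (f i) (g j)) ⟩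
    antidiag n (λ i j → g j *R f i)      ≡⟨ antidiag-swap n (λ i j → g i *R f j) ⟩
    antidiag n (λ i j → g i *R f j)      ≡⟨ ⊛-antidiag g f n ⟨
    (g ⊛ f) n                            ∎
    where open ≡-Reasoning

  ⊛-assoc : ∀ f g h → ((f ⊛ g) ⊛ h) ≐ (f ⊛ (g ⊛ h))
  ⊛-assoc f g h n = begin
    ((f ⊛ g) ⊛ h) n
      ≡⟨ ⊛-antidiag (f ⊛ g) h n ⟩
    antidiag n (λ i k → (f ⊛ g) i *R h k)
      ≡⟨ antidiag-cong n (λ i k _ → trans (cong (_*R h k) (⊛-antidiag f g i)) (sym (antidiag-*ʳ i (h k) (λ a b → f a *R g b)))) ⟩
    antidiag n (λ i k → antidiag i (λ a b → f a *R g b *R h k))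
      ≡⟨ antidiag-assoc n (λ a b k → f a *R g b *R h k) ⟩
    antidiag n (λ a j → antidiag j (λ b k → f a *R g b *R h k))
      ≡⟨ antidiag-cong n (λ a j _ → trans (antidiag-cong j (λ b k _ → *R-assoc (f a) (g b) (h k)))
           (trans (antidiag-*ˡ j (f a) (λ b k → g b *R h k)) (cong (f a *R_) (sym (⊛-antidiag g h j))))) ⟩
    antidiag n (λ a j → f a *R (g ⊛ h) j)
      ≡⟨ ⊛-antidiag f (g ⊛ h) n ⟨
    (f ⊛ (g ⊛ h)) n ∎
    where open ≡-Reasoning

  ⊛-distribˡ-⊕ : ∀ f g h → (f ⊛ (g ⊕ h)) ≐ (f ⊛ g ⊕ f ⊛ h)
  ⊛-distribˡ-⊕ f g h n = begin
    (f ⊛ (g ⊕ h)) n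
      ≡⟨ ⊛-antidiag f (g ⊕ h) n ⟩
    antidiag n (λ i j → f i *R (g j +R h j))
      ≡⟨ antidiag-cong n (λ i j _ → *R-distribˡ-+R (f i) (g j) (h j)) ⟩
    antidiag n (λ i j → f i *R g j +R f i *R h j)
      ≡⟨ antidiag-+ n _ _ ⟩
    antidiag n (λ i j → f i *R g j) +R antidiag n (λ i j → f i *R h j)
      ≡⟨ cong₂ _+R_ (⊛-antidiag f g n) (⊛-antidiag f h n) ⟨
    (f ⊛ g ⊕ f ⊛ h) n ∎
    where open ≡-Reasoning

  constant : Zζ → FPS
  constant a zero    = a
  constant a (suc n) = 0R

  constant-⊛ : ∀ a f n → (constant a ⊛ f) n ≡ a *R f n
  constant-⊛ a f n = trans (⊛-antidiag (constant a) f n) (lemma n)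
    where
    lemma : ∀ n → antidiag n (λ i j → constant a i *R f j) ≡ a *R f n
    lemma zero    = refl
    lemma (suc n) = trans (cong (a *R f (suc n) +R_) (antidiag-zero n (λ i j → R.zeroˡ (f j)))) (R.+-identityʳ (a *R f (suc n)))

  oneS-⊛ : ∀ f → (oneS ⊛ f) ≐ f
  oneS-⊛ f n = trans (⊛-cong {suc n} {oneS} {constant 1R} {f} {f} (≐⇒≈ (λ { zero → refl ; (suc _) → refl })) (≐⇒≈ (λ _ → refl)) .at n ℕₚ.≤-refl)
    (trans (constant-⊛ 1R f n) (*R-identityˡ (f n)))

  X : FPS
  X 1 = 1R
  X _ = 0R

  X-⊛-suc : ∀ f n → (X ⊛ f) (suc n) ≡ f n
  X-⊛-suc f n = trans (⊛-antidiag X f (suc n)) (trans (cong₂ _+R_ (R.zeroˡ (f (suc n))) (lemma n)) (R.+-identityˡ (f n)))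
    where
    lemma : ∀ n → antidiag n (λ i j → X (suc i) *R f j) ≡ f n
    lemma zero    = *R-identityˡ (f 0)
    lemma (suc n) = trans (cong₂ _+R_ (*R-identityˡ (f (suc n))) (antidiag-zero n (λ i j → R.zeroˡ (f j)))) (R.+-identityʳ (f (suc n)))

  X-⊛-zero : ∀ f → (X ⊛ f) 0 ≡ 0R
  X-⊛-zero f = trans (⊛-antidiag X f 0) (R.zeroˡ (f 0))

  -- The quotient keeps all power series as carrier and coarsens only the equality, so the given
  -- series are elements of it as they stand.
  truncatedRing : ℕ → CommutativeRing 0ℓ 0ℓ
  truncatedRing N = record
    { Carrier = FPS ; _≈_ = _≈[ N ]_ ; _+_ = _⊕_ ; _*_ = _⊛_ ; -_ = ⊝_ ; 0# = λ _ → 0R ; 1# = oneS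
    ; isCommutativeRing = record
      { isRing = record
        { +-isAbelianGroup = record
          { isGroup = record
            { isMonoid = record
              { isSemigroup = record
                { isMagma = record
                  { isEquivalence = record
                    { refl = ≐⇒≈ (λ _ → refl)
                    ; sym = λ f≈g → mod λ n n<N → sym (f≈g .at n n<N)
                    ; trans = λ f≈g g≈h → mod λ n n<N → trans (f≈g .at n n<N) (g≈h .at n n<N) }
                  ; ∙-cong = λ f≈ g≈ → mod λ n n<N → cong₂ _+R_ (f≈ .at n n<N) (g≈ .at n n<N) }
                ; assoc = λ f g h → ≐⇒≈ λ n → +R-assoc (f n) (g n) (h n) }
              ; identity = (λ f → ≐⇒≈ λ n → R.+-identityˡ (f n)) , (λ f → ≐⇒≈ λ n → R.+-identityʳ (f n)) }
            ; inverse = (λ f → ≐⇒≈ λ n → R.-‿inverseˡ (f n)) , (λ f → ≐⇒≈ λ n → R.-‿inverseʳ (f n))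
            ; ⁻¹-cong = λ f≈g → mod λ n n<N → cong (λ x → -R x) (f≈g .at n n<N) }
          ; comm = λ f g → ≐⇒≈ λ n → +R-comm (f n) (g n) }
        ; *-cong = ⊛-cong
        ; *-assoc = λ f g h → ≐⇒≈ (⊛-assoc f g h)
        ; *-identity = (λ f → ≐⇒≈ (oneS-⊛ f)) , (λ f → ≐⇒≈ λ n → trans (⊛-comm f oneS n) (oneS-⊛ f n))
        ; distrib = (λ f g h → ≐⇒≈ (⊛-distribˡ-⊕ f g h)) , (λ f g h → ≐⇒≈ λ n → trans (⊛-comm (g ⊕ h) f n)
            (trans (⊛-distribˡ-⊕ f g h n) (cong₂ _+R_ (⊛-comm f g n) (⊛-comm f h n)))) }
      ; *-comm = λ f g → ≐⇒≈ (⊛-comm f g) } }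

  shift-suc : ∀ k f n → shift (suc k) f (suc n) ≡ shift k f n
  shift-suc k f n with k ≤? n | suc k ≤? suc n
  ... | yes _   | yes _   = refl
  ... | no  _   | no  _   = refl
  ... | yes k≤n | no  k≰n = ⊥-elim (k≰n (s≤s k≤n))
  ... | no  k≰n | yes k≤n = ⊥-elim (k≰n (ℕₚ.≤-pred k≤n))

  shift-< : ∀ {k n} f → n < k → shift k f n ≡ 0R
  shift-< {k} {n} f n<k with k ≤? n
  ... | yes k≤n = ⊥-elim (ℕₚ.<⇒≱ n<k k≤n)
  ... | no  _   = refl

  shift-X : ∀ k f → shift (suc k) f ≐ (X ⊛ shift k f)
  shift-X k f zero    = sym (X-⊛-zero (shift k f))
  shift-X k f (suc n) = trans (shift-suc k f n) (sym (X-⊛-suc (shift k f) n))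

  ⊛-0 : ∀ f g → f 0 ≡ 1R → g 0 ≡ 1R → (f ⊛ g) 0 ≡ 1R
  ⊛-0 f g f₀ g₀ = trans (⊛-antidiag f g 0) (cong₂ _*R_ f₀ g₀)

  poch-0 : ∀ a k d → poch a k d 0 ≡ 1R
  poch-0 a k d = refl

  -- Entries of the growing table are final: later stages copy every index already computed.
  invUpTo-suc : ∀ f m n → m ≤ n → invUpTo f n m ≡ inv f m
  invUpTo-suc f zero    zero    _ = refl
  invUpTo-suc f m       (suc n) m≤1+n with m ≤? n
  ... | yes m≤n = invUpTo-suc f m n m≤n
  ... | no  m≰n with refl ← ℕₚ.≤-antisym m≤1+n (ℕₚ.≰⇒> m≰n) with suc n ≤? n
  ...   | yes n<n = ⊥-elim (ℕₚ.1+n≰n n<n)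
  ...   | no  _   = refl

  inv-suc : ∀ f n → inv f (suc n) ≡ -R antidiag n (λ i j → f (suc i) *R inv f j)
  inv-suc f n with suc n ≤? n
  ... | yes n<n = ⊥-elim (ℕₚ.1+n≰n n<n)
  ... | no  _   = cong (λ x → -R x) (trans (sumTo-antidiag n (λ i j → f (suc i) *R invUpTo f n j))
    (antidiag-cong n (λ i j e → cong (f (suc i) *R_) (invUpTo-suc f j n (ℕₚ.m+n≤o⇒n≤o i (ℕₚ.≤-reflexive e))))))

  inv-inverse : ∀ f → f 0 ≡ 1R → (f ⊛ inv f) ≐ oneS
  inv-inverse f f₀ zero    = trans (⊛-antidiag f (inv f) 0) (trans (cong (_*R 1R) f₀) (*R-identityˡ 1R))
  inv-inverse f f₀ (suc n) = begin
    (f ⊛ inv f) (suc n)                    ≡⟨ ⊛-antidiag f (inv f) (suc n) ⟩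
    f 0 *R inv f (suc n) +R tail           ≡⟨ cong (λ x → x *R inv f (suc n) +R tail) f₀ ⟩
    1R *R inv f (suc n) +R tail            ≡⟨ cong (_+R tail) (trans (*R-identityˡ _) (inv-suc f n)) ⟩
    (-R tail) +R tail                      ≡⟨ -R-inverseˡ tail ⟩
    0R                                     ∎
    where
    open ≡-Reasoning
    tail = antidiag n (λ i j → f (suc i) *R inv f j)

-- From the formal definitions to the identity in an abstract ring.

module Transfer {ℓ₁ ℓ₂} (R : CommutativeRing ℓ₁ ℓ₂) where

  open CommutativeRing R hiding (zero)
  open SetoidReasoning setoid
  open RingSolver R
  open FiniteIdentities R
  open InfiniteProducts R
  open Dissections R
  open FifthRoots R
  open ProductIdentity R
  open PowerSeries using (⊛-0; poch-0)
  open import Data.Nat using (_∸_)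

  -- ι is reduction modulo q^N; its abstract properties suffice, so that no convolution is ever unfolded.
  module Interpretation
    (five-cancel : ∀ {x} → x + (x + (x + (x + x))) ≈ 0# → x ≈ 0#)
    {q N} (nil : q ^ N ≈ 0#)
    (C : Zζ → Carrier) (C-1 : C 1R ≈ 1#) (C-+ : ∀ a b → C (a +R b) ≈ C a + C b) (C-^ : ∀ a k → C (a ^R k) ≈ C a ^ k)
    (root : IsFifthRoot (C ζ))
    (ι : FPS → Carrier)
    (ι-1 : ι oneS ≈ 1#)
    (ι-⊕ : ∀ f g → ι (f ⊕ g) ≈ ι f + ι g)
    (ι-⊝ : ∀ f → ι (⊝ f) ≈ - ι f)
    (ι-⊛ : ∀ f g → ι (f ⊛ g) ≈ ι f * ι g)
    (ι-· : ∀ a f → ι (a · f) ≈ C a * ι f)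
    (ι-shift : ∀ k f → ι (shift k f) ≈ q ^ k * ι f)
    (ι-factor : ∀ a m → 1 ℕ.≤ m → ι (factor a m) ≈ 1# + - (C a * q ^ m))
    (ι-poch : ∀ a k d → 1 ℕ.≤ k → 1 ℕ.≤ d → ι (poch a k d) ≈ ι (prodTo N (λ j → factor a (k ℕ.+ d ℕ.* j))))
    (ι-inv : ∀ f → f 0 ≡ 1R → ι (f ⊛ inv f) ≈ ι oneS)
    (ι-PP3 : ι (PP3 ζ ζ⁻¹) ≈ ∑ (4 ℕ.+ N ℕ.* 5) (λ i → ι (PP3-term ζ ζ⁻¹ (suc i))))
    where

    private
      z : Carrier
      z = C ζ

    open Main five-cancel {z} root {q} {N} nil {N} ℕₚ.≤-refl {suc N} ℕₚ.≤-refl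
    open Quintisection five-cancel {Q} {N} nilQ {N} ℕₚ.≤-refl {suc N} ℕₚ.≤-refl using (φ; α)
    open FifthRoot root using (u^5≈1)

    poch-qpoch : ∀ a k d → 1 ℕ.≤ k → 1 ℕ.≤ d → ι (poch a k d) ≈ qpoch (C a * q ^ k) (q ^ d) N
    poch-qpoch a k d 1≤k 1≤d = trans (ι-poch a k d 1≤k 1≤d) (finite N)
      where
      F : ℕ → FPS
      F j = factor a (k ℕ.+ d ℕ.* j)
      factors : ∀ j → ι (F j) ≈ 1# + - (C a * q ^ k * (q ^ d) ^ j)
      factors j = begin
        ι (F j)                                       ≈⟨ ι-factor a (k ℕ.+ d ℕ.* j) (ℕₚ.≤-trans 1≤k (ℕₚ.m≤m+n k (d ℕ.* j))) ⟩
        1# + - (C a * q ^ (k ℕ.+ d ℕ.* j))            ≈⟨ +-congˡ (-‿cong (*-congˡ (trans (^-homo-* q k (d ℕ.* j)) (*-congˡ (sym (^-assocʳ q d j)))))) ⟩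
        1# + - (C a * (q ^ k * (q ^ d) ^ j))          ≈⟨ +-congˡ (-‿cong (*-assoc (C a) (q ^ k) ((q ^ d) ^ j))) ⟨
        1# + - (C a * q ^ k * (q ^ d) ^ j)            ∎
      finite : ∀ K → ι (prodTo K F) ≈ qpoch (C a * q ^ k) (q ^ d) K
      finite zero    = ι-1
      finite (suc K) = trans (ι-⊛ (prodTo K F) (F K)) (*-cong (finite K) (factors K))

    -- Every exponent and modulus in the products of the claim is a multiple of 5, so they are all
    -- products in Q = q⁵.
    poch-φ : ∀ {k d} i j → k ≡ 5 ℕ.* i → d ≡ 5 ℕ.* j → 1 ℕ.≤ i → 1 ℕ.≤ j → ι (poch 1R k d) ≈ φ i j
    poch-φ i j ≡.refl ≡.refl 1≤i 1≤j = trans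
      (poch-qpoch 1R (5 ℕ.* i) (5 ℕ.* j) (ℕₚ.≤-trans 1≤i (ℕₚ.m≤n*m i 5)) (ℕₚ.≤-trans 1≤j (ℕₚ.m≤n*m j 5)))
      (qpoch-cong N (trans (*-congʳ C-1) (trans (*-identityˡ _) (sym (^-assocʳ q 5 i)))) (sym (^-assocʳ q 5 j)))

    θ-φ : ∀ {k d} i i′ j → k ≡ 5 ℕ.* i → d ∸ k ≡ 5 ℕ.* i′ → d ≡ 5 ℕ.* j → 1 ℕ.≤ i → 1 ℕ.≤ i′ → 1 ℕ.≤ j →
      ι (θ k d) ≈ φ i j * φ i′ j
    θ-φ {k} {d} i i′ j k≡ d-k≡ d≡ 1≤i 1≤i′ 1≤j = trans (ι-⊛ (poch 1R k d) (poch 1R (d ∸ k) d))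
      (*-cong (poch-φ i j k≡ d≡ 1≤i 1≤j) (poch-φ i′ j d-k≡ d≡ 1≤i′ 1≤j))

    private
      1≤ : ∀ {n} → 1 ℕ.≤ suc n
      1≤ = s≤s z≤n

      θ-0 : ∀ k d → θ k d 0 ≡ 1R
      θ-0 k d = ⊛-0 (poch 1R k d) (poch 1R (d ∸ k) d) (poch-0 1R k d) (poch-0 1R (d ∸ k) d)

      t₁ : ι (θ 5 75) ≈ t 1
      t₁ = θ-φ {5} {75} 1 14 15 ≡.refl ≡.refl ≡.refl 1≤ 1≤ 1≤
      t₂ : ι (θ 10 75) ≈ t 2
      t₂ = θ-φ {10} {75} 2 13 15 ≡.refl ≡.refl ≡.refl 1≤ 1≤ 1≤
      t₃ : ι (θ 15 75) ≈ t 3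
      t₃ = θ-φ {15} {75} 3 12 15 ≡.refl ≡.refl ≡.refl 1≤ 1≤ 1≤
      t₄ : ι (θ 20 75) ≈ t 4
      t₄ = θ-φ {20} {75} 4 11 15 ≡.refl ≡.refl ≡.refl 1≤ 1≤ 1≤
      t₅ : ι (θ 25 75) ≈ t 5
      t₅ = θ-φ {25} {75} 5 10 15 ≡.refl ≡.refl ≡.refl 1≤ 1≤ 1≤
      t₆ : ι (θ 30 75) ≈ t 6
      t₆ = θ-φ {30} {75} 6 9 15 ≡.refl ≡.refl ≡.refl 1≤ 1≤ 1≤
      t₇ : ι (θ 35 75) ≈ t 7
      t₇ = θ-φ {35} {75} 7 8 15 ≡.refl ≡.refl ≡.refl 1≤ 1≤ 1≤

      inv-inverse : ∀ f {d} → f 0 ≡ 1R → ι f ≈ d → d * ι (inv f) ≈ 1#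
      inv-inverse f f₀ f≈d = trans (*-congʳ (sym f≈d)) (trans (sym (ι-⊛ f (inv f))) (trans (ι-inv f f₀) ι-1))

      inv-inverse₃ : ∀ f g h {x y w} → f 0 ≡ 1R → g 0 ≡ 1R → h 0 ≡ 1R → ι f ≈ x → ι g ≈ y → ι h ≈ w →
        x * y * w * ι (inv (f ⊛ g ⊛ h)) ≈ 1#
      inv-inverse₃ f g h f₀ g₀ h₀ f≈ g≈ h≈ = inv-inverse (f ⊛ g ⊛ h) (⊛-0 (f ⊛ g) h (⊛-0 f g f₀ g₀) h₀)
        (trans (ι-⊛ (f ⊛ g) h) (*-cong (trans (ι-⊛ f g) (*-cong f≈ g≈)) h≈))

      inv-inverse₄ : ∀ f g h k {x y w v} → f 0 ≡ 1R → g 0 ≡ 1R → h 0 ≡ 1R → k 0 ≡ 1R → ι f ≈ x → ι g ≈ y → ι h ≈ w → ι k ≈ v →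
        x * y * w * v * ι (inv (f ⊛ g ⊛ h ⊛ k)) ≈ 1#
      inv-inverse₄ f g h k f₀ g₀ h₀ k₀ f≈ g≈ h≈ k≈ = inv-inverse₃ (f ⊛ g) h k (⊛-0 f g f₀ g₀) h₀ k₀ (trans (ι-⊛ f g) (*-cong f≈ g≈)) h≈ k≈

      inv₁ : t 1 * t 4 * t 5 * t 6 * ι (inv (θ 5 75 ⊛ θ 20 75 ⊛ θ 25 75 ⊛ θ 30 75)) ≈ 1#
      inv₁ = inv-inverse₄ (θ 5 75) (θ 20 75) (θ 25 75) (θ 30 75) (θ-0 5 75) (θ-0 20 75) (θ-0 25 75) (θ-0 30 75) t₁ t₄ t₅ t₆
      inv₂ : t 3 * t 5 * t 7 * ι (inv (θ 15 75 ⊛ θ 25 75 ⊛ θ 35 75)) ≈ 1#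
      inv₂ = inv-inverse₃ (θ 15 75) (θ 25 75) (θ 35 75) (θ-0 15 75) (θ-0 25 75) (θ-0 35 75) t₃ t₅ t₇
      inv₃ : α * ι (inv (θ 10 25)) ≈ 1#
      inv₃ = inv-inverse (θ 10 25) (θ-0 10 25) (θ-φ {10} {25} 2 3 5 ≡.refl ≡.refl ≡.refl 1≤ 1≤ 1≤)
      inv₄ : t 1 * t 5 * t 6 * ι (inv (θ 5 75 ⊛ θ 25 75 ⊛ θ 30 75)) ≈ 1#
      inv₄ = inv-inverse₃ (θ 5 75) (θ 25 75) (θ 30 75) (θ-0 5 75) (θ-0 25 75) (θ-0 30 75) t₁ t₅ t₆
      inv₅ : t 2 * t 3 * t 5 * t 7 * ι (inv (θ 10 75 ⊛ θ 15 75 ⊛ θ 25 75 ⊛ θ 35 75)) ≈ 1#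
      inv₅ = inv-inverse₄ (θ 10 75) (θ 15 75) (θ 25 75) (θ 35 75) (θ-0 10 75) (θ-0 15 75) (θ-0 25 75) (θ-0 35 75) t₂ t₃ t₅ t₇

      I : ℕ → Carrier
      I n = ι (inv (poch ζ n 1 ⊛ poch ζ⁻¹ n 1))

      poch-z : ∀ a {x} n → C a ≈ x → ι (poch a (suc n) 1) ≈ qpoch (x * q ^ suc n) q N
      poch-z a n Ca≈x = trans (poch-qpoch a (suc n) 1 1≤ 1≤) (qpoch-cong N (*-congʳ Ca≈x) (*-identityʳ q))

      I-inverse : ∀ n → I (suc n) * (qpoch (z * q ^ suc n) q N * qpoch (z ^ 4 * q ^ suc n) q N) ≈ 1#
      I-inverse n = trans (*-comm _ _) (inv-inverse (poch ζ (suc n) 1 ⊛ poch ζ⁻¹ (suc n) 1)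
        (⊛-0 (poch ζ (suc n) 1) (poch ζ⁻¹ (suc n) 1) (poch-0 ζ (suc n) 1) (poch-0 ζ⁻¹ (suc n) 1))
        (trans (ι-⊛ (poch ζ (suc n) 1) (poch ζ⁻¹ (suc n) 1)) (*-cong (poch-z ζ n refl) (poch-z ζ⁻¹ n (C-^ ζ 4)))))

      term : ∀ n → ι (PP3-term ζ ζ⁻¹ n) ≈ q ^ (n ℕ.* n ℕ.+ n) * (qpoch (q ^ suc (n ℕ.+ n)) q N * I n)
      term n = begin
        ι (PP3-term ζ ζ⁻¹ n)
          ≈⟨ ι-shift (n ℕ.* n ℕ.+ n) (poch 1R (2 ℕ.* n ℕ.+ 1) 1 ⊛ inv (poch ζ n 1 ⊛ poch ζ⁻¹ n 1)) ⟩
        q ^ (n ℕ.* n ℕ.+ n) * ι (poch 1R (2 ℕ.* n ℕ.+ 1) 1 ⊛ inv (poch ζ n 1 ⊛ poch ζ⁻¹ n 1))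
          ≈⟨ *-congˡ (ι-⊛ (poch 1R (2 ℕ.* n ℕ.+ 1) 1) (inv (poch ζ n 1 ⊛ poch ζ⁻¹ n 1))) ⟩
        q ^ (n ℕ.* n ℕ.+ n) * (ι (poch 1R (2 ℕ.* n ℕ.+ 1) 1) * I n)
          ≈⟨ *-congˡ (*-congʳ (trans (reflexive (≡.cong (λ k → ι (poch 1R k 1)) index)) (trans (poch-z 1R (n ℕ.+ n) C-1) (qpoch-cong N (*-identityˡ _) refl)))) ⟩
        q ^ (n ℕ.* n ℕ.+ n) * (qpoch (q ^ suc (n ℕ.+ n)) q N * I n) ∎
        where
        index : 2 ℕ.* n ℕ.+ 1 ≡ suc (n ℕ.+ n)
        index = ≡.trans (ℕₚ.+-comm (2 ℕ.* n) 1) (≡.cong (λ k → suc (n ℕ.+ k)) (ℕₚ.+-identityʳ n))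

      C-c : C cζ ≈ c
      C-c = trans (C-+ ζ (ζ ^R 4)) (+-congˡ (C-^ ζ 4))

      ι-shift′ : ∀ k f {x} → ι f ≈ x → ι (shift k f) ≈ q ^ k * x
      ι-shift′ k f f≈x = trans (ι-shift k f) (*-congˡ f≈x)

      ι-·′ : ∀ a f {x y} → C a ≈ x → ι f ≈ y → ι (a · f) ≈ x * y
      ι-·′ a f Ca≈x f≈y = trans (ι-· a f) (*-cong Ca≈x f≈y)

      ι-⊕′ : ∀ f g {x y} → ι f ≈ x → ι g ≈ y → ι (f ⊕ g) ≈ x + y
      ι-⊕′ f g f≈x g≈y = trans (ι-⊕ f g) (+-cong f≈x g≈y)

      ι-⊝′ : ∀ f {x} → ι f ≈ x → ι (⊝ f) ≈ - x
      ι-⊝′ f f≈x = trans (ι-⊝ f) (-‿cong f≈x)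

      ι-⊛′ : ∀ f g {x y} → ι f ≈ x → ι g ≈ y → ι (f ⊛ g) ≈ x * y
      ι-⊛′ f g f≈x g≈y = trans (ι-⊛ f g) (*-cong f≈x g≈y)

      s₁ : ι (shift 5 (θ 10 75 ⊛ inv (θ 5 75 ⊛ θ 20 75 ⊛ θ 25 75 ⊛ θ 30 75))) ≈ q ^ 5 * (t 2 * ι (inv (θ 5 75 ⊛ θ 20 75 ⊛ θ 25 75 ⊛ θ 30 75)))
      s₁ = ι-shift′ 5 (θ 10 75 ⊛ inv (θ 5 75 ⊛ θ 20 75 ⊛ θ 25 75 ⊛ θ 30 75)) (ι-⊛′ (θ 10 75) (inv (θ 5 75 ⊛ θ 20 75 ⊛ θ 25 75 ⊛ θ 30 75)) t₂ refl)
      s₂ : ι (cζ · shift 6 (inv (θ 15 75 ⊛ θ 25 75 ⊛ θ 35 75))) ≈ c * (q ^ 6 * ι (inv (θ 15 75 ⊛ θ 25 75 ⊛ θ 35 75)))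
      s₂ = ι-·′ cζ (shift 6 (inv (θ 15 75 ⊛ θ 25 75 ⊛ θ 35 75))) C-c (ι-shift 6 (inv (θ 15 75 ⊛ θ 25 75 ⊛ θ 35 75)))
      s₃ : ι ((1R +R cζ) · shift 2 (inv (θ 10 25))) ≈ (1# + c) * (q ^ 2 * ι (inv (θ 10 25)))
      s₃ = ι-·′ (1R +R cζ) (shift 2 (inv (θ 10 25))) (trans (C-+ 1R cζ) (+-cong C-1 C-c)) (ι-shift 2 (inv (θ 10 25)))
      s₄ : ι (cζ · shift 2 (inv (θ 5 75 ⊛ θ 25 75 ⊛ θ 30 75))) ≈ c * (q ^ 2 * ι (inv (θ 5 75 ⊛ θ 25 75 ⊛ θ 30 75)))
      s₄ = ι-·′ cζ (shift 2 (inv (θ 5 75 ⊛ θ 25 75 ⊛ θ 30 75))) C-c (ι-shift 2 (inv (θ 5 75 ⊛ θ 25 75 ⊛ θ 30 75)))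
      s₅ : ι (shift 8 (θ 5 75 ⊛ inv (θ 10 75 ⊛ θ 15 75 ⊛ θ 25 75 ⊛ θ 35 75))) ≈ q ^ 8 * (t 1 * ι (inv (θ 10 75 ⊛ θ 15 75 ⊛ θ 25 75 ⊛ θ 35 75)))
      s₅ = ι-shift′ 8 (θ 5 75 ⊛ inv (θ 10 75 ⊛ θ 15 75 ⊛ θ 25 75 ⊛ θ 35 75)) (ι-⊛′ (θ 5 75) (inv (θ 10 75 ⊛ θ 15 75 ⊛ θ 25 75 ⊛ θ 35 75)) t₁ refl)
      s₆ : ι (cζ · shift 3 (θ 20 75 ⊛ inv (θ 10 75 ⊛ θ 15 75 ⊛ θ 25 75 ⊛ θ 35 75))) ≈ c * (q ^ 3 * (t 4 * ι (inv (θ 10 75 ⊛ θ 15 75 ⊛ θ 25 75 ⊛ θ 35 75))))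
      s₆ = ι-·′ cζ (shift 3 (θ 20 75 ⊛ inv (θ 10 75 ⊛ θ 15 75 ⊛ θ 25 75 ⊛ θ 35 75))) C-c (ι-shift′ 3 (θ 20 75 ⊛ inv (θ 10 75 ⊛ θ 15 75 ⊛ θ 25 75 ⊛ θ 35 75)) (ι-⊛′ (θ 20 75) (inv (θ 10 75 ⊛ θ 15 75 ⊛ θ 25 75 ⊛ θ 35 75)) t₄ refl))

      -- Stated for arbitrary terms, so that the outer shape of `RHS` is matched without looking
      -- into the six products.
      signedSum : ∀ p f₁ f₂ f₃ f₄ f₅ f₆ {y x₁ x₂ x₃ x₄ x₅ x₆} → ι p ≈ y →
        ι f₁ ≈ x₁ → ι f₂ ≈ x₂ → ι f₃ ≈ x₃ → ι f₄ ≈ x₄ → ι f₅ ≈ x₅ → ι f₆ ≈ x₆ →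
        ι (p ⊛ (⊝ f₁ ⊖ f₂ ⊕ f₃ ⊖ f₄ ⊖ f₅ ⊕ f₆)) ≈ y * (- x₁ + - x₂ + x₃ + - x₄ + - x₅ + x₆)
      signedSum p f₁ f₂ f₃ f₄ f₅ f₆ p≈ e₁ e₂ e₃ e₄ e₅ e₆ = ι-⊛′ p (⊝ f₁ ⊖ f₂ ⊕ f₃ ⊖ f₄ ⊖ f₅ ⊕ f₆) p≈
        (ι-⊕′ (⊝ f₁ ⊖ f₂ ⊕ f₃ ⊖ f₄ ⊖ f₅) f₆ (ι-⊕′ (⊝ f₁ ⊖ f₂ ⊕ f₃ ⊖ f₄) (⊝ f₅) (ι-⊕′ (⊝ f₁ ⊖ f₂ ⊕ f₃) (⊝ f₄)
          (ι-⊕′ (⊝ f₁ ⊖ f₂) f₃ (ι-⊕′ (⊝ f₁) (⊝ f₂) (ι-⊝′ f₁ e₁) (ι-⊝′ f₂ e₂)) e₃) (ι-⊝′ f₄ e₄)) (ι-⊝′ f₅ e₅)) e₆)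

      rhs : ι RHS ≈ φ 5 5 * products I I-inverse inv₁ inv₂ inv₃ inv₄ inv₅
      rhs = signedSum (poch 1R 25 25) (shift 5 (θ 10 75 ⊛ inv (θ 5 75 ⊛ θ 20 75 ⊛ θ 25 75 ⊛ θ 30 75))) (cζ · shift 6 (inv (θ 15 75 ⊛ θ 25 75 ⊛ θ 35 75))) ((1R +R cζ) · shift 2 (inv (θ 10 25))) (cζ · shift 2 (inv (θ 5 75 ⊛ θ 25 75 ⊛ θ 30 75))) (shift 8 (θ 5 75 ⊛ inv (θ 10 75 ⊛ θ 15 75 ⊛ θ 25 75 ⊛ θ 35 75))) (cζ · shift 3 (θ 20 75 ⊛ inv (θ 10 75 ⊛ θ 15 75 ⊛ θ 25 75 ⊛ θ 35 75))) (poch-φ {25} {25} 5 5 ≡.refl ≡.refl 1≤ 1≤) s₁ s₂ s₃ s₄ s₅ s₆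

    PP3≈RHS : ι (PP3 ζ ζ⁻¹) ≈ ι RHS
    PP3≈RHS = begin
      ι (PP3 ζ ζ⁻¹)
        ≈⟨ ι-PP3 ⟩
      ∑ (4 ℕ.+ N ℕ.* 5) (λ i → ι (PP3-term ζ ζ⁻¹ (suc i)))
        ≈⟨ ∑-cong (4 ℕ.+ N ℕ.* 5) (λ i → term (suc i)) ⟩
      -- With M = N + 1 the length `ℕ.pred (M ℕ.* 5)` of the sum computes to 4 + 5N.
      _ ≈⟨ spt≈products I I-inverse inv₁ inv₂ inv₃ inv₄ inv₅ ⟩
      φ 5 5 * products I I-inverse inv₁ inv₂ inv₃ inv₄ inv₅
        ≈⟨ rhs ⟨
      ι RHS ∎

-- The abstract hypotheses verified modulo each power of q.

module Truncation where

  open Cyclotomic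
  open PowerSeries
  open import Data.Nat using (_≤_; _<_; _∸_; _≡ᵇ_)
  open ≡ using (refl; cong; cong₂)

  private module R = CommutativeRing Zζ-ring

  sumTo-extend : ∀ {m K} f → (∀ i → m ≤ i → f i ≡ 0R) → m ≤ K → sumTo K f ≡ sumTo m f
  sumTo-extend {m} {K} f f≡0 m≤K = ≡.trans (cong (λ k → sumTo k f) (≡.sym (ℕₚ.m∸n+n≡m m≤K))) (extend (K ∸ m))
    where
    extend : ∀ j → sumTo (j ℕ.+ m) f ≡ sumTo m f
    extend zero    = refl
    extend (suc j) = ≡.trans (cong₂ _+R_ (f≡0 (j ℕ.+ m) (ℕₚ.m≤n+m m j)) (extend j)) (R.+-identityˡ (sumTo m f))

  prodTo-extend : ∀ {N m K} F → (∀ j → m ≤ j → F j ≈[ N ] oneS) → m ≤ K → prodTo K F ≈[ N ] prodTo m F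
  prodTo-extend {N} {m} {K} F F≈1 m≤K = ≡.subst (λ k → prodTo k F ≈[ N ] prodTo m F) (ℕₚ.m∸n+n≡m m≤K) (extend (K ∸ m))
    where
    module P = CommutativeRing (truncatedRing N)
    extend : ∀ j → prodTo (j ℕ.+ m) F ≈[ N ] prodTo m F
    extend zero    = P.refl
    extend (suc j) = P.trans (P.*-cong (extend j) (F≈1 (j ℕ.+ m) (ℕₚ.m≤n+m m j))) (P.*-identityʳ (prodTo m F))

  factor-low : ∀ a {m k} → m ≤ k → factor a k ≈[ m ] oneS
  factor-low a {m} {k} m≤k = mod low
    where
    low : ∀ n → n < m → factor a k n ≡ oneS n
    low zero    n<m = refl
    low (suc n) n<m with suc n ≡ᵇ k in eq
    ... | false = refl
    ... | true  = ⊥-elim (ℕₚ.<⇒≢ (ℕₚ.<-≤-trans n<m m≤k) (ℕₚ.≡ᵇ⇒≡ (suc n) k (≡.subst Bool.T (≡.sym eq) tt)))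

  -- Each coefficient of `poch` is taken from a finite product of its own length n + 1. Modulo
  -- q^(n+1) the factors with j > n are one, since k + d j > n, so a common length N serves all n
  -- below N.
  poch-prodTo : ∀ a k d {N} → 1 ≤ k → 1 ≤ d → poch a k d ≈[ N ] prodTo N (λ j → factor a (k ℕ.+ d ℕ.* j))
  poch-prodTo a k (suc d) {N} 1≤k (s≤s _) = mod λ n n<N → ≡.sym (prodTo-extend {suc n} {suc n} {N} (λ j → factor a (k ℕ.+ suc d ℕ.* j))
    (λ j n<j → factor-low a (ℕₚ.≤-trans n<j (ℕₚ.≤-trans (ℕₚ.m≤m+n j (d ℕ.* j)) (ℕₚ.m≤n+m (suc d ℕ.* j) k)))) n<N .at n ℕₚ.≤-refl)

  five-cancelℤ : ∀ a → a ℤ.+ (a ℤ.+ (a ℤ.+ (a ℤ.+ a))) ≡ + 0 → a ≡ + 0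
  five-cancelℤ a eq with ℤₚ.i*j≡0⇒i≡0∨j≡0 (+ 5) (≡.trans (solve 1 (λ a → con (+ 5) :* a := a :+ (a :+ (a :+ (a :+ a)))) refl a) eq)
    where open ℤS.+-*-Solver
  ... | inj₂ a≡0 = a≡0

  five-cancel : ∀ {a} → a +R (a +R (a +R (a +R a))) ≡ 0R → a ≡ 0R
  five-cancel {mk a b c d} eq with refl ← five-cancelℤ a (cong c0 eq) with refl ← five-cancelℤ b (cong c1 eq)
    with refl ← five-cancelℤ c (cong c2 eq) with refl ← five-cancelℤ d (cong c3 eq) = refl

  module Truncated (N : ℕ) where

    open CommutativeRing (truncatedRing N) renaming (refl to ≈-refl; sym to ≈-sym; trans to ≈-trans; zero to *-zero)
    open FiniteIdentities (truncatedRing N)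
    open FifthRoots (truncatedRing N) using (IsFifthRoot)
    open SetoidReasoning setoid

    X^-coefficient : ∀ m n → (X ^ m) n ≡ (if n ≡ᵇ m then 1R else 0R)
    X^-coefficient zero    zero    = refl
    X^-coefficient zero    (suc n) = refl
    X^-coefficient (suc m) zero    = X-⊛-zero (X ^ m)
    X^-coefficient (suc m) (suc n) = ≡.trans (X-⊛-suc (X ^ m) n) (X^-coefficient m n)

    shift≈ : ∀ k f → shift k f ≈ X ^ k * f
    shift≈ zero    f = ≈-sym (*-identityˡ f)
    shift≈ (suc k) f = begin
      shift (suc k) f    ≈⟨ ≐⇒≈ (shift-X k f) ⟩
      X * shift k f      ≈⟨ *-congˡ {X} (shift≈ k f) ⟩
      X * (X ^ k * f)    ≈⟨ *-assoc X (X ^ k) f ⟨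
      X ^ suc k * f      ∎

    X-nilpotent : X ^ N ≈ 0#
    X-nilpotent = mod vanish
      where
      vanish : ∀ n → n < N → (X ^ N) n ≡ 0R
      vanish n n<N with n ≡ᵇ N in eq | X^-coefficient N n
      ... | false | e = e
      ... | true  | e = ⊥-elim (ℕₚ.<⇒≢ n<N (ℕₚ.≡ᵇ⇒≡ n N (≡.subst Bool.T (≡.sym eq) tt)))

    constant-* : ∀ a b → constant a * constant b ≈ constant (a *R b)
    constant-* a b = ≐⇒≈ λ
      { zero    → constant-⊛ a (constant b) 0
      ; (suc n) → ≡.trans (constant-⊛ a (constant b) (suc n)) (R.zeroʳ a) }

    constant-1 : constant 1R ≈ 1#
    constant-1 = ≐⇒≈ λ { zero → refl ; (suc n) → refl }

    constant-^ : ∀ a k → constant a ^ k ≈ constant (a ^R k)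
    constant-^ a zero    = ≈-sym constant-1
    constant-^ a (suc k) = ≈-trans (*-congˡ {constant a} (constant-^ a k)) (constant-* a (a ^R k))

    constant-+ : ∀ a b → constant (a +R b) ≈ constant a + constant b
    constant-+ a b = ≐⇒≈ λ { zero → refl ; (suc n) → refl }

    ·≈ : ∀ a f → a · f ≈ constant a * f
    ·≈ a f = ≐⇒≈ λ n → ≡.sym (constant-⊛ a f n)

    z : FPS
    z = constant ζ

    root : IsFifthRoot z
    root = ≈-trans (+-cong (+-cong (+-cong (≈-refl {1# + z}) (constant-^ ζ 2)) (constant-^ ζ 3)) (constant-^ ζ 4)) (≐⇒≈ λ { zero → refl ; (suc n) → refl })

    factor≈ : ∀ a m → 1 ≤ m → factor a m ≈ 1# + - (constant a * X ^ m)
    factor≈ a (suc m) _ = ≐⇒≈ λ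
      { zero    → ≡.sym (cong (λ x → 1R +R (-R x)) (≡.trans (constant-⊛ a (X ^ suc m) 0) (≡.trans (cong (a *R_) (X^-coefficient (suc m) 0)) (R.zeroʳ a))))
      ; (suc n) → ≡.sym (≡.trans
          (cong (λ x → 0R +R (-R x)) (≡.trans (constant-⊛ a (X ^ suc m) (suc n)) (cong (a *R_) (X^-coefficient (suc m) (suc n)))))
          (value (n ≡ᵇ m))) }
      where
      value : ∀ b → 0R +R (-R (a *R (if b then 1R else 0R))) ≡ (if b then -R a else 0R)
      value true  = ≡.trans (R.+-identityˡ (-R (a *R 1R))) (cong (λ x → -R x) (R.*-identityʳ a))
      value false = cong (λ x → 0R +R (-R x)) (R.zeroʳ a)

    ∑-coefficient : ∀ n f k → ∑ n f k ≡ sumTo n (λ i → f i k)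
    ∑-coefficient zero    f k = refl
    ∑-coefficient (suc n) f k = ≡.trans (cong (f 0 k +R_) (∑-coefficient n (λ i → f (suc i)) k)) (≡.sym (sumTo-head n (λ i → f i k)))

    five-cancelₛ : ∀ {f} → f + (f + (f + (f + f))) ≈ 0# → f ≈ 0#
    five-cancelₛ eq = mod λ n n<N → five-cancel (eq .at n n<N)

    -- The term of index i + 1 starts at degree (i + 1)² + i + 1, so lengthening the sum beyond n
    -- terms leaves the coefficient of qⁿ unchanged. The length 4 + 5N is the one that the
    -- dissection into complete blocks of five produces, less the term n = 0.
    PP3≈sum : PP3 ζ ζ⁻¹ ≈ ∑ (4 ℕ.+ N ℕ.* 5) (λ i → PP3-term ζ ζ⁻¹ (suc i))
    PP3≈sum = mod λ n n<N → ≡.sym (≡.trans (∑-coefficient (4 ℕ.+ N ℕ.* 5) (λ i → PP3-term ζ ζ⁻¹ (suc i)) n)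
      (sumTo-extend {n} {4 ℕ.+ N ℕ.* 5} (λ i → PP3-term ζ ζ⁻¹ (suc i) n)
        (λ i n≤i → shift-< {suc i ℕ.* suc i ℕ.+ suc i} {n}
          (poch 1R (2 ℕ.* suc i ℕ.+ 1) 1 ⊛ inv (poch ζ (suc i) 1 ⊛ poch ζ⁻¹ (suc i) 1)) (ℕₚ.<-≤-trans (ℕ.s≤s n≤i) (ℕₚ.m≤n+m (suc i) (suc i ℕ.* suc i))))
        (ℕₚ.≤-trans (ℕₚ.<⇒≤ n<N) (ℕₚ.≤-trans (ℕₚ.m≤m*n N 5) (ℕₚ.m≤n+m (N ℕ.* 5) 4)))))

    -- The interpretation is the identity map, because reduction lives in the equality of
    -- `truncatedRing`. The coefficient of qⁿ is then settled by N = n + 1.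
    congruence : PP3 ζ ζ⁻¹ ≈[ N ] RHS
    congruence = Transfer.Interpretation.PP3≈RHS (truncatedRing N)
      five-cancelₛ {X} {N} X-nilpotent constant constant-1 constant-+ (λ a k → ≈-sym (constant-^ a k)) root
      (λ f → f)
      ≈-refl
      (λ f g → ≈-refl {f ⊕ g})
      (λ f → ≈-refl {⊝ f})
      (λ f g → ≈-refl {f ⊛ g})
      ·≈
      shift≈
      factor≈
      (λ a k d 1≤k 1≤d → poch-prodTo a k d 1≤k 1≤d)
      (λ f f₀ → ≐⇒≈ (inv-inverse f f₀))
      PP3≈sum

theorem11 : PP3 ζ ζ⁻¹ ≐ RHS
theorem11 n = PowerSeries.at (Truncation.Truncated.congruence (suc n)) n ℕₚ.≤-refl
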